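{- Let $1\le b\le m$ be integers and let $U=\{u_1\le u_2\le\dots\le u_b\}\subset(0,1)$ be inverse bike speeds with $u_b\le T(m,U)$, where $T(m,U)=1-\frac1m\sum_{j=1}^b(1-u_j)$. Then the algorithm $\mathrm{AllMakeIt}^*$ on input $(m,U)$ solves the Relaxed Bike Sharing problem optimally: the schedule $(X,M)$ it produces is feasible and $\tau(X,M)\le\tau(X',M')$ for every feasible schedule $(X',M')$ (with any number of bikes abandoned).
   Context: There are $m$ agents and $b$ bikes, all starting at the point $0$ of the interval $[0,1]$. Bike $k$ has inverse speed $u_k$; label $0$ denotes walking, with inverse speed $1$. A schedule of size $n$ is a pair $(X,M)$, where $X=(x_1,\dots,x_n)$ satisfies $x_j\ge 0$ and $\sum_j x_j=1$ (consecutive subintervals of $[0,1]$ and their lengths), and $M$ is an $m\times n$ matrix with entries in $\{0,1,\dots,b\}$; $M(i,j)$ is the label of the bike used by agent $i$ on subinterval $x_j$ ($0$ if agent $i$ walks). Let $\widetilde M(i,j)=u_{M(i,j)}$ if $M(i,j)\ne 0$ and $\widetilde M(i,j)=1$ if $M(i,j)=0$. Put $t_{i,j}=\sum_{k=1}^{j}\widetilde M(i,k)x_k$, $t_i=t_{i,n}$, and $\tau(X,M)=\max_i t_i$. $(X,M)$ is feasible if: (1) for $j\ge2$, $M(i,j)\ne0$ implies there is $i'$ with $M(i',j-1)=M(i,j)$; (2) $M(i,j)\ne 0$ implies $M(i',j)\ne M(i,j)$ for all $i'\ne i$; (3) for $j\ge 2$, $M(i,j)=M(i',j-1)\neq0$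 implies $t_{i',j-1}\le t_{i,j-1}$. The Relaxed Bike Sharing problem asks for a feasible schedule minimizing $\tau$; bikes need not be used all the way to the end. Induced partition vector. For a schedule matrix $M$ satisfying (1) and (2), consider the linear program in variables $\tau,x_1,\dots,x_n$: minimize $\tau$ subject to $\tau\ge t_i$ for all $i$; $t_{i',j-1}\le t_{i,j-1}$ whenever $M(i,j)=M(i',j-1)\ne0$, $i\ne i'$; $x_j\ge0$; $\sum_jx_j=1$. An induced partition vector $X_M$ is the $X$-part of an optimal vertex of this program. Standard form. In a schedule $(X,M)$ a zero column is a column $j$ with $x_j=0$; a redundant column is a column $j\geq 2$ of $M$ identical to column $j-1$; a swap-switch is a triple $(i,i',j)$ with $i\ne i'$, $M(i,j)=M(i',j-1)\ne0$ and $t_{i,j-1}=t_{i',j-1}$. The schedule is in standard form if it has none of these. Standardize$(X,M)$ brings a feasible schedule to standard form by deleting zero columns (with their entry of $X$), deleting a redundant column $j$ and merging $x_{j}$ into $x_{j-1}$, and removing a swap-switch $(i,i',j)$ by exchanging rows $i$ and $i'$ of $M$ in columns $j,j+1,\dots,n$. Reduce$(U,M)$: set $X=X_M$; repeat [$(X,M)\leftarrow$ Standardize$(X,M)$; $X\leftarrow X_M$] until $(X,M)$ is in standard form; return $M$. $\mathrm{AllMakeIt}^*(m,U)$. Put $m_k=m-b+k$, $U_k=\{u_1,\dots,u_k\}$. Let $DP[0]$ be the zero column with $m-b$ rows (one column, with no rows if $m=b$). For $k=1,\dots,b$, form a matrix $M$ with $m_k$ rows as the concatenation, left to right, of: for $j=1,\dots,m-b$,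 a single column whose entry in row $i$ is $i-j+1$ if $j\le i\le j+k-1$ and $0$ otherwise; then, for $l=0,\dots,k-1$, a block with as many columns as $DP[l]$, whose rows $1,\dots,m_l$ are $DP[l]$ and whose row $i$, for $m_l<i\le m_k$, has all entries equal to $i-(m-b)$. Set $DP[k]=$ Reduce$(U_k,M)$. The schedule produced is $(X_M,M)$ with $M=DP[b]$. -}

module Defs where

open import Algebra.Bundles using (CommutativeRing)
open import Algebra.Core using (Op₁; Op₂)
open import Algebra.Structures using (IsCommutativeRing)
import Algebra.Construct.NaturalChoice.Max as NaturalMax
import Algebra.Definitions.RawMonoid as RawMonoid
open import Data.Fin.Base as Fin using
  (Fin; zero; suc; toℕ; fromℕ<; cast; splitAt; inject≤; inject!)
open import Data.Fin.Permutation.Components using (transpose)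
open import Data.Nat.Base as ℕ using (ℕ; zero; suc; _∸_)
open import Data.Nat.Properties using (_≤?_; _<?_; ≤-refl; <⇒≤; m∸n+n≡m)
open import Data.Product.Base using (_×_; _,_; ∃)
open import Data.Sum.Base using ([_,_]′)
open import Data.Vec.Functional using
  (Vector; head; tail; foldr; removeAt; updateAt; _++_)
open import Function.Base using (_∘_; const)
open import Level using (_⊔_)
open import Relation.Binary.Bundles using (DecTotalOrder)
open import Relation.Binary.Construct.Closure.ReflexiveTransitive using (Star)
import Relation.Binary.Construct.NonStrictToStrict as Strict
open import Relation.Binary.Core using (Rel)
open import Relation.Binary.PropositionalEquality.Core using (_≡_; _≢_; sym)
open import Relation.Binary.Structures using (IsDecTotalOrder)
open import Relation.Nullary using (¬_; yes; no)

------------------------------------------------------------------------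
-- Ordered fields

-- The classical real numbers are an instance. The value of 0# ⁻¹ is
-- unspecified.
record OrderedField c ℓ₁ ℓ₂ : Set (Level.suc (c ⊔ ℓ₁ ⊔ ℓ₂)) where
  infix  9 _⁻¹
  infix  8 -_
  infixl 7 _*_
  infixl 6 _+_
  infix  4 _≈_ _≤_
  field
    Carrier           : Set c
    _≈_               : Rel Carrier ℓ₁
    _≤_               : Rel Carrier ℓ₂
    _+_ _*_           : Op₂ Carrier
    -_ _⁻¹            : Op₁ Carrier
    0# 1#             : Carrier
    isCommutativeRing : IsCommutativeRing _≈_ _+_ _*_ -_ 0# 1#
    isDecTotalOrder   : IsDecTotalOrder _≈_ _≤_
    0≉1               : ¬ 0# ≈ 1#
    ⁻¹-inverseʳ       : ∀ x → ¬ x ≈ 0# → x * x ⁻¹ ≈ 1#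
    +-monoˡ-≤         : ∀ z {x y} → x ≤ y → x + z ≤ y + z
    *-nonNegative     : ∀ {x y} → 0# ≤ x → 0# ≤ y → 0# ≤ x * y

  commutativeRing : CommutativeRing c ℓ₁
  commutativeRing = record { isCommutativeRing = isCommutativeRing }

  decTotalOrder : DecTotalOrder c ℓ₁ ℓ₂
  decTotalOrder = record { isDecTotalOrder = isDecTotalOrder }

  open CommutativeRing commutativeRing public using (_-_)
  open RawMonoid (CommutativeRing.+-rawMonoid commutativeRing) public
    using (sum) renaming (_×_ to _·_)
  open NaturalMax (DecTotalOrder.totalOrder decTotalOrder) public
    using () renaming (_⊔_ to max)
  open Strict _≈_ _≤_ public using (_<_)

  -- The empty vector gets the junk value 0#.
  maximum : ∀ {n} → Vector Carrier n → Carrier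
  maximum {zero}  v = 0#
  maximum {suc n} v = foldr max (head v) (tail v)

------------------------------------------------------------------------
-- Schedule matrices

-- Label zero is walking; label suc k is the bike with inverse speed u k.
Label : ℕ → Set
Label b = Fin (suc b)

Matrix : (m n b : ℕ) → Set
Matrix m n b = Fin m → Fin n → Label b

record SizedMatrix (m b : ℕ) : Set where
  constructor sized
  field
    {size} : ℕ
    matrix : Matrix m size b

-- j′ = j - 1, for a column j other than the first.
_PrecedesCol_ : ∀ {n} → Fin n → Fin n → Set
j′ PrecedesCol j = suc (toℕ j′) ≡ toℕ j

module _ {m n b} (M : Matrix m n b) where

  BikesAvailable : Set
  BikesAvailable = ∀ i {j′ j} → j′ PrecedesCol j → M i j ≢ zero →
                   ∃ λ i′ → M i′ j′ ≡ M i j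

  BikesUnshared : Set
  BikesUnshared = ∀ i j → M i j ≢ zero → ∀ i′ → i′ ≢ i → M i′ j ≢ M i j

  RedundantColumn : (j′ j : Fin n) → Set
  RedundantColumn j′ j = j′ PrecedesCol j × (∀ i → M i j ≡ M i j′)

  -- Rows i and i′ exchanged in column j and everything to its right.
  exchangeFrom : (i i′ : Fin m) (j : Fin n) → Matrix m n b
  exchangeFrom i i′ j r c with toℕ j ≤? toℕ c
  ... | yes _ = M (transpose i i′ r) c
  ... | no  _ = M r c

------------------------------------------------------------------------
-- The matrices built by AllMakeIt*, with w = m - b

-- With 0-based rows and columns, the entry is the bike numbered (from 1)
-- i - j + 1 when 0 ≤ i - j < k.
shiftColumns : ∀ w k → Matrix (w ℕ.+ k) w k
shiftColumns w k i j with toℕ j ≤? toℕ i | (toℕ i ∸ toℕ j) <? k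
... | yes _ | yes i-j<k = suc (fromℕ< i-j<k)
... | _     | _         = zero

-- Row w + r (0-based) keeps the bike numbered r + 1. The value on the
-- first w rows is never used.
ownBike : ∀ w {k} → Fin (w ℕ.+ k) → Label k
ownBike w i = [ const zero , suc ]′ (splitAt w i)

extend : ∀ w {k l n} → l ℕ.≤ k → Matrix (w ℕ.+ l) n l → Matrix (w ℕ.+ k) n k
extend w {l = l} l≤k M i j with toℕ i <? w ℕ.+ l
... | yes i<w+l = inject≤ (M (fromℕ< i<w+l) j) (ℕ.s≤s l≤k)
... | no  _     = ownBike w i

Table : ℕ → Set
Table w = ∀ k → SizedMatrix (w ℕ.+ k) k

-- The blocks of DP[0], …, DP[l - 1] appended, in this order, to the shift
-- columns.
concatenation : ∀ w k → Table w → ∀ l → l ℕ.≤ k → SizedMatrix (w ℕ.+ k) k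
concatenation w k DP zero    _   = sized (shiftColumns w k)
concatenation w k DP (suc l) l<k = sized λ i → M i ++ N i
  where
  open SizedMatrix (concatenation w k DP l (<⇒≤ l<k)) renaming (matrix to M)
  N = extend w (<⇒≤ l<k) (SizedMatrix.matrix (DP l))

------------------------------------------------------------------------

module BikeSharing {c ℓ₁ ℓ₂} (F : OrderedField c ℓ₁ ℓ₂) where
  open OrderedField F

  record Schedule (m b : ℕ) : Set c where
    constructor schedule
    field
      {size} : ℕ
      X      : Vector Carrier size
      M      : Matrix m size b

  T : ∀ m {b} → Vector Carrier b → Carrier
  T m u = 1# - (m · 1#) ⁻¹ * sum λ j → 1# - u j

  module _ {b} (u : Vector Carrier b) where

    pace : Label b → Carrier
    pace zero    = 1#
    pace (suc k) = u k

    module _ {m n} (X : Vector Carrier n) (M : Matrix m n b) where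

      -- t i j is the time of agent i at the right end of subinterval j.
      t : Fin m → Fin n → Carrier
      t i j = sum {suc (toℕ j)} λ k →
        pace (M i (inject! {i = suc j} k)) * X (inject! {i = suc j} k)

      arrival : Fin m → Carrier
      arrival i = sum λ k → pace (M i k) * X k

      IsPartition : Set (ℓ₁ ⊔ ℓ₂)
      IsPartition = (∀ j → 0# ≤ X j) × sum X ≈ 1#

      SwapSwitch : (i i′ : Fin m) (j′ j : Fin n) → Set ℓ₁
      SwapSwitch i i′ j′ j = j′ PrecedesCol j × i ≢ i′ × M i j ≡ M i′ j′ ×
                             M i j ≢ zero × t i j′ ≈ t i′ j′

    τ : ∀ {m} → Schedule m b → Carrier
    τ (schedule X M) = maximum (arrival X M)

    record Feasible {m} (S : Schedule m b) : Set (ℓ₁ ⊔ ℓ₂) where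
      open Schedule S
      field
        isPartition : IsPartition X M
        available   : BikesAvailable M
        unshared    : BikesUnshared M
        inTime      : ∀ i i′ {j′ j} → j′ PrecedesCol j → M i j ≡ M i′ j′ →
                      M i j ≢ zero → t X M i′ j′ ≤ t X M i j′

    OptimalSchedule : ∀ {m} → Schedule m b → Set (c ⊔ ℓ₁ ⊔ ℓ₂)
    OptimalSchedule {m} S =
      Feasible S × (∀ (S′ : Schedule m b) → Feasible S′ → τ S ≤ τ S′)

    ----------------------------------------------------------------------
    -- The linear program, in the variables (s , X)

    module _ {m n} (M : Matrix m n b) where

      record LPFeasible (s : Carrier) (X : Vector Carrier n) :
                        Set (ℓ₁ ⊔ ℓ₂) where
        field
          makespan    : ∀ i → arrival X M i ≤ s
          inTime      : ∀ i i′ {j′ j} → j′ PrecedesCol j → i ≢ i′ →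
                        M i j ≡ M i′ j′ → M i j ≢ zero →
                        t X M i′ j′ ≤ t X M i j′
          isPartition : IsPartition X M

      LPOptimal : Carrier → Vector Carrier n → Set (c ⊔ ℓ₁ ⊔ ℓ₂)
      LPOptimal s X =
        LPFeasible s X × (∀ s′ X′ → LPFeasible s′ X′ → s ≤ s′)

      -- A vertex is an extreme point of the feasible polyhedron.
      LPVertex : Carrier → Vector Carrier n → Set (c ⊔ ℓ₁ ⊔ ℓ₂)
      LPVertex s X = LPFeasible s X ×
        (∀ s₁ X₁ s₂ X₂ → LPFeasible s₁ X₁ → LPFeasible s₂ X₂ →
         ∀ a → 0# < a → a < 1# →
         s ≈ a * s₁ + (1# - a) * s₂ →
         (∀ j → X j ≈ a * X₁ j + (1# - a) * X₂ j) →
         s₁ ≈ s₂ × (∀ j → X₁ j ≈ X₂ j))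

      -- The linear program may have several optimal vertices, so "X is X_M"
      -- is a relation.
      InducedPartition : Vector Carrier n → Set (c ⊔ ℓ₁ ⊔ ℓ₂)
      InducedPartition X = ∃ λ s → LPOptimal s X × LPVertex s X

    ----------------------------------------------------------------------
    -- Standard form

    record StandardForm {m} (S : Schedule m b) : Set ℓ₁ where
      open Schedule S
      field
        noZeroColumn      : ∀ j → ¬ X j ≈ 0#
        noRedundantColumn : ∀ j′ j → ¬ RedundantColumn M j′ j
        noSwapSwitch      : ∀ i i′ j′ j → ¬ SwapSwitch X M i i′ j′ j

    infix 4 _⟶_

    data _⟶_ {m} : Rel (Schedule m b) (c ⊔ ℓ₁) where
      deleteZero : ∀ {n} (X : Vector Carrier (suc n)) M j →
        X j ≈ 0# →
        schedule X M ⟶ schedule (removeAt X j) (λ i → removeAt (M i) j)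
      deleteRedundant : ∀ {n} (X : Vector Carrier (suc n)) M j′ j →
        RedundantColumn M j′ j →
        schedule X M ⟶ schedule (removeAt (updateAt X j′ (_+ X j)) j)
                                (λ i → removeAt (M i) j)
      removeSwitch : ∀ {n} (X : Vector Carrier n) M i i′ j′ j →
        SwapSwitch X M i i′ j′ j →
        schedule X M ⟶ schedule X (exchangeFrom M i i′ j)

    -- The order in which the defects are removed is left open.
    Standardize : ∀ {m} → Rel (Schedule m b) (c ⊔ ℓ₁)
    Standardize S S′ = Star _⟶_ S S′ × StandardForm S′

    -- RepeatUntil S P: the loop of Reduce, entered with the schedule S, can
    -- exit with the matrix P.
    data RepeatUntil {m} : Schedule m b → SizedMatrix m b →
                           Set (c ⊔ ℓ₁ ⊔ ℓ₂) where
      exit : ∀ {S n X X′} {M : Matrix m n b} →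
        Standardize S (schedule X M) → InducedPartition M X′ →
        StandardForm (schedule X′ M) →
        RepeatUntil S (sized M)
      again : ∀ {S n X X′ P} {M : Matrix m n b} →
        Standardize S (schedule X M) → InducedPartition M X′ →
        ¬ StandardForm (schedule X′ M) →
        RepeatUntil (schedule X′ M) P →
        RepeatUntil S P

    Reduce : ∀ {m} → SizedMatrix m b → SizedMatrix m b → Set (c ⊔ ℓ₁ ⊔ ℓ₂)
    Reduce (sized M) P =
      ∃ λ X → InducedPartition M X × RepeatUntil (schedule X M) P

  ------------------------------------------------------------------------
  -- AllMakeIt*

  -- The entries DP k with k > b play no role.
  record IsDPTable {b} (u : Vector Carrier b) w (DP : Table w) :
                   Set (c ⊔ ℓ₁ ⊔ ℓ₂) where
    field
      base : DP 0 ≡ sized {size = 1} (λ _ _ → zero)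
      step : ∀ k → 1 ℕ.≤ k → (k≤b : k ℕ.≤ b) →
             Reduce (λ r → u (inject≤ r k≤b))
                    (concatenation w k DP k ≤-refl) (DP k)

  -- The last table entry has m ∸ b + b rows, hence the cast.
  finalMatrix : ∀ {m b} → b ℕ.≤ m → Table (m ∸ b) → SizedMatrix m b
  finalMatrix {b = b} b≤m DP =
    sized λ i → SizedMatrix.matrix (DP b) (cast (sym (m∸n+n≡m b≤m)) i)

  -- AllMakeIt* m u b≤m S: some execution on input (m , u) produces S.
  data AllMakeIt* m {b} (u : Vector Carrier b) (b≤m : b ℕ.≤ m) :
                  Schedule m b → Set (c ⊔ ℓ₁ ⊔ ℓ₂) where
    produces : ∀ DP → IsDPTable u (m ∸ b) DP →
      let open SizedMatrix (finalMatrix b≤m DP) in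
      ∀ X → InducedPartition u matrix X →
      AllMakeIt* m u b≤m (schedule X matrix)

{-# OPTIONS --safe #-}

-- At every point of [0,1] the bikes in use are distinct, so the arrival times
-- of the m agents add up to at least m T(m,U), with equality if every bike is
-- always in use; hence T(m,U) ≤ τ. Call a schedule on time if every bike is
-- always in use and everybody arrives at T(m,U). Standardize keeps a schedule
-- on time, and so does passing to an optimal vertex of the linear program.
-- Reduce terminates because every deleted column lowers the number of columns
-- and every removed swap-switch lowers the number of label changes along the
-- rows.
--
-- It remains to find, by induction on k, lengths that put the concatenated
-- matrix on time. In shift column j, agent j on the fastest bike catches up
-- with the agents before it, who walk together. Likewise the block of DP[l] is
-- scaled such that agent m_l + 1 on bike l + 1 catches up with the agents
-- 1, …, m_l, who stay together by the induction hypothesis; this works because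
-- u_{l+1} < T(m_l,U_l). If equality holds here for some l < k, then it holds
-- for l = k - 1, and only the last block gets a positive length.

module Submission where

open import Defs
open import Algebra.Bundles using (CommutativeMonoid; CommutativeRing)
import Algebra.Construct.NaturalChoice.Max as NaturalMax
import Algebra.Properties.CommutativeMonoid.Sum as MonoidSum
import Algebra.Properties.CommutativeSemigroup as CommutativeSemigroupProperties
import Algebra.Properties.Ring as RingProperties
import Algebra.Properties.Semiring.Mult.TCOptimised as SemiringMult
import Algebra.Properties.Semiring.Sum as SemiringSum
import Algebra.Solver.Ring as RingSolver
open import Algebra.Solver.Ring.AlmostCommutativeRing
  using (fromCommutativeRing; _-Raw-AlmostCommutative⟶_)
open import Data.Fin.Base as Fin using
  (Fin; zero; suc; toℕ; fromℕ<; inject≤; inject!; cast; splitAt; punchIn; punchOut; _↑ˡ_; _↑ʳ_)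
open import Data.Fin.Permutation.Components using (transpose; transpose-inverse)
import Data.Fin.Properties as Finₚ
open import Data.Integer.Base as ℤ using (ℤ; -[1+_]; _⊖_) renaming (+_ to pos)
import Data.Integer.Properties as ℤₚ
open import Data.List.Base as List using (List; []; _∷_)
open import Data.List.Relation.Unary.All as All using (All; []; _∷_)
import Data.List.Relation.Unary.All.Properties as Allₚ
import Data.Maybe.Base as Maybe
open import Data.Nat.Base as ℕ using (ℕ; zero; suc; z≤n; s≤s; _∸_)
import Data.Nat.Induction as ℕᵢ
import Data.Nat.Properties as ℕₚ
open import Data.Product.Base using (_×_; _,_; ∃; proj₁; proj₂; uncurry)
open import Data.Product.Relation.Binary.Lex.Strict using (×-Lex; ×-wellFounded)
open import Data.Sum.Base as Sum using (_⊎_; inj₁; inj₂)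
open import Data.Vec.Functional as Vector using
  (Vector; foldr; head; tail; removeAt; updateAt; _++_)
open import Data.Vec.Functional.Properties using
  (lookup-++ˡ; lookup-++ʳ; updateAt-updates; updateAt-minimal)
open import Function.Base using (_∘_; id)
open import Induction.WellFounded using (Acc; acc; WellFounded)
open import Level using (Level; _⊔_)
open import Relation.Binary.Bundles using (DecTotalOrder)
open import Relation.Binary.Construct.Closure.ReflexiveTransitive using (Star; ε; _◅_; _◅◅_)
open import Relation.Binary.Definitions using (tri<; tri≈; tri>)
open import Relation.Binary.PropositionalEquality as ≡ using (_≡_; _≢_)
import Relation.Binary.Reasoning.Setoid as SetoidReasoning
open import Relation.Nullary using (¬_; Dec; yes; no; contradiction)
open import Relation.Nullary.Decidable using (dec⇒maybe; ¬?; _×-dec_)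

-- `AllMakeIt*` is a relation: neither the optimal vertex nor the order of the standardization steps
-- is determined. So the invariant has to survive every choice, and an execution has to be shown to
-- exist. Over an arbitrary ordered field compactness cannot supply optimal vertices; elimination of
-- variables does. The comparison of u_{l+1} with T(m_l,U_l) is governed by one quantity, `slack`.
-- With bikes numbered from 0, it is (w + j)(T - u j) for the T before bike j is added, and also (w
-- + j + 1)(T′ - u j) for the T′ after it, because one more agent on bike j raises the total arrival
-- time by exactly u j. The second form turns the hypothesis u_b ≤ T(m,U) into nonnegativity at the
-- last bike; the first is what scaling a block divides by, up to a factor. Sortedness makes `slack`
-- antitone, so nonnegativity spreads to all bikes, and once it vanishes it stays zero. For m = b it
-- vanishes from the start: there are no shift columns, and the case of equality is the only one.

-- Arithmetic, finite sums and maxima in an ordered field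

module FieldProperties {c ℓ₁ ℓ₂} (F : OrderedField c ℓ₁ ℓ₂) where
  open OrderedField F
  open CommutativeRing commutativeRing public
    using (setoid; refl; sym; trans; reflexive; +-cong; +-congˡ; +-congʳ; *-cong; *-congˡ; *-congʳ;
           +-assoc; +-comm; +-identityˡ; +-identityʳ; *-assoc; *-comm; *-identityˡ;
           *-identityʳ; zeroˡ; zeroʳ; distribˡ; distribʳ; -‿cong; -‿inverseʳ)
  open CommutativeRing commutativeRing using (ring; semiring)
  open RingProperties ring using (-0#≈0#; -‿+-comm; -‿distribˡ-*; -‿distribʳ-*; -‿involutive)
  open SemiringMult semiring using (1+×; ×-homo-+; ×1-homo-*) renaming (_×_ to _×′_)
  open SemiringSum semiring public
    using (sum-cong-≋; sum-remove; ∑-distrib-+; ∑-comm; sum-replicate;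
           sum-replicate-zero; *-distribˡ-sum; *-distribʳ-sum)
  open DecTotalOrder decTotalOrder public
    using (_≟_; _≤?_; total; antisym; ≤-respʳ-≈; ≤-respˡ-≈)
    renaming (refl to ≤-refl; reflexive to ≤-reflexive; trans to ≤-trans)

  open CommutativeSemigroupProperties
    (CommutativeMonoid.commutativeSemigroup (CommutativeRing.+-commutativeMonoid commutativeRing))
    using (interchange)
  open NaturalMax (DecTotalOrder.totalOrder decTotalOrder) using (⊔-lub; x≤x⊔y; x≤y⊔x)

  private
    open SetoidReasoning setoid

    -- Integer coefficients let the ring solver decide equality of constants by computation. With
    -- the optimised multiple, `1 ×′ 1#` reduces to `1#`, so the solver constants `:0` and `:1`
    -- denote `0#` and `1#` themselves.
    fromℤ : ℤ → Carrier
    fromℤ (pos n)  = n ×′ 1#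
    fromℤ -[1+ n ] = - (suc n ×′ 1#)

    fromℤ-⊖ : ∀ m n → fromℤ (m ⊖ n) ≈ m ×′ 1# - n ×′ 1#
    fromℤ-⊖ zero    zero    = sym (-‿inverseʳ _)
    fromℤ-⊖ zero    (suc n) = sym (+-identityˡ _)
    fromℤ-⊖ (suc m) zero    = sym (trans (+-congˡ -0#≈0#) (+-identityʳ _))
    fromℤ-⊖ (suc m) (suc n) = begin
      fromℤ (suc m ⊖ suc n)                ≡⟨ ≡.cong fromℤ (ℤₚ.[1+m]⊖[1+n]≡m⊖n m n) ⟩
      fromℤ (m ⊖ n)                        ≈⟨ fromℤ-⊖ m n ⟩
      m ×′ 1# - n ×′ 1#                    ≈⟨ +-identityˡ _ ⟨
      0# + (m ×′ 1# - n ×′ 1#)             ≈⟨ +-congʳ (-‿inverseʳ 1#) ⟨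
      1# - 1# + (m ×′ 1# - n ×′ 1#)        ≈⟨ interchange 1# (- 1#) (m ×′ 1#) (- (n ×′ 1#)) ⟩
      1# + m ×′ 1# + (- 1# - n ×′ 1#)      ≈⟨ +-congˡ (-‿+-comm _ _) ⟩
      1# + m ×′ 1# - (1# + n ×′ 1#)        ≈⟨ +-cong (1+× m 1#) (-‿cong (1+× n 1#)) ⟨
      suc m ×′ 1# - suc n ×′ 1#            ∎

    fromℤ-neg : ∀ i → fromℤ (ℤ.- i) ≈ - fromℤ i
    fromℤ-neg (pos zero)    = sym -0#≈0#
    fromℤ-neg (pos (suc n)) = refl
    fromℤ-neg -[1+ n ]      = sym (-‿involutive _)

    fromℤ-+ : ∀ i j → fromℤ (i ℤ.+ j) ≈ fromℤ i + fromℤ j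
    fromℤ-+ (pos m)  (pos n)  = ×-homo-+ 1# m n
    fromℤ-+ (pos m)  -[1+ n ] = fromℤ-⊖ m (suc n)
    fromℤ-+ -[1+ m ] (pos n)  = trans (fromℤ-⊖ n (suc m)) (+-comm _ _)
    fromℤ-+ -[1+ m ] -[1+ n ] = begin
      - (suc (suc (m ℕ.+ n)) ×′ 1#)       ≡⟨ ≡.cong (λ k → - (suc k ×′ 1#)) (≡.sym (ℕₚ.+-suc m n)) ⟩
      - ((suc m ℕ.+ suc n) ×′ 1#)         ≈⟨ -‿cong (×-homo-+ 1# (suc m) (suc n)) ⟩
      - (suc m ×′ 1# + suc n ×′ 1#)        ≈⟨ -‿+-comm _ _ ⟨
      - (suc m ×′ 1#) - suc n ×′ 1#        ∎

    fromℤ-*ᵖ : ∀ m j → fromℤ (pos m ℤ.* j) ≈ m ×′ 1# * fromℤ j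
    fromℤ-*ᵖ m (pos n)  = trans (reflexive (≡.cong fromℤ (≡.sym (ℤₚ.pos-* m n)))) (×1-homo-* m n)
    fromℤ-*ᵖ m -[1+ n ] = begin
      fromℤ (pos m ℤ.* -[1+ n ])           ≡⟨ ≡.cong fromℤ (ℤₚ.neg-distribʳ-* (pos m) (pos (suc n))) ⟨
      fromℤ (ℤ.- (pos m ℤ.* pos (suc n)))  ≈⟨ fromℤ-neg (pos m ℤ.* pos (suc n)) ⟩
      - fromℤ (pos m ℤ.* pos (suc n))      ≈⟨ -‿cong (fromℤ-*ᵖ m (pos (suc n))) ⟩
      - (m ×′ 1# * suc n ×′ 1#)              ≈⟨ -‿distribʳ-* _ _ ⟩
      m ×′ 1# * - (suc n ×′ 1#)              ∎

    fromℤ-* : ∀ i j → fromℤ (i ℤ.* j) ≈ fromℤ i * fromℤ j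
    fromℤ-* (pos m)  j = fromℤ-*ᵖ m j
    fromℤ-* -[1+ m ] j = begin
      fromℤ (-[1+ m ] ℤ.* j)               ≡⟨ ≡.cong fromℤ (ℤₚ.neg-distribˡ-* (pos (suc m)) j) ⟨
      fromℤ (ℤ.- (pos (suc m) ℤ.* j))      ≈⟨ fromℤ-neg (pos (suc m) ℤ.* j) ⟩
      - fromℤ (pos (suc m) ℤ.* j)          ≈⟨ -‿cong (fromℤ-*ᵖ (suc m) j) ⟩
      - (suc m ×′ 1# * fromℤ j)             ≈⟨ -‿distribˡ-* _ _ ⟩
      - (suc m ×′ 1#) * fromℤ j             ∎

    fromℤ-morphism : CommutativeRing.rawRing ℤₚ.+-*-commutativeRing
                       -Raw-AlmostCommutative⟶ fromCommutativeRing commutativeRing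
    fromℤ-morphism = record
      { ⟦_⟧    = fromℤ
      ; +-homo = fromℤ-+
      ; *-homo = fromℤ-*
      ; -‿homo = fromℤ-neg
      ; 0-homo = refl
      ; 1-homo = refl
      }

  open RingSolver _ _ fromℤ-morphism
    (λ i j → Maybe.map (reflexive ∘ ≡.cong fromℤ) (dec⇒maybe (i ℤₚ.≟ j))) public
    using (Polynomial; solve; _:+_; _:*_; _:-_; :-_; _:=_)
    renaming (con to :con)

  :0 :1 : ∀ {n} → Polynomial n
  :0 = :con (pos 0)
  :1 = :con (pos 1)

  0≤y-x : ∀ {x y} → x ≤ y → 0# ≤ y - x
  0≤y-x {x} {y} x≤y = ≤-respˡ-≈ (-‿inverseʳ x) (+-monoˡ-≤ (- x) x≤y)

  x≤x+d : ∀ {x y d} → 0# ≤ d → y ≈ x + d → x ≤ y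
  x≤x+d {x} {y} {d} 0≤d y≈x+d = ≤-respˡ-≈ (+-identityˡ x)
    (≤-respʳ-≈ (trans (+-comm d x) (sym y≈x+d)) (+-monoˡ-≤ x 0≤d))

  +-nonNegative : ∀ {x y} → 0# ≤ x → 0# ≤ y → 0# ≤ x + y
  +-nonNegative {x} 0≤x 0≤y = ≤-trans 0≤x (x≤x+d 0≤y refl)

  +-mono-≤ : ∀ {x y x′ y′} → x ≤ y → x′ ≤ y′ → x + x′ ≤ y + y′
  +-mono-≤ {x} {y} {x′} {y′} x≤y x′≤y′ = x≤x+d (+-nonNegative (0≤y-x x≤y) (0≤y-x x′≤y′))
    (solve 4 (λ x y x′ y′ → y :+ y′ := x :+ x′ :+ ((y :- x) :+ (y′ :- x′))) refl x y x′ y′)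

  +-cancelʳ-≤ : ∀ {x y} z → x + z ≤ y + z → x ≤ y
  +-cancelʳ-≤ {x} {y} z p = x≤x+d (0≤y-x p)
    (solve 3 (λ x y z → y := x :+ (y :+ z :- (x :+ z))) refl x y z)

  +-cancelʳ-≈ : ∀ {x y} z → x + z ≈ y + z → x ≈ y
  +-cancelʳ-≈ z p = antisym (+-cancelʳ-≤ z (≤-reflexive p)) (+-cancelʳ-≤ z (≤-reflexive (sym p)))

  neg-mono-≤ : ∀ {x y} → x ≤ y → - y ≤ - x
  neg-mono-≤ {x} {y} x≤y = x≤x+d (0≤y-x x≤y)
    (solve 2 (λ x y → :- x := :- y :+ (y :- x)) refl x y)

  *-monoˡ-≤ : ∀ {x y z} → 0# ≤ z → x ≤ y → z * x ≤ z * y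
  *-monoˡ-≤ {x} {y} {z} 0≤z x≤y = x≤x+d (*-nonNegative 0≤z (0≤y-x x≤y))
    (solve 3 (λ x y z → z :* y := z :* x :+ z :* (y :- x)) refl x y z)

  *-monoʳ-≤ : ∀ {x y z} → 0# ≤ z → x ≤ y → x * z ≤ y * z
  *-monoʳ-≤ 0≤z x≤y = ≤-respˡ-≈ (*-comm _ _) (≤-respʳ-≈ (*-comm _ _) (*-monoˡ-≤ 0≤z x≤y))

  ≰⇒≥ : ∀ {x y} → ¬ x ≤ y → y ≤ x
  ≰⇒≥ {x} {y} x≰y with total x y
  ... | inj₁ x≤y = contradiction x≤y x≰y
  ... | inj₂ y≤x = y≤x

  ≰⇒> : ∀ {x y} → ¬ x ≤ y → y < x
  ≰⇒> x≰y = ≰⇒≥ x≰y , λ y≈x → x≰y (≤-reflexive (sym y≈x))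

  <⇒≰ : ∀ {x y} → x < y → ¬ y ≤ x
  <⇒≰ (x≤y , x≉y) y≤x = x≉y (antisym x≤y y≤x)

  ≤-<-trans : ∀ {x y z} → x ≤ y → y < z → x < z
  ≤-<-trans x≤y y<z = ≰⇒> λ z≤x → <⇒≰ y<z (≤-trans z≤x x≤y)

  <-≤-trans : ∀ {x y z} → x < y → y ≤ z → x < z
  <-≤-trans x<y y≤z = ≰⇒> λ z≤x → <⇒≰ x<y (≤-trans y≤z z≤x)

  0<y-x : ∀ {x y} → x < y → 0# < y - x
  0<y-x {x} {y} (x≤y , x≉y) = 0≤y-x x≤y , λ 0≈y-x → x≉y
    (trans (sym (+-identityˡ x)) (trans (+-congʳ 0≈y-x)
      (solve 2 (λ x y → y :- x :+ x := y) refl x y)))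

  0≤1 : 0# ≤ 1#
  0≤1 with total 0# 1#
  ... | inj₁ 0≤1 = 0≤1
  ... | inj₂ 1≤0 = ≤-respʳ-≈ (solve 0 ((:0 :- :1) :* (:0 :- :1) := :1) refl)
                     (*-nonNegative (0≤y-x 1≤0) (0≤y-x 1≤0))

  0<1 : 0# < 1#
  0<1 = 0≤1 , 0≉1

  ⁻¹-nonNegative : ∀ {x} → 0# < x → 0# ≤ x ⁻¹
  ⁻¹-nonNegative {x} 0<x@(0≤x , 0≉x) with total 0# (x ⁻¹)
  ... | inj₁ 0≤x⁻¹ = 0≤x⁻¹
  ... | inj₂ x⁻¹≤0 = contradiction (≤-respˡ-≈ (⁻¹-inverseʳ x (0≉x ∘ sym))
                       (≤-respʳ-≈ (zeroʳ x) (*-monoˡ-≤ 0≤x x⁻¹≤0))) (<⇒≰ 0<1)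

  *-⁻¹-cancel : ∀ {x} → ¬ 0# ≈ x → ∀ y → x * (x ⁻¹ * y) ≈ y
  *-⁻¹-cancel {x} 0≉x y = trans (sym (*-assoc _ _ _))
    (trans (*-congʳ (⁻¹-inverseʳ x (0≉x ∘ sym))) (*-identityˡ y))

  ⁻¹-*-cancel : ∀ {x} → ¬ 0# ≈ x → ∀ y → x ⁻¹ * (x * y) ≈ y
  ⁻¹-*-cancel {x} 0≉x y = trans
    (solve 3 (λ x z y → z :* (x :* y) := x :* (z :* y)) refl x (x ⁻¹) y)
    (*-⁻¹-cancel 0≉x y)

  *-cancelˡ-≤ : ∀ {x y z} → 0# < z → z * x ≤ z * y → x ≤ y
  *-cancelˡ-≤ {x} {y} {z} 0<z p = ≤-respˡ-≈ (⁻¹-*-cancel (proj₂ 0<z) x)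
    (≤-respʳ-≈ (⁻¹-*-cancel (proj₂ 0<z) y) (*-monoˡ-≤ (⁻¹-nonNegative 0<z) p))

  *-cancelˡ-≈ : ∀ {x y z} → 0# < z → z * x ≈ z * y → x ≈ y
  *-cancelˡ-≈ 0<z p = antisym (*-cancelˡ-≤ 0<z (≤-reflexive p))
                              (*-cancelˡ-≤ 0<z (≤-reflexive (sym p)))

  ·1-nonNegative : ∀ n → 0# ≤ n · 1#
  ·1-nonNegative zero    = ≤-refl
  ·1-nonNegative (suc n) = +-nonNegative 0≤1 (·1-nonNegative n)

  ·1-positive : ∀ {n} → 1 ℕ.≤ n → 0# < n · 1#
  ·1-positive {suc n} _ = <-≤-trans 0<1 (x≤x+d (·1-nonNegative n) refl)

  ·≈·1* : ∀ n x → n · x ≈ n · 1# * x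
  ·≈·1* zero    x = sym (zeroˡ x)
  ·≈·1* (suc n) x = trans (+-cong (sym (*-identityˡ x)) (·≈·1* n x)) (sym (distribʳ x 1# (n · 1#)))

  sum-mono-≤ : ∀ {n} {f g : Vector Carrier n} → (∀ i → f i ≤ g i) → sum f ≤ sum g
  sum-mono-≤ {zero}  f≤g = ≤-refl
  sum-mono-≤ {suc n} f≤g = +-mono-≤ (f≤g zero) (sum-mono-≤ (f≤g ∘ suc))

  sum-zero : ∀ {n} {f : Vector Carrier n} → (∀ i → f i ≈ 0#) → sum f ≈ 0#
  sum-zero {n} f≈0 = trans (sum-cong-≋ f≈0) (sum-replicate-zero n)

  sum-nonNegative : ∀ {n} {f : Vector Carrier n} → (∀ i → 0# ≤ f i) → 0# ≤ sum f
  sum-nonNegative {zero}  0≤f = ≤-refl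
  sum-nonNegative {suc n} 0≤f = +-nonNegative (0≤f zero) (sum-nonNegative (0≤f ∘ suc))

  sum-const : ∀ n x → sum {n} (λ _ → x) ≈ n · 1# * x
  sum-const n x = trans (sum-replicate n) (·≈·1* n x)

  -- This turns a statement about the total of the arrival times into one about each agent.
  sum-tight : ∀ {n} {f g : Vector Carrier n} → (∀ i → f i ≤ g i) → sum g ≤ sum f → ∀ i → g i ≤ f i
  sum-tight {suc n} {f} {g} f≤g Σg≤Σf zero    = +-cancelʳ-≤ (sum (tail f))
    (≤-trans (+-mono-≤ ≤-refl (sum-mono-≤ (f≤g ∘ suc))) Σg≤Σf)
  sum-tight {suc n} {f} {g} f≤g Σg≤Σf (suc i) = sum-tight (f≤g ∘ suc)
    (+-cancelʳ-≤ (f zero) (≤-respˡ-≈ (+-comm _ _) (≤-respʳ-≈ (+-comm _ _)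
      (≤-trans (+-mono-≤ (f≤g zero) ≤-refl) Σg≤Σf)))) i

  sum-single : ∀ {n} (f : Vector Carrier n) i → (∀ j → j ≢ i → f j ≈ 0#) → sum f ≈ f i
  sum-single {suc n} f i f≈0 = trans (sum-remove {i = i} f)
    (trans (+-congˡ (sum-zero λ j → f≈0 (punchIn i j) (Finₚ.punchInᵢ≢i i j))) (+-identityʳ _))

  maximum-least : ∀ {n z} → 1 ℕ.≤ n → (v : Vector Carrier n) → (∀ i → v i ≤ z) → maximum v ≤ z
  maximum-least {suc n} {z} _ v v≤z = go (tail v) (v≤z ∘ suc)
    where
    go : ∀ {n} (w : Vector Carrier n) → (∀ i → w i ≤ z) → foldr max (head v) w ≤ z
    go {zero}  w w≤z = v≤z zero
    go {suc n} w w≤z = ⊔-lub (w≤z zero) (go (tail w) (w≤z ∘ suc))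

  ≤-maximum : ∀ {n} (v : Vector Carrier n) i → v i ≤ maximum v
  ≤-maximum {suc n} v i = go i
    where
    go₀ : ∀ {n} (w : Vector Carrier n) → head v ≤ foldr max (head v) w
    go₀ {zero}  w = ≤-refl
    go₀ {suc n} w = ≤-trans (go₀ (tail w)) (x≤y⊔x _ _)
    go₁ : ∀ {n} (w : Vector Carrier n) i → w i ≤ foldr max (head v) w
    go₁ w zero    = x≤x⊔y _ _
    go₁ w (suc i) = ≤-trans (go₁ (tail w) i) (x≤y⊔x _ _)
    go : ∀ i → v i ≤ maximum v
    go zero    = go₀ (tail v)
    go (suc i) = go₁ (tail v) i

-- Fourier-Motzkin elimination and extreme points

module Polyhedra {c ℓ₁ ℓ₂} (F : OrderedField c ℓ₁ ℓ₂) where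
  open OrderedField F
  open FieldProperties F

  infixl 6 _⊕_
  infixl 7 _⊛_

  -- Syntax trees rather than coefficient vectors: both sides of each constraint of the linear
  -- program are then values of such trees by computation.
  data Affine (n : ℕ) : Set c where
    var   : Fin n → Affine n
    const : Carrier → Affine n
    _⊕_   : Affine n → Affine n → Affine n
    _⊛_   : Carrier → Affine n → Affine n
    ∑     : ∀ {k} → (Fin k → Affine n) → Affine n

  ⟦_⟧ : ∀ {n} → Affine n → Vector Carrier n → Carrier
  ⟦ var k   ⟧ X = X k
  ⟦ const a ⟧ X = a
  ⟦ e ⊕ e′  ⟧ X = ⟦ e ⟧ X + ⟦ e′ ⟧ X
  ⟦ a ⊛ e   ⟧ X = a * ⟦ e ⟧ X
  ⟦ ∑ es    ⟧ X = sum λ k → ⟦ es k ⟧ X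

  infixl 6 _⊝_
  _⊝_ : ∀ {n} → Affine n → Affine n → Affine n
  e ⊝ e′ = e ⊕ (- 1#) ⊛ e′

  ⟦⊝⟧ : ∀ {n} (e e′ : Affine n) X → ⟦ e ⊝ e′ ⟧ X ≈ ⟦ e ⟧ X - ⟦ e′ ⟧ X
  ⟦⊝⟧ e e′ X = solve 2 (λ x y → x :+ (:- :1) :* y := x :- y) refl (⟦ e ⟧ X) (⟦ e′ ⟧ X)

  ⟦⟧-cong : ∀ {n} (e : Affine n) {X Y : Vector Carrier n} → (∀ k → X k ≈ Y k) → ⟦ e ⟧ X ≈ ⟦ e ⟧ Y
  ⟦⟧-cong (var k)   X≈Y = X≈Y k
  ⟦⟧-cong (const a) X≈Y = refl
  ⟦⟧-cong (e ⊕ e′)  X≈Y = +-cong (⟦⟧-cong e X≈Y) (⟦⟧-cong e′ X≈Y)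
  ⟦⟧-cong (a ⊛ e)   X≈Y = *-congˡ (⟦⟧-cong e X≈Y)
  ⟦⟧-cong (∑ es)    X≈Y = sum-cong-≋ λ k → ⟦⟧-cong (es k) X≈Y

  slope : ∀ {n} → Affine (suc n) → Carrier
  slope (var zero)    = 1#
  slope (var (suc k)) = 0#
  slope (const a)     = 0#
  slope (e ⊕ e′)      = slope e + slope e′
  slope (a ⊛ e)       = a * slope e
  slope (∑ es)        = sum λ k → slope (es k)

  rest : ∀ {n} → Affine (suc n) → Affine n
  rest (var zero)    = const 0#
  rest (var (suc k)) = var k
  rest (const a)     = const a
  rest (e ⊕ e′)      = rest e ⊕ rest e′
  rest (a ⊛ e)       = a ⊛ rest e
  rest (∑ es)        = ∑ λ k → rest (es k)

  ⟦⟧-split : ∀ {n} (e : Affine (suc n)) X → ⟦ e ⟧ X ≈ slope e * head X + ⟦ rest e ⟧ (tail X)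
  ⟦⟧-split (var zero)    X = solve 1 (λ x → x := :1 :* x :+ :0) refl (X zero)
  ⟦⟧-split (var (suc k)) X = solve 2 (λ x y → y := :0 :* x :+ y) refl (X zero) (X (suc k))
  ⟦⟧-split (const a)     X = solve 2 (λ x y → y := :0 :* x :+ y) refl (X zero) a
  ⟦⟧-split (e ⊕ e′)      X = trans (+-cong (⟦⟧-split e X) (⟦⟧-split e′ X))
    (solve 5 (λ s s′ x r r′ → s :* x :+ r :+ (s′ :* x :+ r′) := (s :+ s′) :* x :+ (r :+ r′)) refl
      (slope e) (slope e′) (head X) _ _)
  ⟦⟧-split (a ⊛ e)       X = trans (*-congˡ (⟦⟧-split e X))
    (solve 4 (λ a s x r → a :* (s :* x :+ r) := a :* s :* x :+ a :* r) refl a (slope e) (head X) _)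
  ⟦⟧-split (∑ es)        X = trans (sum-cong-≋ λ k → ⟦⟧-split (es k) X)
    (trans (∑-distrib-+ (λ k → slope (es k) * head X) (λ k → ⟦ rest (es k) ⟧ (tail X)))
      (+-congʳ (sym (*-distribʳ-sum (head X) λ k → slope (es k)))))

  _Satisfies_ : ∀ {n} → Vector Carrier n → List (Affine n) → Set (c ⊔ ℓ₂)
  X Satisfies es = All (λ e → 0# ≤ ⟦ e ⟧ X) es

  Definable : ∀ {p n} → (Vector Carrier n → Set p) → Set _
  Definable {n = n} P = ∃ λ (es : List (Affine n)) →
    (∀ X → P X → X Satisfies es) × (∀ X → X Satisfies es → P X)

  private
    variable
      p q : Level
      n k : ℕ

  ≤-definable : (e e′ : Affine n) → Definable (λ X → ⟦ e ⟧ X ≤ ⟦ e′ ⟧ X)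
  ≤-definable e e′ = List.[ e′ ⊝ e ] ,
    (λ X le → ≤-respʳ-≈ (sym (⟦⊝⟧ e′ e X)) (0≤y-x le) ∷ []) ,
    λ { X (0≤ ∷ []) → x≤x+d (≤-respʳ-≈ (⟦⊝⟧ e′ e X) 0≤)
      (solve 2 (λ x y → y := x :+ (y :- x)) refl (⟦ e ⟧ X) (⟦ e′ ⟧ X)) }

  ×-definable : {P : Vector Carrier n → Set p} {Q : Vector Carrier n → Set q} →
                Definable P → Definable Q → Definable (λ X → P X × Q X)
  ×-definable (es , to , from) (es′ , to′ , from′) = es List.++ es′ ,
    (λ X (PX , QX) → Allₚ.++⁺ (to X PX) (to′ X QX)) ,
    λ X sat → from X (Allₚ.++⁻ˡ es sat) , from′ X (Allₚ.++⁻ʳ es sat)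

  ⇔-definable : {P : Vector Carrier n → Set p} {Q : Vector Carrier n → Set q} →
                (∀ X → P X → Q X) → (∀ X → Q X → P X) → Definable P → Definable Q
  ⇔-definable P⇒Q Q⇒P (es , to , from) =
    es , (λ X → to X ∘ Q⇒P X) , λ X → P⇒Q X ∘ from X

  ≈-definable : (e e′ : Affine n) → Definable (λ X → ⟦ e ⟧ X ≈ ⟦ e′ ⟧ X)
  ≈-definable e e′ = ⇔-definable (λ _ → uncurry antisym)
    (λ _ eq → ≤-reflexive eq , ≤-reflexive (sym eq))
    (×-definable (≤-definable e e′) (≤-definable e′ e))

  ∀-definable : {P : Fin k → Vector Carrier n → Set p} →
                (∀ i → Definable (P i)) → Definable (λ X → ∀ i → P i X)
  ∀-definable defs = List.concat (List.tabulate (proj₁ ∘ defs)) ,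
    (λ X PX → Allₚ.concat⁺ (Allₚ.tabulate⁺ λ i → proj₁ (proj₂ (defs i)) X (PX i))) ,
    λ X sat i → proj₂ (proj₂ (defs i)) X
      (Allₚ.tabulate⁻ (Allₚ.concat⁻ {xss = List.tabulate (proj₁ ∘ defs)} sat) i)

  -- The side conditions of the linear program concern the matrix alone and are decidable, so each
  -- of them either keeps its inequality or drops it.
  →-definable : {A : Set q} {P : Vector Carrier n → Set p} →
                Dec A → Definable P → Definable (λ X → A → P X)
  →-definable (yes a) def = ⇔-definable (λ _ PX _ → PX) (λ _ PX → PX a) def
  →-definable (no ¬a) def = [] , (λ _ _ → []) , λ _ _ a → contradiction a ¬a

  -- Elimination of the first variable

  record Bounds (n : ℕ) : Set c where
    field lowers uppers others : List (Affine n)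

  record _,_Within_ {n} (x : Carrier) (Y : Vector Carrier n) (B : Bounds n) : Set (c ⊔ ℓ₂) where
    open Bounds B
    field
      lower : All (λ e → ⟦ e ⟧ Y ≤ x) lowers
      upper : All (λ e → x ≤ ⟦ e ⟧ Y) uppers
      other : Y Satisfies others
  open _,_Within_

  bounds : List (Affine (suc n)) → Bounds n
  bounds []       = record { lowers = [] ; uppers = [] ; others = [] }
  bounds (e ∷ es) with slope e ≤? 0# | 0# ≤? slope e
  ... | yes _ | yes _ = record (bounds es) { others = rest e ∷ Bounds.others (bounds es) }
  ... | yes _ | no  _ = record (bounds es)
    { uppers = (- (slope e) ⁻¹) ⊛ rest e ∷ Bounds.uppers (bounds es) }
  ... | no  _ | _     = record (bounds es)
    { lowers = (- (slope e) ⁻¹) ⊛ rest e ∷ Bounds.lowers (bounds es) }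

  private
    -- The zero of the affine function is `(- s ⁻¹) * r`, and this is the bound that the constraint
    -- puts on `x`.
    root : ∀ {s} → ¬ 0# ≈ s → ∀ x r → s * x + r ≈ s * (x - (- s ⁻¹) * r)
    root {s} 0≉s x r = trans (+-congˡ (sym (*-⁻¹-cancel 0≉s r)))
      (solve 4 (λ s t x r → s :* x :+ s :* (t :* r) := s :* (x :- (:- t) :* r)) refl s (s ⁻¹) x r)

  module _ {n} (e : Affine (suc n)) (X : Vector Carrier (suc n)) where
    private
      s = slope e
      x = head X
      r = ⟦ rest e ⟧ (tail X)
      ρ = (- s ⁻¹) * r

    zeroSlope : s ≈ 0# → ⟦ e ⟧ X ≈ r
    zeroSlope s≈0 = trans (⟦⟧-split e X) (trans (+-congʳ (trans (*-congʳ s≈0) (zeroˡ _))) (+-identityˡ r))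

    positiveSlope⁺ : 0# < s → 0# ≤ ⟦ e ⟧ X → ρ ≤ x
    positiveSlope⁺ 0<s 0≤e = x≤x+d
      (*-cancelˡ-≤ 0<s (≤-respˡ-≈ (sym (zeroʳ s))
        (≤-respʳ-≈ (trans (⟦⟧-split e X) (root (proj₂ 0<s) x r)) 0≤e)))
      (solve 2 (λ x ρ → x := ρ :+ (x :- ρ)) refl x ρ)

    positiveSlope⁻ : 0# < s → ρ ≤ x → 0# ≤ ⟦ e ⟧ X
    positiveSlope⁻ 0<s ρ≤x = ≤-respʳ-≈ (sym (trans (⟦⟧-split e X) (root (proj₂ 0<s) x r)))
      (*-nonNegative (proj₁ 0<s) (0≤y-x ρ≤x))

    private
      flipped : s < 0# → ⟦ e ⟧ X ≈ (0# - s) * (ρ - x)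
      flipped s<0 = trans (trans (⟦⟧-split e X) (root (proj₂ s<0 ∘ sym) x r))
        (solve 3 (λ s x ρ → s :* (x :- ρ) := (:0 :- s) :* (ρ :- x)) refl s x ρ)

    negativeSlope⁺ : s < 0# → 0# ≤ ⟦ e ⟧ X → x ≤ ρ
    negativeSlope⁺ s<0 0≤e = x≤x+d
      (*-cancelˡ-≤ (0<y-x s<0) (≤-respˡ-≈ (sym (zeroʳ _)) (≤-respʳ-≈ (flipped s<0) 0≤e)))
      (solve 2 (λ x ρ → ρ := x :+ (ρ :- x)) refl x ρ)

    negativeSlope⁻ : s < 0# → x ≤ ρ → 0# ≤ ⟦ e ⟧ X
    negativeSlope⁻ s<0 x≤ρ = ≤-respʳ-≈ (sym (flipped s<0))
      (*-nonNegative (proj₁ (0<y-x s<0)) (0≤y-x x≤ρ))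

  satisfies⇒within : ∀ es (X : Vector Carrier (suc n)) → X Satisfies es → head X , tail X Within bounds es
  satisfies⇒within []       X []           = record { lower = [] ; upper = [] ; other = [] }
  satisfies⇒within (e ∷ es) X (0≤e ∷ 0≤es) with slope e ≤? 0# | 0# ≤? slope e | satisfies⇒within es X 0≤es
  ... | yes s≤0 | yes 0≤s | w = record
    { lower = lower w ; upper = upper w
    ; other = ≤-respʳ-≈ (zeroSlope e X (antisym s≤0 0≤s)) 0≤e ∷ other w }
  ... | yes s≤0 | no  0≰s | w = record
    { lower = lower w ; upper = negativeSlope⁺ e X (≰⇒> 0≰s) 0≤e ∷ upper w ; other = other w }
  ... | no  s≰0 | _       | w = record
    { lower = positiveSlope⁺ e X (≰⇒> s≰0) 0≤e ∷ lower w ; upper = upper w ; other = other w }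

  within⇒satisfies : ∀ es (X : Vector Carrier (suc n)) → head X , tail X Within bounds es → X Satisfies es
  within⇒satisfies []       X w = []
  within⇒satisfies (e ∷ es) X w with slope e ≤? 0# | 0# ≤? slope e
  ... | yes s≤0 | yes 0≤s with other w
  ...   | 0≤e ∷ o = ≤-respʳ-≈ (sym (zeroSlope e X (antisym s≤0 0≤s))) 0≤e ∷
    within⇒satisfies es X record { lower = lower w ; upper = upper w ; other = o }
  within⇒satisfies (e ∷ es) X w | yes s≤0 | no 0≰s with upper w
  ...   | x≤ρ ∷ u = negativeSlope⁻ e X (≰⇒> 0≰s) x≤ρ ∷
    within⇒satisfies es X record { lower = lower w ; upper = u ; other = other w }
  within⇒satisfies (e ∷ es) X w | no s≰0 | _ with lower w
  ...   | ρ≤x ∷ l = positiveSlope⁻ e X (≰⇒> s≰0) ρ≤x ∷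
    within⇒satisfies es X record { lower = l ; upper = upper w ; other = other w }

  differences : List (Affine n) → List (Affine n) → List (Affine n)
  differences []       Ls = []
  differences (U ∷ Us) Ls = List.map (U ⊝_) Ls List.++ differences Us Ls

  differences⁺ : ∀ {x} (Y : Vector Carrier n) Us Ls → All (λ e → x ≤ ⟦ e ⟧ Y) Us →
                 All (λ e → ⟦ e ⟧ Y ≤ x) Ls → Y Satisfies differences Us Ls
  differences⁺ Y []       Ls []       l≤x = []
  differences⁺ Y (U ∷ Us) Ls (x≤u ∷ x≤us) l≤x = Allₚ.++⁺
    (Allₚ.map⁺ (All.map (λ {L} l≤x → ≤-respʳ-≈ (sym (⟦⊝⟧ U L Y)) (0≤y-x (≤-trans l≤x x≤u))) l≤x))
    (differences⁺ Y Us Ls x≤us l≤x)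

  differences⁻ : ∀ (Y : Vector Carrier n) Us Ls → Y Satisfies differences Us Ls →
                 All (λ U → All (λ L → ⟦ L ⟧ Y ≤ ⟦ U ⟧ Y) Ls) Us
  differences⁻ Y []       Ls sat = []
  differences⁻ Y (U ∷ Us) Ls sat =
    All.map (λ {L} 0≤ → x≤x+d (≤-respʳ-≈ (⟦⊝⟧ U L Y) 0≤)
               (solve 2 (λ u l → u := l :+ (u :- l)) refl (⟦ U ⟧ Y) (⟦ L ⟧ Y)))
            (Allₚ.map⁻ (Allₚ.++⁻ˡ (List.map (U ⊝_) Ls) sat)) ∷
    differences⁻ Y Us Ls (Allₚ.++⁻ʳ (List.map (U ⊝_) Ls) sat)

  -- Nonnegativity of the variables is kept outside the list. For the eliminated variable it enters
  -- as the lower bound `const 0#`, so there is always a lower bound and hence a least admissible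
  -- value.
  project : List (Affine (suc n)) → List (Affine n)
  project es = Bounds.others B List.++ differences (Bounds.uppers B) (const 0# ∷ Bounds.lowers B)
    where B = bounds es

  project⁺ : ∀ es (X : Vector Carrier (suc n)) → 0# ≤ head X → X Satisfies es →
    tail X Satisfies project es
  project⁺ es X 0≤x sat = Allₚ.++⁺ (other w)
    (differences⁺ (tail X) (Bounds.uppers (bounds es)) _ (upper w) (0≤x ∷ lower w))
    where w = satisfies⇒within es X sat

  least : ∀ (Y : Vector Carrier n) Ls → ∃ λ x → All (λ L → ⟦ L ⟧ Y ≤ x) (const 0# ∷ Ls) ×
          (∀ y → All (λ L → ⟦ L ⟧ Y ≤ y) (const 0# ∷ Ls) → x ≤ y)
  least Y []       = 0# , (≤-refl ∷ []) , λ { y (0≤y ∷ []) → 0≤y }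
  least Y (L ∷ Ls) with least Y Ls
  ... | x , (0≤x ∷ Ls≤x) , min with total (⟦ L ⟧ Y) x
  ...   | inj₁ L≤x = x , (0≤x ∷ L≤x ∷ Ls≤x) , λ { y (0≤y ∷ L≤y ∷ Ls≤y) → min y (0≤y ∷ Ls≤y) }
  ...   | inj₂ x≤L = ⟦ L ⟧ Y ,
    (≤-trans 0≤x x≤L ∷ ≤-refl ∷ All.map (λ Ls≤x → ≤-trans Ls≤x x≤L) Ls≤x) ,
    λ { y (0≤y ∷ L≤y ∷ Ls≤y) → L≤y }

  -- The witness is the largest lower bound. Minimality is stated for all points whose tail is
  -- merely `≈` to `Y`, since the points compared in a test of extremality are known only up to `≈`.
  project⁻ : ∀ es (Y : Vector Carrier n) → Y Satisfies project es →
             ∃ λ x → 0# ≤ x × (x Vector.∷ Y) Satisfies es ×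
             (∀ (Z : Vector Carrier (suc n)) → (∀ j → tail Z j ≈ Y j) → 0# ≤ head Z → Z Satisfies es →
               x ≤ head Z)
  project⁻ {n} es Y sat with least Y (Bounds.lowers (bounds es))
  ... | x , (0≤x ∷ lo) , min = x , 0≤x ,
    within⇒satisfies es (x Vector.∷ Y) (record
      { lower = lo
      ; upper = All.map (λ {U} → min (⟦ U ⟧ Y))
                        (differences⁻ Y _ _ (Allₚ.++⁻ʳ (Bounds.others (bounds es)) sat))
      ; other = Allₚ.++⁻ˡ (Bounds.others (bounds es)) sat }) ,
    λ Z Z≈Y 0≤z satZ → min (head Z) (0≤z ∷
      All.map (λ {L} → ≤-respˡ-≈ (⟦⟧-cong L Z≈Y)) (lower (satisfies⇒within es Z satZ)))

  Extreme : (Vector Carrier n → Set p) → Vector Carrier n → Set _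
  Extreme P X = P X × (∀ X₁ X₂ → P X₁ → P X₂ → ∀ a → 0# < a → a < 1# →
    (∀ j → X j ≈ a * X₁ j + (1# - a) * X₂ j) → ∀ j → X₁ j ≈ X₂ j)

  -- A proper average of two different numbers lies strictly above the smaller one. This gives
  -- extremality in the eliminated coordinate and, later, in the makespan.
  convex-min : ∀ {x x₁ x₂ a} → 0# < a → a < 1# → x ≈ a * x₁ + (1# - a) * x₂ →
               x ≤ x₁ → x ≤ x₂ → x₁ ≈ x₂
  convex-min {x} {x₁} {x₂} {a} 0<a a<1 x≈ x≤x₁ x≤x₂ = antisym
    (*-cancelˡ-≤ 0<a (x≤x+d (0≤y-x x≤x₂) (sym (trans (+-congˡ (+-congˡ (-‿cong x≈)))
      (solve 3 (λ a x₁ x₂ → a :* x₁ :+ (x₂ :- (a :* x₁ :+ (:1 :- a) :* x₂)) := a :* x₂) refl a x₁ x₂)))))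
    (*-cancelˡ-≤ (0<y-x a<1) (x≤x+d (0≤y-x x≤x₁) (sym (trans (+-congˡ (+-congˡ (-‿cong x≈)))
      (solve 3 (λ a x₁ x₂ → (:1 :- a) :* x₂ :+ (x₁ :- (a :* x₁ :+ (:1 :- a) :* x₂)) := (:1 :- a) :* x₁)
        refl a x₁ x₂)))))

  convex-same : ∀ {x₁ x₂ a} → x₁ ≈ x₂ → a * x₁ + (1# - a) * x₂ ≈ x₁
  convex-same {x₁} {x₂} {a} x₁≈x₂ = trans (+-congˡ (*-congˡ (sym x₁≈x₂)))
    (solve 2 (λ a x → a :* x :+ (:1 :- a) :* x := x) refl a x₁)

  NonNegative : Vector Carrier n → Set _
  NonNegative X = ∀ j → 0# ≤ X j

  -- By Fourier–Motzkin elimination: an extreme point Y of the projection,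
  -- together with the least x such that x ∷ Y is feasible, is extreme.
  extremePoint : ∀ n (es : List (Affine n)) X → NonNegative X → X Satisfies es →
                 ∃ (Extreme λ X → NonNegative X × X Satisfies es)
  extremePoint zero    es X 0≤X sat = X , (0≤X , sat) , λ _ _ _ _ _ _ _ _ ()
  extremePoint (suc n) es X 0≤X sat
    with extremePoint n (project es) (tail X) (0≤X ∘ suc) (project⁺ es X (0≤X zero) sat)
  ... | Y , (0≤Y , satY) , extY with project⁻ es Y satY
  ...   | x , 0≤x , satx , min =
    x Vector.∷ Y , ((λ { zero → 0≤x ; (suc j) → 0≤Y j }) , satx) , ext
    where
    ext : _
    ext X₁ X₂ (0≤X₁ , sat₁) (0≤X₂ , sat₂) a 0<a a<1 comb = λ { zero → heads ; (suc j) → tails j }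
      where
      tails : ∀ j → tail X₁ j ≈ tail X₂ j
      tails = extY (tail X₁) (tail X₂)
        (0≤X₁ ∘ suc , project⁺ es X₁ (0≤X₁ zero) sat₁)
        (0≤X₂ ∘ suc , project⁺ es X₂ (0≤X₂ zero) sat₂) a 0<a a<1 (comb ∘ suc)
      tail₁ : ∀ j → tail X₁ j ≈ Y j
      tail₁ j = sym (trans (comb (suc j)) (convex-same (tails j)))
      heads : head X₁ ≈ head X₂
      heads = convex-min 0<a a<1 (comb zero)
        (min X₁ tail₁ (0≤X₁ zero) sat₁)
        (min X₂ (λ j → trans (sym (tails j)) (tail₁ j)) (0≤X₂ zero) sat₂)

  definable-extremePoint : {P : Vector Carrier n → Set p} → Definable P →
    (∀ X → P X → NonNegative X) → ∃ P → ∃ (Extreme P)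
  definable-extremePoint (es , to , from) P⇒0≤ (X , PX)
    with extremePoint _ es X (P⇒0≤ X PX) (to X PX)
  ... | Y , (_ , satY) , ext = Y , from Y satY , λ X₁ X₂ P₁ P₂ →
    ext X₁ X₂ (P⇒0≤ X₁ P₁ , to X₁ P₁) (P⇒0≤ X₂ P₂ , to X₂ P₂)

-- Prefix sums

module PrefixSums {c ℓ₁ ℓ₂} (F : OrderedField c ℓ₁ ℓ₂) where
  open OrderedField F
  open FieldProperties F

  -- The cut is a natural number, not an element of `Fin`, so that cuts in vectors of different
  -- lengths can be compared directly. Beyond the end of the vector the sum stays constant.
  prefix : ∀ {n} → Vector Carrier n → ℕ → Carrier
  prefix         f zero    = 0#
  prefix {zero}  f (suc c) = 0#
  prefix {suc n} f (suc c) = head f + prefix (tail f) c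

  private
    variable
      n n′ : ℕ

  prefix-all : (f : Vector Carrier n) → prefix f n ≈ sum f
  prefix-all {zero}  f = refl
  prefix-all {suc n} f = +-congˡ (prefix-all (tail f))

  prefix-agree : ∀ {f g : Vector Carrier n} c → (∀ k → toℕ k ℕ.< c → f k ≈ g k) → prefix f c ≈ prefix g c
  prefix-agree         zero    f≈g = refl
  prefix-agree {zero}  (suc c) f≈g = refl
  prefix-agree {suc n} (suc c) f≈g =
    +-cong (f≈g zero (s≤s z≤n)) (prefix-agree c λ k k<c → f≈g (suc k) (s≤s k<c))

  prefix-cong : ∀ {f g : Vector Carrier n} c → (∀ k → f k ≈ g k) → prefix f c ≈ prefix g c
  prefix-cong c f≈g = prefix-agree c λ k _ → f≈g k

  -- The offsets `a` and `b` serve the induction, which moves the heads of the two vectors into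
  -- them.
  prefix-resume : ∀ {f g : Vector Carrier n} {d c} a b → a + prefix f d ≈ b + prefix g d →
                  (∀ k → d ℕ.≤ toℕ k → f k ≈ g k) → d ℕ.≤ c → a + prefix f c ≈ b + prefix g c
  prefix-resume {d = zero} {c} a b start f≈g _ =
    +-cong (+-cancelʳ-≈ 0# start) (prefix-cong c λ k → f≈g k z≤n)
  prefix-resume {zero} {d = suc d} a b start f≈g (s≤s _) = start
  prefix-resume {suc n} {d = suc d} a b start f≈g (s≤s d≤c) =
    trans (sym (+-assoc _ _ _)) (trans
      (prefix-resume _ _ (trans (+-assoc _ _ _) (trans start (sym (+-assoc _ _ _))))
        (λ k → f≈g (suc k) ∘ s≤s) d≤c)
      (+-assoc _ _ _))

  prefix-inject! : (f : Vector Carrier n) (j : Fin n) →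
    sum {suc (toℕ j)} (λ k → f (inject! {i = suc j} k)) ≈ prefix f (suc (toℕ j))
  prefix-inject! f zero    = refl
  prefix-inject! f (suc j) = +-congˡ (prefix-inject! (tail f) j)

  sum-inject≤ : ∀ {n l} (f : Vector Carrier n) (l≤n : l ℕ.≤ n) →
    sum (λ r → f (inject≤ r l≤n)) ≈ prefix f l
  sum-inject≤ f z≤n       = refl
  sum-inject≤ f (s≤s l≤n) = +-congˡ (sum-inject≤ (tail f) l≤n)

  prefix-suc : (f : Vector Carrier n) (j : Fin n) → prefix f (suc (toℕ j)) ≈ prefix f (toℕ j) + f j
  prefix-suc f zero    = +-comm _ _
  prefix-suc f (suc j) = trans (+-congˡ (prefix-suc (tail f) j)) (sym (+-assoc _ _ _))

  prefix-scale : ∀ a (f : Vector Carrier n) c → prefix (λ k → a * f k) c ≈ a * prefix f c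
  prefix-scale         a f zero    = sym (zeroʳ a)
  prefix-scale {zero}  a f (suc c) = sym (zeroʳ a)
  prefix-scale {suc n} a f (suc c) = trans (+-congˡ (prefix-scale a (tail f) c)) (sym (distribˡ a _ _))

  tail-++ : (f : Vector Carrier (suc n)) (g : Vector Carrier n′) → ∀ k → tail (f ++ g) k ≡ (tail f ++ g) k
  tail-++ {n} f g k with splitAt n k
  ... | inj₁ _ = ≡.refl
  ... | inj₂ _ = ≡.refl

  prefix-++ˡ : ∀ (f : Vector Carrier n) (g : Vector Carrier n′) {c} → c ℕ.≤ n →
    prefix (f ++ g) c ≈ prefix f c
  prefix-++ˡ         f g z≤n       = refl
  prefix-++ˡ {suc n} f g (s≤s {c} c≤n) = +-congˡ
    (trans (prefix-cong c (λ k → reflexive (tail-++ f g k))) (prefix-++ˡ (tail f) g c≤n))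

  prefix-++ʳ : ∀ (f : Vector Carrier n) (g : Vector Carrier n′) c →
    prefix (f ++ g) (n ℕ.+ c) ≈ sum f + prefix g c
  prefix-++ʳ {zero}  f g c = sym (+-identityˡ _)
  prefix-++ʳ {suc n} f g c = trans (+-congˡ
    (trans (prefix-cong (n ℕ.+ c) (λ k → reflexive (tail-++ f g k))) (prefix-++ʳ (tail f) g c)))
    (sym (+-assoc _ _ _))

  sum-++ : ∀ (f : Vector Carrier n) (g : Vector Carrier n′) → sum (f ++ g) ≈ sum f + sum g
  sum-++ {n} {n′} f g = trans (sym (prefix-all (f ++ g)))
    (trans (prefix-++ʳ f g n′) (+-congˡ (prefix-all g)))

  prefix-removeAt-≤ : ∀ (f : Vector Carrier (suc n)) j {c} → c ℕ.≤ toℕ j →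
                      prefix (removeAt f j) c ≈ prefix f c
  prefix-removeAt-≤         f j       {zero}  _         = refl
  prefix-removeAt-≤ {suc n} f (suc j) {suc c} (s≤s c≤j) = +-congˡ (prefix-removeAt-≤ (tail f) j c≤j)

  prefix-removeAt-≥ : ∀ (f : Vector Carrier (suc n)) j {c} → toℕ j ℕ.≤ c →
                      prefix (removeAt f j) c + f j ≈ prefix f (suc c)
  prefix-removeAt-≥         f zero            j≤c       = +-comm _ _
  prefix-removeAt-≥ {suc n} f (suc j) {suc c} (s≤s j≤c) =
    trans (+-assoc _ _ _) (+-congˡ (prefix-removeAt-≥ (tail f) j j≤c))

  prefix-zero : ∀ {f : Vector Carrier n} → (∀ k → f k ≈ 0#) → ∀ c → prefix f c ≈ 0#
  prefix-zero         f≈0 zero    = refl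
  prefix-zero {zero}  f≈0 (suc c) = refl
  prefix-zero {suc n} f≈0 (suc c) = trans (+-cong (f≈0 zero) (prefix-zero (f≈0 ∘ suc) c)) (+-identityˡ 0#)

-- Totals of arrival times, on-time schedules and the linear program

module OnTimeSchedules {c ℓ₁ ℓ₂} (F : OrderedField c ℓ₁ ℓ₂) where
  open OrderedField F
  open BikeSharing F
  open FieldProperties F
  open Polyhedra F
  open PrefixSums F

  totalPace : ∀ m {b} → Vector Carrier b → Carrier
  totalPace m u = m · 1# - sum λ k → 1# - u k

  m*T≈totalPace : ∀ {m b} → 1 ℕ.≤ m → (u : Vector Carrier b) → m · 1# * T m u ≈ totalPace m u
  m*T≈totalPace {m} 1≤m u = trans
    (solve 3 (λ N N⁻¹ s → N :* (:1 :- N⁻¹ :* s) := N :- N :* (N⁻¹ :* s)) refl (m · 1#) ((m · 1#) ⁻¹) _)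
    (+-congˡ (-‿cong (*-⁻¹-cancel (proj₂ (·1-positive 1≤m)) _)))

  module _ {b} (u : Vector Carrier b) where

    leg : ∀ {m n} → Vector Carrier n → Matrix m n b → Fin m → Vector Carrier n
    leg X M i k = pace u (M i k) * X k

    time : ∀ {m n} → Vector Carrier n → Matrix m n b → Fin m → ℕ → Carrier
    time X M i = prefix (leg X M i)

    -- `t` is indexed by the column just finished, `time` by the number of finished columns. At the
    -- boundary between `j′` and `j` this number is `toℕ j`.
    t≈time : ∀ {m n} (X : Vector Carrier n) (M : Matrix m n b) i {j′ j} → j′ PrecedesCol j →
             t u X M i j′ ≈ time X M i (toℕ j)
    t≈time X M i {j′} p = trans (prefix-inject! (leg X M i) j′) (reflexive (≡.cong (time X M i) p))

    InTime : ∀ {m n} → Vector Carrier n → Matrix m n b → Set ℓ₂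
    InTime X M = ∀ i i′ {j′ j} → j′ PrecedesCol j → M i j ≡ M i′ j′ → M i j ≢ zero →
                 time X M i′ (toℕ j) ≤ time X M i (toℕ j)

    FullColumns : ∀ {m n} → Matrix m n b → Set
    FullColumns M = ∀ j k → ∃ λ i → M i j ≡ suc k

    -- `full` and `unshared` concern `M` alone, so new lengths put only the other fields at stake.
    -- Fullness implies that bikes are available and, unlike availability, passes to a submatrix of
    -- columns without any argument.
    record OnTime {m n} (X : Vector Carrier n) (M : Matrix m n b) : Set (ℓ₁ ⊔ ℓ₂) where
      field
        full        : FullColumns M
        unshared    : BikesUnshared M
        isPartition : IsPartition u X M
        inTime      : InTime X M
        punctual    : ∀ i → arrival u X M i ≈ T m u

    -- Column sums

    indicator : Label b → Fin b → Carrier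
    indicator l k with l Finₚ.≟ suc k
    ... | yes _ = 1#
    ... | no  _ = 0#

    indicator-≡ : ∀ {l k} → l ≡ suc k → indicator l k ≈ 1#
    indicator-≡ {l} {k} l≡k with l Finₚ.≟ suc k
    ... | yes _   = refl
    ... | no  l≢k = contradiction l≡k l≢k

    indicator-≢ : ∀ {l k} → l ≢ suc k → indicator l k ≈ 0#
    indicator-≢ {l} {k} l≢k with l Finₚ.≟ suc k
    ... | yes l≡k = contradiction l≡k l≢k
    ... | no  _   = refl

    -- Spreading the saving of an agent over all bikes allows double counting: the sum over the
    -- agents of a column can be exchanged with the sum over the bikes.
    1-pace : ∀ l → 1# - pace u l ≈ sum λ k → indicator l k * (1# - u k)
    1-pace zero    = trans (-‿inverseʳ 1#) (sym (sum-zero {f = λ k → indicator zero k * (1# - u k)}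
      λ k → trans (*-congʳ (indicator-≢ {zero} {k} λ ())) (zeroˡ (1# - u k))))
    1-pace (suc k) = sym (trans
      (sum-single (λ k′ → indicator (suc k) k′ * (1# - u k′)) k λ k′ k′≢k →
        trans (*-congʳ (indicator-≢ {suc k} {k′} (k′≢k ∘ ≡.sym ∘ Finₚ.suc-injective)))
          (zeroˡ (1# - u k′)))
      (trans (*-congʳ (indicator-≡ {suc k} ≡.refl)) (*-identityˡ (1# - u k))))

    users : ∀ {m} → (Fin m → Label b) → Fin b → Carrier
    users f k = sum λ i → indicator (f i) k

    Unshared : ∀ {m} → (Fin m → Label b) → Set
    Unshared f = ∀ i → f i ≢ zero → ∀ i′ → i′ ≢ i → f i′ ≢ f i

    private
      module _ {m} (f : Fin m → Label b) (unshared : Unshared f) where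

        users-used : ∀ k i → f i ≡ suc k → users f k ≈ 1#
        users-used k i fi≡k = trans
          (sum-single (λ i′ → indicator (f i′) k) i λ i′ i′≢i → indicator-≢ λ fi′≡k →
            unshared i (λ fi≡0 → Finₚ.0≢1+n (≡.trans (≡.sym fi≡0) fi≡k)) i′ i′≢i
              (≡.trans fi′≡k (≡.sym fi≡k)))
          (indicator-≡ fi≡k)

        users≤1 : ∀ k → users f k ≤ 1#
        users≤1 k with Finₚ.any? (λ i → f i Finₚ.≟ suc k)
        ... | yes (i , fi≡k) = ≤-reflexive (users-used k i fi≡k)
        ... | no  unused     = ≤-respˡ-≈ (sym (sum-zero {f = λ i → indicator (f i) k}
                               λ i → indicator-≢ λ fi≡k → unused (i , fi≡k))) 0≤1

      paces : ∀ {m} (f : Fin m → Label b) →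
              sum (λ i → pace u (f i)) ≈ m · 1# - sum λ k → users f k * (1# - u k)
      paces {m} f = +-cancelʳ-≈ Σ′ (begin
        sum (λ i → pace u (f i)) + Σ′
          ≈⟨ +-congˡ (sym rearranged) ⟩
        sum (λ i → pace u (f i)) + sum (λ i → 1# - pace u (f i))
          ≈⟨ ∑-distrib-+ (λ i → pace u (f i)) (λ i → 1# - pace u (f i)) ⟨
        sum (λ i → pace u (f i) + (1# - pace u (f i)))
          ≈⟨ sum-cong-≋ (λ i → solve 1 (λ p → p :+ (:1 :- p) := :1) refl (pace u (f i))) ⟩
        sum {m} (λ _ → 1#)
          ≈⟨ sum-replicate m ⟩
        m · 1#
          ≈⟨ solve 2 (λ N s → N := N :- s :+ s) refl (m · 1#) Σ′ ⟩
        m · 1# - Σ′ + Σ′ ∎)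
        where
        open SetoidReasoning setoid
        Σ′ = sum λ k → users f k * (1# - u k)
        rearranged : sum (λ i → 1# - pace u (f i)) ≈ Σ′
        rearranged = trans (sum-cong-≋ λ i → 1-pace (f i))
          (trans (∑-comm λ i k → indicator (f i) k * (1# - u k))
                 (sum-cong-≋ λ k → sym (*-distribʳ-sum (1# - u k) λ i → indicator (f i) k)))

      Σarrival : ∀ {m n} (X : Vector Carrier n) (M : Matrix m n b) →
                 sum (arrival u X M) ≈ sum λ k → sum (λ i → pace u (M i k)) * X k
      Σarrival X M = trans (∑-comm λ i k → pace u (M i k) * X k)
        (sum-cong-≋ λ k → sym (*-distribʳ-sum (X k) λ i → pace u (M i k)))

    Σarrival-≈ : ∀ {m n} (X : Vector Carrier n) (M : Matrix m n b) → FullColumns M → BikesUnshared M →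
                 sum (arrival u X M) ≈ totalPace m u * sum X
    Σarrival-≈ X M full unshared = trans (Σarrival X M) (trans
      (sum-cong-≋ λ k → *-congʳ (trans (paces λ i → M i k) (+-congˡ (-‿cong
        (sum-cong-≋ λ p → trans (*-congʳ (users-used (λ i → M i k) (λ i → unshared i k) p
          (proj₁ (full k p)) (proj₂ (full k p)))) (*-identityˡ _))))))
      (sym (*-distribˡ-sum _ X)))

    -- At most one agent rides bike `p` in a column, and the saving `1# - u p` is nonnegative, so no
    -- column saves more than all bikes together.
    Σarrival-≥ : (∀ k → u k ≤ 1#) → ∀ {m n} (X : Vector Carrier n) (M : Matrix m n b) →
                 (∀ k → 0# ≤ X k) → BikesUnshared M → totalPace m u * sum X ≤ sum (arrival u X M)
    Σarrival-≥ u≤1 {m} X M 0≤X unshared = ≤-respˡ-≈ (sym (*-distribˡ-sum (totalPace m u) X))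
      (≤-respʳ-≈ (sym (Σarrival X M))
        (sum-mono-≤ {g = λ k → sum (λ i → pace u (M i k)) * X k} λ k → *-monoʳ-≤ (0≤X k) (column k)))
      where
      column : ∀ k → totalPace m u ≤ sum λ i → pace u (M i k)
      column k = ≤-respʳ-≈ (sym (paces λ i → M i k)) (+-mono-≤ ≤-refl (neg-mono-≤
        (sum-mono-≤ {f = λ p → users (λ i → M i k) p * (1# - u p)} λ p → ≤-respʳ-≈ (*-identityˡ _)
          (*-monoʳ-≤ (0≤y-x (u≤1 p)) (users≤1 (λ i → M i k) (λ i → unshared i k) p)))))

    -- The linear program

    lp-relax : ∀ {m n s s′} {X : Vector Carrier n} {M : Matrix m n b} → s ≤ s′ →
               LPFeasible u M s X → LPFeasible u M s′ X
    lp-relax s≤s′ lp = record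
      { makespan = λ i → ≤-trans (makespan i) s≤s′ ; inTime = inTime ; isPartition = isPartition }
      where open LPFeasible lp

    lp⇒inTime : ∀ {m n s} {X : Vector Carrier n} {M : Matrix m n b} → LPFeasible u M s X → InTime X M
    lp⇒inTime {X = X} {M} lp i i′ p same nonzero with i Finₚ.≟ i′
    ... | yes ≡.refl = ≤-refl
    ... | no  i≢i′   = ≤-respˡ-≈ (t≈time X M i′ p) (≤-respʳ-≈ (t≈time X M i p)
                         (LPFeasible.inTime lp i i′ p i≢i′ same nonzero))

    onTime⇒lp : ∀ {m n} {X : Vector Carrier n} {M : Matrix m n b} → OnTime X M → LPFeasible u M (T m u) X
    onTime⇒lp {X = X} {M} onTime = record
      { makespan    = ≤-reflexive ∘ punctual
      ; inTime      = λ i i′ p _ same nonzero →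
          ≤-respˡ-≈ (sym (t≈time X M i′ p))
            (≤-respʳ-≈ (sym (t≈time X M i p)) (inTime i i′ p same nonzero))
      ; isPartition = isPartition
      }
      where open OnTime onTime

    onTime⇒feasible : ∀ {m n} {X : Vector Carrier n} {M : Matrix m n b} → OnTime X M →
      Feasible u (schedule X M)
    onTime⇒feasible {X = X} {M} onTime = record
      { isPartition = isPartition
      ; available   = λ i {j′} {j} _ → available j′ (M i j)
      ; unshared    = unshared
      ; inTime      = λ i i′ p same nonzero →
          ≤-respˡ-≈ (sym (t≈time X M i′ p))
            (≤-respʳ-≈ (sym (t≈time X M i p)) (inTime i i′ p same nonzero))
      }
      where
      open OnTime onTime
      available : ∀ j l → l ≢ zero → ∃ λ i′ → M i′ j ≡ l
      available j zero    l≢0 = contradiction ≡.refl l≢0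
      available j (suc k) _   = full j k

    -- The makespan `s` is a parameter and not a coordinate: extreme points are sought in a slice
    -- with fixed `s`, whose coordinates are all nonnegative.
    lp-definable : ∀ {m n} (M : Matrix m n b) → ∀ s → Definable (LPFeasible u M s)
    lp-definable M s = ⇔-definable
      (λ X (makespan , inTime , isPartition) → record
        { makespan = makespan ; inTime = λ i i′ {j′} {j} → inTime i i′ j′ j ; isPartition = isPartition })
      (λ X lp → let open LPFeasible lp in makespan , (λ i i′ j′ j → inTime i i′) , isPartition)
      (×-definable (∀-definable λ i → ≤-definable (∑ λ k → pace u (M i k) ⊛ var k) (const s))
      (×-definable (∀-definable λ i → ∀-definable λ i′ → ∀-definable λ j′ → ∀-definable λ j →
                      →-definable (_ ℕₚ.≟ _) (→-definable (¬? (i Finₚ.≟ i′))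
                      (→-definable (M i j Finₚ.≟ M i′ j′) (→-definable (¬? (M i j Finₚ.≟ zero))
                      (≤-definable (clock i′ j′) (clock i j′))))))
      (×-definable (∀-definable λ j → ≤-definable (const 0#) (var j))
                   (≈-definable (∑ var) (const 1#)))))
      where
      clock : ∀ i j → Affine _
      clock i j = ∑ λ k → pace u (M i (inject! {i = suc j} k)) ⊛ var (inject! {i = suc j} k)

    module _ {m} (1≤m : 1 ℕ.≤ m) (u≤1 : ∀ k → u k ≤ 1#) where

      T-lowerBound : ∀ {n s} {X : Vector Carrier n} {M : Matrix m n b} → BikesUnshared M →
        IsPartition u X M →
                     (∀ i → arrival u X M i ≤ s) → T m u ≤ s
      T-lowerBound {s = s} {X} {M} unshared (0≤X , ΣX≈1) ≤s = *-cancelˡ-≤ (·1-positive 1≤m)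
        (≤-trans (≤-reflexive (trans (m*T≈totalPace 1≤m u) (sym (trans (*-congˡ ΣX≈1) (*-identityʳ _)))))
        (≤-trans (Σarrival-≥ u≤1 X M 0≤X unshared)
        (≤-trans (sum-mono-≤ {f = arrival u X M} {g = λ _ → s} ≤s) (≤-reflexive (sum-const m s)))))

      -- Full columns make the average of the arrival times exactly `T m u`; if nobody is above the
      -- average, nobody is below it.
      T-attained : ∀ {n} {X : Vector Carrier n} {M : Matrix m n b} → FullColumns M → BikesUnshared M →
                   IsPartition u X M → (∀ i → arrival u X M i ≤ T m u) → ∀ i → arrival u X M i ≈ T m u
      T-attained {X = X} {M} full unshared (0≤X , ΣX≈1) ≤T i = antisym (≤T i)
        (sum-tight {f = arrival u X M} {g = λ _ → T m u} ≤T (≤-reflexive (begin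
          sum {m} (λ _ → T m u)   ≈⟨ sum-const m (T m u) ⟩
          m · 1# * T m u          ≈⟨ m*T≈totalPace 1≤m u ⟩
          totalPace m u           ≈⟨ trans (*-congˡ ΣX≈1) (*-identityʳ _) ⟨
          totalPace m u * sum X   ≈⟨ Σarrival-≈ X M full unshared ⟨
          sum (arrival u X M)     ∎)) i)
        where open SetoidReasoning setoid

      T≤τ : ∀ {S : Schedule m b} → Feasible u S → T m u ≤ τ u S
      T≤τ {schedule X M} feasible = T-lowerBound {M = M} unshared isPartition (≤-maximum (arrival u X M))
        where open Feasible feasible

      -- The old lengths show that the optimum is at most `T m u`, and with full columns a makespan
      -- of at most `T m u` forces every agent to arrive exactly then. The argument applies to any
      -- optimal solution.
      inducedPartition-onTime : ∀ {n} {X X′ : Vector Carrier n} {M : Matrix m n b} →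
        OnTime X M → InducedPartition u M X′ → OnTime X′ M
      inducedPartition-onTime onTime (s , (lp , s-least) , _) = record
        { full        = full
        ; unshared    = unshared
        ; isPartition = LPFeasible.isPartition lp
        ; inTime      = lp⇒inTime lp
        ; punctual    = T-attained full unshared (LPFeasible.isPartition lp)
            λ i → ≤-trans (LPFeasible.makespan lp i) (s-least _ _ (onTime⇒lp onTime))
        }
        where open OnTime onTime

      -- As T is a lower bound of the makespan, an extreme point of the face
      -- s = T is an optimal vertex.
      extreme⇒inducedPartition : ∀ {n} {X : Vector Carrier n} {M : Matrix m n b} →
        BikesUnshared M → Extreme (LPFeasible u M (T m u)) X → InducedPartition u M X
      extreme⇒inducedPartition {X = X} {M} unshared (lp , extreme) =
        T m u , (lp , λ s X₁ lp₁ → T≤s {s} {X₁} lp₁) , lp , λ s₁ X₁ s₂ X₂ lp₁ lp₂ a 0<a a<1 T≈ X≈ →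
          let s₁≈s₂ = convex-min {T m u} {s₁} {s₂} {a} 0<a a<1 T≈ (T≤s {s₁} {X₁} lp₁) (T≤s {s₂} {X₂} lp₂)
              s₁≈T  = sym (trans T≈ (convex-same {s₁} {s₂} {a} s₁≈s₂))
          in s₁≈s₂ , extreme X₁ X₂
            (lp-relax (≤-reflexive s₁≈T) lp₁) (lp-relax (≤-reflexive (trans (sym s₁≈s₂) s₁≈T)) lp₂)
            a 0<a a<1 X≈
        where
        T≤s : ∀ {s X} → LPFeasible u M s X → T m u ≤ s
        T≤s {s} {X} lp = T-lowerBound {s = s} {X} {M} unshared
          (LPFeasible.isPartition lp) (LPFeasible.makespan lp)

      inducedPartition-exists : ∀ {n} {X : Vector Carrier n} {M : Matrix m n b} →
        OnTime X M → ∃ (InducedPartition u M)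
      inducedPartition-exists {X = X} {M} onTime =
        let (Y , extreme) = definable-extremePoint (lp-definable M (T m u))
              (λ X lp → proj₁ (LPFeasible.isPartition lp)) (X , onTime⇒lp onTime)
        in Y , extreme⇒inducedPartition (OnTime.unshared onTime) extreme

-- Combinatorics of column deletion and row exchange

toℕ-punchIn-< : ∀ {n} (j : Fin (suc n)) k → toℕ k ℕ.< toℕ j → toℕ (punchIn j k) ≡ toℕ k
toℕ-punchIn-< (suc j) zero    _         = ≡.refl
toℕ-punchIn-< (suc j) (suc k) (s≤s k<j) = ≡.cong suc (toℕ-punchIn-< j k k<j)

toℕ-punchIn-≥ : ∀ {n} (j : Fin (suc n)) k → toℕ j ℕ.≤ toℕ k → toℕ (punchIn j k) ≡ suc (toℕ k)
toℕ-punchIn-≥ zero    k       _         = ≡.refl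
toℕ-punchIn-≥ (suc j) (suc k) (s≤s j≤k) = ≡.cong suc (toℕ-punchIn-≥ j k j≤k)

module _ {m n b} (M : Matrix m n b) (i i′ : Fin m) (j : Fin n) where

  exchangeFrom-≥ : ∀ r {k} → toℕ j ℕ.≤ toℕ k → exchangeFrom M i i′ j r k ≡ M (transpose i i′ r) k
  exchangeFrom-≥ r {k} j≤k with toℕ j ℕₚ.≤? toℕ k
  ... | yes _   = ≡.refl
  ... | no  j≰k = contradiction j≤k j≰k

  exchangeFrom-< : ∀ r {k} → toℕ k ℕ.< toℕ j → exchangeFrom M i i′ j r k ≡ M r k
  exchangeFrom-< r {k} k<j with toℕ j ℕₚ.≤? toℕ k
  ... | yes j≤k = contradiction k<j (ℕₚ.≤⇒≯ j≤k)
  ... | no  _   = ≡.refl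

transpose-left : ∀ {n} (i i′ : Fin n) → transpose i i′ i ≡ i′
transpose-left i i′ with i Finₚ.≟ i
... | yes _  = ≡.refl
... | no i≢i = contradiction ≡.refl i≢i

transpose-right : ∀ {n} (i i′ : Fin n) → transpose i i′ i′ ≡ i
transpose-right i i′ with i′ Finₚ.≟ i
... | yes i′≡i = i′≡i
... | no  _ with i′ Finₚ.≟ i′
...   | yes _    = ≡.refl
...   | no i′≢i′ = contradiction ≡.refl i′≢i′

transpose-other : ∀ {n} (i i′ : Fin n) {r} → r ≢ i → r ≢ i′ → transpose i i′ r ≡ r
transpose-other i i′ {r} r≢i r≢i′ with r Finₚ.≟ i
... | yes r≡i = contradiction r≡i r≢i
... | no  _ with r Finₚ.≟ i′
...   | yes r≡i′ = contradiction r≡i′ r≢i′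
...   | no  _    = ≡.refl

-- The termination measure of Reduce: the number of columns, then the number
-- of label changes along the rows. Removing a swap-switch lowers the latter.
module Breaks where
  open MonoidSum ℕₚ.+-0-commutativeMonoid using (sum; sum-remove; sum-cong-≗)

  private
    variable
      b m n : ℕ

  break : (l l′ : Fin b) → ℕ
  break l l′ with l Finₚ.≟ l′
  ... | yes _ = 0
  ... | no  _ = 1

  break-≡ : ∀ {l l′ : Fin b} → l ≡ l′ → break l l′ ≡ 0
  break-≡ {l = l} {l′} l≡l′ with l Finₚ.≟ l′
  ... | yes _    = ≡.refl
  ... | no  l≢l′ = contradiction l≡l′ l≢l′

  break-≢ : ∀ {l l′ : Fin b} → l ≢ l′ → break l l′ ≡ 1
  break-≢ {l = l} {l′} l≢l′ with l Finₚ.≟ l′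
  ... | yes l≡l′ = contradiction l≡l′ l≢l′
  ... | no  _    = ≡.refl

  break-≤1 : ∀ (l l′ : Fin b) → break l l′ ℕ.≤ 1
  break-≤1 l l′ with l Finₚ.≟ l′
  ... | yes _ = z≤n
  ... | no  _ = s≤s z≤n

  breaks : Vector (Fin b) n → ℕ
  breaks {n = zero}        v = 0
  breaks {n = suc zero}    v = 0
  breaks {n = suc (suc n)} v = break (v zero) (v (suc zero)) ℕ.+ breaks (tail v)

  breaks-cong : ∀ {v w : Vector (Fin b) n} → (∀ k → v k ≡ w k) → breaks v ≡ breaks w
  breaks-cong {n = zero}        v≡w = ≡.refl
  breaks-cong {n = suc zero}    v≡w = ≡.refl
  breaks-cong {n = suc (suc n)} v≡w =
    ≡.cong₂ ℕ._+_ (≡.cong₂ break (v≡w zero) (v≡w (suc zero))) (breaks-cong (v≡w ∘ suc))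

  -- The two rows exchange their tails at a cut where both have a break. Breaks elsewhere only move
  -- to the other row. At the cut `w⁺` goes on with the same label, so two breaks become at most
  -- one.
  breaks-splice : ∀ (v w v⁺ w⁺ : Vector (Fin b) n) j′ j → j′ PrecedesCol j →
    (∀ k → toℕ k ℕ.< toℕ j → v⁺ k ≡ v k) → (∀ k → toℕ k ℕ.< toℕ j → w⁺ k ≡ w k) →
    (∀ k → toℕ j ℕ.≤ toℕ k → v⁺ k ≡ w k) → (∀ k → toℕ j ℕ.≤ toℕ k → w⁺ k ≡ v k) →
    w j′ ≡ v j → v j′ ≢ v j → w j′ ≢ w j → breaks v⁺ ℕ.+ breaks w⁺ ℕ.< breaks v ℕ.+ breaks w
  breaks-splice v w v⁺ w⁺ zero (suc zero) _ v< w< v≥ w≥ join v-break w-break = begin-strict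
    break (v⁺ zero) (v⁺ (suc zero)) + breaks (tail v⁺) +
    (break (w⁺ zero) (w⁺ (suc zero)) + breaks (tail w⁺))
      ≡⟨ ≡.cong₂ _+_ (≡.cong (_ +_) (breaks-cong λ k → v≥ (suc k) (s≤s z≤n)))
                     (≡.cong₂ _+_ (break-≡ (≡.trans (w< zero (s≤s z≤n))
                       (≡.trans join (≡.sym (w≥ (suc zero) (s≤s z≤n))))))
                                  (breaks-cong λ k → w≥ (suc k) (s≤s z≤n))) ⟩
    break (v⁺ zero) (v⁺ (suc zero)) + breaks (tail w) + breaks (tail v)
      ≤⟨ ℕₚ.+-monoˡ-≤ (breaks (tail v))
        (ℕₚ.+-monoˡ-≤ (breaks (tail w)) (break-≤1 (v⁺ zero) (v⁺ (suc zero)))) ⟩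
    suc (breaks (tail w)) + breaks (tail v)
      ≡⟨ ℕₚ.+-comm (suc (breaks (tail w))) (breaks (tail v)) ⟩
    breaks (tail v) + suc (breaks (tail w))
      <⟨ ℕₚ.n<1+n _ ⟩
    suc (breaks (tail v)) + suc (breaks (tail w))
      ≡⟨ ≡.cong₂ _+_ (≡.cong (_+ breaks (tail v)) (break-≢ v-break))
        (≡.cong (_+ breaks (tail w)) (break-≢ w-break)) ⟨
    break (v zero) (v (suc zero)) + breaks (tail v) + (break (w zero) (w (suc zero)) + breaks (tail w)) ∎
    where
    open ℕₚ.≤-Reasoning
    open import Data.Nat.Base using (_+_)
  breaks-splice v w v⁺ w⁺ (suc j′) (suc (suc j)) prec v< w< v≥ w≥ join v-break w-break = begin-strict
    break (v⁺ zero) (v⁺ (suc zero)) + breaks (tail v⁺) +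
    (break (w⁺ zero) (w⁺ (suc zero)) + breaks (tail w⁺))
      ≡⟨ ≡.cong₂ _+_ (≡.cong (_+ breaks (tail v⁺))
        (≡.cong₂ break (v< zero (s≤s z≤n)) (v< (suc zero) (s≤s (s≤s z≤n)))))
                     (≡.cong (_+ breaks (tail w⁺))
                       (≡.cong₂ break (w< zero (s≤s z≤n)) (w< (suc zero) (s≤s (s≤s z≤n))))) ⟩
    break (v zero) (v (suc zero)) + breaks (tail v⁺) + (break (w zero) (w (suc zero)) + breaks (tail w⁺))
      ≡⟨ interchange (break (v zero) (v (suc zero))) (breaks (tail v⁺)) (break (w zero) (w (suc zero)))
        (breaks (tail w⁺)) ⟩
    break (v zero) (v (suc zero)) + break (w zero) (w (suc zero)) + (breaks (tail v⁺) + breaks (tail w⁺))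
      <⟨ ℕₚ.+-monoʳ-< (break (v zero) (v (suc zero)) + break (w zero) (w (suc zero)))
           (breaks-splice (tail v) (tail w) (tail v⁺) (tail w⁺) j′ (suc j) (ℕₚ.suc-injective prec)
             (λ k → v< (suc k) ∘ s≤s) (λ k → w< (suc k) ∘ s≤s) (λ k → v≥ (suc k) ∘ s≤s)
               (λ k → w≥ (suc k) ∘ s≤s)
             join v-break w-break) ⟩
    break (v zero) (v (suc zero)) + break (w zero) (w (suc zero)) + (breaks (tail v) + breaks (tail w))
      ≡⟨ interchange (break (v zero) (v (suc zero))) (break (w zero) (w (suc zero))) (breaks (tail v))
        (breaks (tail w)) ⟩
    break (v zero) (v (suc zero)) + breaks (tail v) + (break (w zero) (w (suc zero)) + breaks (tail w)) ∎
    where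
    open ℕₚ.≤-Reasoning
    open import Data.Nat.Base using (_+_)
    open import Algebra.Properties.CommutativeSemigroup ℕₚ.+-commutativeSemigroup using (interchange)

  sum-two-< : ∀ {f g : Fin m → ℕ} i i′ → i ≢ i′ → (∀ r → r ≢ i → r ≢ i′ → f r ≡ g r) →
              f i ℕ.+ f i′ ℕ.< g i ℕ.+ g i′ → sum f ℕ.< sum g
  sum-two-< {suc zero}    zero zero i≢i′ _ _ = contradiction ≡.refl i≢i′
  sum-two-< {suc (suc m)} {f} {g} i i′ i≢i′ f≡g f<g = begin-strict
    sum f                                        ≡⟨ split f ⟩
    f i ℕ.+ f i′ ℕ.+ sum (f ∘ punchIn i ∘ punchIn k)  ≡⟨ ≡.cong (f i ℕ.+ f i′ ℕ.+_)
      (sum-cong-≗ λ r → f≡g _ (Finₚ.punchInᵢ≢i i _)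
          λ eq → Finₚ.punchInᵢ≢i k r
            (Finₚ.punchIn-injective i _ _ (≡.trans eq (≡.sym (Finₚ.punchIn-punchOut i≢i′))))) ⟩
    f i ℕ.+ f i′ ℕ.+ sum (g ∘ punchIn i ∘ punchIn k)  <⟨ ℕₚ.+-monoˡ-< _ f<g ⟩
    g i ℕ.+ g i′ ℕ.+ sum (g ∘ punchIn i ∘ punchIn k)  ≡⟨ split g ⟨
    sum g                                        ∎
    where
    open ℕₚ.≤-Reasoning
    k = punchOut i≢i′
    split : ∀ h → sum h ≡ h i ℕ.+ h i′ ℕ.+ sum (h ∘ punchIn i ∘ punchIn k)
    split h = ≡.trans (sum-remove {i = i} h) (≡.trans
      (≡.cong (h i ℕ.+_) (≡.trans (sum-remove {i = k} (removeAt h i))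
        (≡.cong (λ r → h r ℕ.+ sum (h ∘ punchIn i ∘ punchIn k)) (Finₚ.punchIn-punchOut i≢i′))))
      (≡.sym (ℕₚ.+-assoc (h i) (h i′) _)))

  totalBreaks : Matrix m n b → ℕ
  totalBreaks M = sum λ i → breaks (M i)

  totalBreaks-exchange : ∀ (M : Matrix m n b) {i i′ j′ j} → BikesUnshared M → j′ PrecedesCol j → i ≢ i′ →
    M i j ≡ M i′ j′ → M i j ≢ zero → totalBreaks (exchangeFrom M i i′ j) ℕ.< totalBreaks M
  totalBreaks-exchange M {i} {i′} {j′} {j} unshared prec i≢i′ same nonzero = sum-two-< i i′ i≢i′
    (λ r r≢i r≢i′ → breaks-cong (other r≢i r≢i′))
    (breaks-splice (M i) (M i′) (exchangeFrom M i i′ j i) (exchangeFrom M i i′ j i′) j′ j prec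
      (λ k → exchangeFrom-< M i i′ j i) (λ k → exchangeFrom-< M i i′ j i′)
      (λ k j≤k → ≡.trans (exchangeFrom-≥ M i i′ j i j≤k) (≡.cong (λ r → M r k) (transpose-left i i′)))
      (λ k j≤k → ≡.trans (exchangeFrom-≥ M i i′ j i′ j≤k) (≡.cong (λ r → M r k) (transpose-right i i′)))
      (≡.sym same)
      -- Both rows change label at the cut: if row `i` did not, the bike would be shared in column
      -- `j′`; if row `i′` did not, it would be shared in column `j`.
      (λ stays → unshared i′ j′ (λ z → nonzero (≡.trans same z)) i i≢i′ (≡.trans stays same))
      (λ stays → unshared i j nonzero i′ (i≢i′ ∘ ≡.sym) (≡.trans (≡.sym stays) (≡.sym same))))
    where
    other : ∀ {r} → r ≢ i → r ≢ i′ → ∀ k → exchangeFrom M i i′ j r k ≡ M r k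
    other {r} r≢i r≢i′ k with toℕ j ℕₚ.≤? toℕ k
    ... | yes _ = ≡.cong (λ r → M r k) (transpose-other i i′ r≢i r≢i′)
    ... | no  _ = ≡.refl

  _≺_ : ℕ × ℕ → ℕ × ℕ → Set
  _≺_ = ×-Lex _≡_ ℕ._<_ ℕ._<_

  ≺-wellFounded : WellFounded _≺_
  ≺-wellFounded = ×-wellFounded ℕᵢ.<-wellFounded ℕᵢ.<-wellFounded

  measure : Matrix m n b → ℕ × ℕ
  measure {n = n} M = n , totalBreaks M

-- Standardization and termination of Reduce

module Standardization {c ℓ₁ ℓ₂} (F : OrderedField c ℓ₁ ℓ₂) where
  open OrderedField F
  open BikeSharing F
  open FieldProperties F
  open PrefixSums F
  open OnTimeSchedules F
  open Breaks

  module _ {n} {f g : Vector Carrier n} {j′ : Fin n} {a : Carrier}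
           (g≈f : ∀ k → k ≢ j′ → g k ≈ f k) (gj′≈ : g j′ ≈ f j′ + a) where

    prefix-bump-≤ : ∀ {c} → c ℕ.≤ toℕ j′ → prefix g c ≈ prefix f c
    prefix-bump-≤ {c} c≤j′ = prefix-agree c λ k k<c → g≈f k λ { ≡.refl → ℕₚ.<⇒≱ k<c c≤j′ }

    prefix-bump-> : ∀ {c} → toℕ j′ ℕ.< c → prefix g c ≈ prefix f c + a
    prefix-bump-> {c} j′<c = trans (sym (+-identityˡ _)) (trans
      (prefix-resume {f = g} {g = f} 0# a start
        (λ k j′<k → g≈f k λ { ≡.refl → ℕₚ.<-irrefl ≡.refl j′<k }) j′<c)
      (+-comm a _))
      where
      start : 0# + prefix g (suc (toℕ j′)) ≈ a + prefix f (suc (toℕ j′))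
      start = trans (+-congˡ (trans (prefix-suc g j′) (+-cong (prefix-bump-≤ ℕₚ.≤-refl) gj′≈)))
        (trans (solve 3 (λ p x a → :0 :+ (p :+ (x :+ a)) := a :+ (p :+ x)) refl (prefix f (toℕ j′))
          (f j′) a)
               (+-congˡ (sym (prefix-suc f j′))))

  module _ {b} (u : Vector Carrier b) where

    private
      variable
        m n : ℕ

    -- The common part of both deletions. The cut to the left of column `j` is the one that is lost,
    -- hence the strict inequality for the clocks before it: a merge lengthens the preceding column,
    -- whose right end then becomes the old right end of `j`. The last hypothesis is the handover
    -- between the two columns that become adjacent.
    deleteColumn : ∀ (X : Vector Carrier (suc n)) (M : Matrix m (suc n) b) (j : Fin (suc n))
      (X⁻ : Vector Carrier n) →
      OnTime u X M → IsPartition u X⁻ (λ i → removeAt (M i) j) →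
      (∀ i {c} → c ℕ.< toℕ j → time u X⁻ (λ i → removeAt (M i) j) i c ≈ time u X M i c) →
      (∀ i {c} → toℕ j ℕ.≤ c → time u X⁻ (λ i → removeAt (M i) j) i c ≈ time u X M i (suc c)) →
      (∀ i i′ {j⁻ j⁺} → j⁻ PrecedesCol j → j PrecedesCol j⁺ → M i j⁺ ≡ M i′ j⁻ → M i j⁺ ≢ zero →
        time u X M i′ (toℕ j⁺) ≤ time u X M i (toℕ j⁺)) →
      OnTime u X⁻ (λ i → removeAt (M i) j)
    deleteColumn {n} {m} X M j X⁻ onTime isPartition⁻ before after bridge = record
      { full        = λ k p → full (punchIn j k) p
      ; unshared    = λ i k → unshared i (punchIn j k)
      ; isPartition = isPartition⁻
      ; inTime      = inTime⁻
      ; punctual    = λ i → trans (sym (prefix-all (leg u X⁻ M⁻ i)))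
          (trans (after i (ℕₚ.≤-pred (Finₚ.toℕ<n j)))
                        (trans (prefix-all (leg u X M i)) (punctual i)))
      }
      where
      open OnTime onTime
      M⁻ : Matrix m n b
      M⁻ i = removeAt (M i) j
      inTime⁻ : InTime u X⁻ M⁻
      inTime⁻ i i′ {k′} {k} k′→k same nonzero with ℕₚ.<-cmp (toℕ k) (toℕ j)
      ... | tri< k<j _ _ = ≤-respˡ-≈ (sym (before i′ k<j)) (≤-respʳ-≈ (sym (before i k<j))
        (≡.subst (λ c → time u X M i′ c ≤ time u X M i c) (toℕ-punchIn-< j k k<j)
          (inTime i i′ prec same nonzero)))
        where
        prec : punchIn j k′ PrecedesCol punchIn j k
        prec = ≡.trans (≡.cong suc (toℕ-punchIn-< j k′ (ℕₚ.<-trans (ℕₚ.≤-reflexive k′→k) k<j)))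
                 (≡.trans k′→k (≡.sym (toℕ-punchIn-< j k k<j)))
      ... | tri≈ _ k≡j _ = ≤-respˡ-≈ (sym (after i′ j≤k)) (≤-respʳ-≈ (sym (after i j≤k))
        (≡.subst (λ c → time u X M i′ c ≤ time u X M i c) k⁺
          (bridge i i′ prec⁻ (≡.trans (≡.cong suc (≡.sym k≡j)) (≡.sym k⁺)) same nonzero)))
        where
        j≤k = ℕₚ.≤-reflexive (≡.sym k≡j)
        k⁺ = toℕ-punchIn-≥ j k j≤k
        prec⁻ : punchIn j k′ PrecedesCol j
        prec⁻ = ≡.trans (≡.cong suc (toℕ-punchIn-< j k′ (ℕₚ.≤-reflexive (≡.trans k′→k k≡j))))
          (≡.trans k′→k k≡j)
      ... | tri> _ _ j<k = ≤-respˡ-≈ (sym (after i′ j≤k)) (≤-respʳ-≈ (sym (after i j≤k))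
        (≡.subst (λ c → time u X M i′ c ≤ time u X M i c) (toℕ-punchIn-≥ j k j≤k)
          (inTime i i′ prec same nonzero)))
        where
        j≤k = ℕₚ.<⇒≤ j<k
        prec : punchIn j k′ PrecedesCol punchIn j k
        prec = ≡.trans (≡.cong suc
          (toℕ-punchIn-≥ j k′ (ℕₚ.≤-pred (ℕₚ.≤-trans j<k (ℕₚ.≤-reflexive (≡.sym k′→k))))))
                 (≡.trans (≡.cong suc k′→k) (≡.sym (toℕ-punchIn-≥ j k j≤k)))

    -- A bike used on both sides of the deleted column has a rider `r` inside it, because columns
    -- are full. The two old handovers through `r` compose, as no time passes in between.
    deleteZero-onTime : ∀ (X : Vector Carrier (suc n)) (M : Matrix m (suc n) b) j → X j ≈ 0# →
                        OnTime u X M → OnTime u (removeAt X j) (λ i → removeAt (M i) j)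
    deleteZero-onTime {n} {m} X M j Xj≈0 onTime = deleteColumn X M j (removeAt X j) onTime
      ((λ k → proj₁ isPartition (punchIn j k)) , trans (sym sum-removed) (proj₂ isPartition))
      (λ i c<j → prefix-removeAt-≤ (leg u X M i) j (ℕₚ.<⇒≤ c<j))
      (λ i {c} j≤c → trans (sym (+-identityʳ _)) (trans (+-congˡ (sym (leg≈0 i)))
        (prefix-removeAt-≥ (leg u X M i) j j≤c)))
      bridge
      where
      open OnTime onTime
      sum-removed : sum X ≈ sum (removeAt X j)
      sum-removed = trans (sum-remove {i = j} X) (trans (+-congʳ Xj≈0) (+-identityˡ _))
      leg≈0 : ∀ i → leg u X M i j ≈ 0#
      leg≈0 i = trans (*-congˡ Xj≈0) (zeroʳ _)
      pause : ∀ i {j⁺} → j PrecedesCol j⁺ → time u X M i (toℕ j⁺) ≈ time u X M i (toℕ j)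
      pause i j→j⁺ = trans (reflexive (≡.cong (time u X M i) (≡.sym j→j⁺)))
        (trans (prefix-suc (leg u X M i) j) (trans (+-congˡ (leg≈0 i)) (+-identityʳ _)))
      user : ∀ l → l ≢ zero → ∃ λ i → M i j ≡ l
      user zero    l≢0 = contradiction ≡.refl l≢0
      user (suc p) _   = full j p
      bridge : ∀ i i′ {j⁻ j⁺} → j⁻ PrecedesCol j → j PrecedesCol j⁺ → M i j⁺ ≡ M i′ j⁻ → M i j⁺ ≢ zero →
               time u X M i′ (toℕ j⁺) ≤ time u X M i (toℕ j⁺)
      bridge i i′ {j⁻} {j⁺} j⁻→j j→j⁺ same nonzero =
        let (r , Mrj≡) = user (M i j⁺) nonzero
        in ≤-trans (≤-reflexive (pause i′ j→j⁺))
          (≤-trans (inTime r i′ j⁻→j (≡.trans Mrj≡ same) (λ z → nonzero (≡.trans (≡.sym Mrj≡) z)))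
          (≤-trans (≤-reflexive (sym (pause r j→j⁺)))
                   (inTime i r j→j⁺ (≡.sym Mrj≡) nonzero)))

    deleteRedundant-onTime : ∀ (X : Vector Carrier (suc n)) (M : Matrix m (suc n) b) j′ j →
      RedundantColumn M j′ j →
      OnTime u X M → OnTime u (removeAt (updateAt X j′ (_+ X j)) j) (λ i → removeAt (M i) j)
    deleteRedundant-onTime {n} {m} X M j′ j (j′→j , same) onTime =
      deleteColumn X M j (removeAt X⁺ j) onTime
        ((λ k → X⁺-nonNegative (punchIn j k)) , trans sum-merged (proj₂ isPartition))
        (λ i c<j → trans (prefix-removeAt-≤ (leg u X⁺ M i) j (ℕₚ.<⇒≤ c<j))
          (prefix-bump-≤ {f = leg u X M i} {a = leg u X M i j} (legs i) (leg-j′ i)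
            (ℕₚ.≤-pred (ℕₚ.≤-trans c<j (ℕₚ.≤-reflexive (≡.sym j′→j))))))
        (λ i j≤c → +-cancelʳ-≈ (leg u X M i j)
          (trans (+-congˡ (sym (legs i j j≢j′))) (trans (prefix-removeAt-≥ (leg u X⁺ M i) j j≤c)
            (prefix-bump-> {f = leg u X M i} {a = leg u X M i j} (legs i) (leg-j′ i)
              (ℕₚ.m≤n⇒m≤1+n (ℕₚ.≤-trans (ℕₚ.≤-reflexive j′→j) j≤c))))))
        -- Here `j⁻` is `j′`, whose labels column `j` repeats, so the new handover from `j⁻` to `j⁺`
        -- is the old one from `j` to `j⁺`.
        λ i i′ {j⁻} {j⁺} j⁻→j j→j⁺ same′ nonzero → inTime i i′ j→j⁺
          (≡.trans same′ (≡.trans (≡.cong (M i′)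
            (Finₚ.toℕ-injective (ℕₚ.suc-injective (≡.trans j⁻→j (≡.sym j′→j)))))
            (≡.sym (same i′)))) nonzero
      where
      open OnTime onTime
      X⁺ : Vector Carrier (suc n)
      X⁺ = updateAt X j′ (_+ X j)
      j≢j′ : j ≢ j′
      j≢j′ ≡.refl = ℕₚ.1+n≢n j′→j
      X⁺≡X : ∀ k → k ≢ j′ → X⁺ k ≡ X k
      X⁺≡X k k≢j′ = updateAt-minimal k j′ X k≢j′
      X⁺j′ : X⁺ j′ ≡ X j′ + X j
      X⁺j′ = updateAt-updates j′ X
      X⁺-nonNegative : ∀ k → 0# ≤ X⁺ k
      X⁺-nonNegative k with k Finₚ.≟ j′
      ... | yes ≡.refl = ≤-respʳ-≈ (reflexive (≡.sym X⁺j′))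
                           (+-nonNegative (proj₁ isPartition j′) (proj₁ isPartition j))
      ... | no  k≢j′   = ≤-respʳ-≈ (reflexive (≡.sym (X⁺≡X k k≢j′))) (proj₁ isPartition k)
      legs : ∀ i k → k ≢ j′ → leg u X⁺ M i k ≈ leg u X M i k
      legs i k k≢j′ = *-congˡ (reflexive (X⁺≡X k k≢j′))
      leg-j′ : ∀ i → leg u X⁺ M i j′ ≈ leg u X M i j′ + leg u X M i j
      leg-j′ i = trans (*-congˡ (reflexive X⁺j′)) (trans (distribˡ _ _ _)
        (+-congˡ (*-congʳ (reflexive (≡.cong (pace u) (≡.sym (same i)))))))
      sum-merged : sum (removeAt X⁺ j) ≈ sum X
      sum-merged = +-cancelʳ-≈ (X j) (begin
        sum (removeAt X⁺ j) + X j   ≈⟨ trans (+-comm _ _) (+-congʳ (reflexive (≡.sym (X⁺≡X j j≢j′)))) ⟩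
        X⁺ j + sum (removeAt X⁺ j)  ≈⟨ sum-remove {i = j} X⁺ ⟨
        sum X⁺                      ≈⟨ prefix-all X⁺ ⟨
        prefix X⁺ (suc n)           ≈⟨ prefix-bump-> {f = X} {a = X j} (λ k → reflexive ∘ X⁺≡X k)
          (reflexive X⁺j′) (Finₚ.toℕ<n j′) ⟩
        prefix X (suc n) + X j      ≈⟨ +-congʳ (prefix-all X) ⟩
        sum X + X j                 ∎)
        where open SetoidReasoning setoid

    -- The clocks of `i` and `i′` agree at the cut, so from there on row `r` simply carries the
    -- clock of `π r`; arrival times are permuted and handover conditions are renamed.
    removeSwitch-onTime : ∀ (X : Vector Carrier n) (M : Matrix m n b) i i′ j′ j →
      SwapSwitch u X M i i′ j′ j →
                          OnTime u X M → OnTime u X (exchangeFrom M i i′ j)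
    removeSwitch-onTime {n} {m} X M i i′ j′ j (j′→j , i≢i′ , same , nonzero , meet) onTime = record
      { full        = full⁺
      ; unshared    = unshared⁺
      ; isPartition = isPartition
      ; inTime      = inTime⁺
      ; punctual    = λ r → trans (sym (prefix-all (leg u X M⁺ r)))
          (trans (time-≥ r (ℕₚ.<⇒≤ (Finₚ.toℕ<n j)))
            (trans (prefix-all (leg u X M (π r))) (punctual (π r))))
      }
      where
      open OnTime onTime
      M⁺ : Matrix m n b
      M⁺ = exchangeFrom M i i′ j
      π : Fin m → Fin m
      π = transpose i i′
      π-injective : ∀ {r r′} → π r ≡ π r′ → r ≡ r′
      π-injective eq = ≡.trans (≡.sym (transpose-inverse i′ i))
        (≡.trans (≡.cong (transpose i′ i) eq) (transpose-inverse i′ i))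
      M⁺-≥ : ∀ r {k} → toℕ j ℕ.≤ toℕ k → M⁺ r k ≡ M (π r) k
      M⁺-≥ = exchangeFrom-≥ M i i′ j
      M⁺-< : ∀ r {k} → toℕ k ℕ.< toℕ j → M⁺ r k ≡ M r k
      M⁺-< = exchangeFrom-< M i i′ j
      meet′ : time u X M i (toℕ j) ≈ time u X M i′ (toℕ j)
      meet′ = trans (sym (t≈time u X M i j′→j)) (trans meet (t≈time u X M i′ j′→j))
      time-π : ∀ r → time u X M r (toℕ j) ≈ time u X M (π r) (toℕ j)
      time-π r = go (r Finₚ.≟ i) (r Finₚ.≟ i′)
        where
        at-π : ∀ {r″} → π r ≡ r″ → time u X M r″ (toℕ j) ≈ time u X M (π r) (toℕ j)
        at-π eq = reflexive (≡.cong (λ r → time u X M r (toℕ j)) (≡.sym eq))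
        go : Dec (r ≡ i) → Dec (r ≡ i′) → time u X M r (toℕ j) ≈ time u X M (π r) (toℕ j)
        go (yes ≡.refl) _            = trans meet′ (at-π (transpose-left i i′))
        go (no  _)      (yes ≡.refl) = trans (sym meet′) (at-π (transpose-right i i′))
        go (no  r≢i)    (no  r≢i′)   = at-π (transpose-other i i′ r≢i r≢i′)
      time-≤ : ∀ r {c} → c ℕ.≤ toℕ j → time u X M⁺ r c ≈ time u X M r c
      time-≤ r {c} c≤j = prefix-agree c λ k k<c → *-congʳ
        (reflexive (≡.cong (pace u) (M⁺-< r (ℕₚ.≤-trans k<c c≤j))))
      time-≥ : ∀ r {c} → toℕ j ℕ.≤ c → time u X M⁺ r c ≈ time u X M (π r) c
      time-≥ r {c} j≤c = trans (sym (+-identityˡ _)) (trans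
        (prefix-resume {f = leg u X M⁺ r} {g = leg u X M (π r)} 0# 0#
          (+-congˡ (trans (time-≤ r ℕₚ.≤-refl) (time-π r)))
          (λ k j≤k → *-congʳ (reflexive (≡.cong (pace u) (M⁺-≥ r j≤k)))) j≤c)
        (+-identityˡ _))
      full⁺ : FullColumns u M⁺
      full⁺ k p with full k p | ℕₚ.<-≤-connex (toℕ k) (toℕ j)
      ... | r , Mrk≡p | inj₁ k<j = r , ≡.trans (M⁺-< r k<j) Mrk≡p
      ... | r , Mrk≡p | inj₂ j≤k = transpose i′ i r ,
        ≡.trans (M⁺-≥ _ j≤k) (≡.trans (≡.cong (λ r → M r k) (transpose-inverse i i′)) Mrk≡p)
      unshared⁺ : BikesUnshared M⁺
      unshared⁺ r k nz r′ r′≢r eq with ℕₚ.<-≤-connex (toℕ k) (toℕ j)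
      ... | inj₁ k<j = unshared r k (λ z → nz (≡.trans (M⁺-< r k<j) z)) r′ r′≢r
        (≡.trans (≡.sym (M⁺-< r′ k<j)) (≡.trans eq (M⁺-< r k<j)))
      ... | inj₂ j≤k = unshared (π r) k (λ z → nz (≡.trans (M⁺-≥ r j≤k) z)) (π r′) (r′≢r ∘ π-injective)
        (≡.trans (≡.sym (M⁺-≥ r′ j≤k)) (≡.trans eq (M⁺-≥ r j≤k)))
      inTime⁺ : InTime u X M⁺
      inTime⁺ r r′ {k′} {k} k′→k eq nz with ℕₚ.<-cmp (toℕ k) (toℕ j)
      ... | tri< k<j _ _ = ≤-respˡ-≈ (sym (time-≤ r′ (ℕₚ.<⇒≤ k<j)))
          (≤-respʳ-≈ (sym (time-≤ r (ℕₚ.<⇒≤ k<j)))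
        (inTime r r′ k′→k (≡.trans (≡.sym (M⁺-< r k<j))
          (≡.trans eq (M⁺-< r′ (ℕₚ.<-trans (ℕₚ.≤-reflexive k′→k) k<j))))
          (λ z → nz (≡.trans (M⁺-< r k<j) z))))
      -- Across the cut the giver is still in its old row while the taker is already renamed; the
      -- clocks at the cut can be read either way.
      ... | tri≈ _ k≡j _ = ≤-respˡ-≈ (sym (time-≤ r′ (ℕₚ.≤-reflexive k≡j)))
          (≤-respʳ-≈ (sym (time-≥ r j≤k))
        (inTime (π r) r′ k′→k (≡.trans (≡.sym (M⁺-≥ r j≤k))
          (≡.trans eq (M⁺-< r′ (ℕₚ.≤-reflexive (≡.trans k′→k k≡j)))))
          (λ z → nz (≡.trans (M⁺-≥ r j≤k) z))))
        where j≤k = ℕₚ.≤-reflexive (≡.sym k≡j)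
      ... | tri> _ _ j<k = ≤-respˡ-≈ (sym (time-≥ r′ j≤k)) (≤-respʳ-≈ (sym (time-≥ r j≤k))
        (inTime (π r) (π r′) k′→k (≡.trans (≡.sym (M⁺-≥ r j≤k)) (≡.trans eq (M⁺-≥ r′ j≤k′)))
          (λ z → nz (≡.trans (M⁺-≥ r j≤k) z))))
        where
        j≤k = ℕₚ.<⇒≤ j<k
        j≤k′ = ℕₚ.≤-pred (ℕₚ.≤-trans j<k (ℕₚ.≤-reflexive (≡.sym k′→k)))

    OnTimeSchedule : Schedule m b → Set _
    OnTimeSchedule (schedule X M) = OnTime u X M

    step-onTime : {S S′ : Schedule m b} → _⟶_ u S S′ → OnTimeSchedule S → OnTimeSchedule S′
    step-onTime (deleteZero X M j Xj≈0)          = deleteZero-onTime X M j Xj≈0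
    step-onTime (deleteRedundant X M j′ j red)   = deleteRedundant-onTime X M j′ j red
    step-onTime (removeSwitch X M i i′ j′ j sw)  = removeSwitch-onTime X M i i′ j′ j sw

    steps-onTime : {S S′ : Schedule m b} → Star (_⟶_ u) S S′ → OnTimeSchedule S → OnTimeSchedule S′
    steps-onTime ε        = λ onTime → onTime
    steps-onTime (s ◅ ss) = steps-onTime ss ∘ step-onTime s

    measureOf : Schedule m b → ℕ × ℕ
    measureOf (schedule X M) = measure M

    Progress : Schedule m b → Set _
    Progress S = StandardForm u S ⊎
      (¬ StandardForm u S × ∃ λ S′ → _⟶_ u S S′ × measureOf S′ ≺ measureOf S)

    -- One fixed order of the removals is enough for existence, whereas `step-onTime` covers every
    -- order. Being on time enters through `unshared`, on which the drop of the measure rests.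
    progress : (S : Schedule m b) → OnTimeSchedule S → Progress S
    progress {m} (schedule {n} X M) onTime
      with Finₚ.any? (λ j → X j ≟ 0#)
         | Finₚ.any? (λ j′ → Finₚ.any? λ j →
           (suc (toℕ j′) ℕₚ.≟ toℕ j) ×-dec Finₚ.all? λ i → M i j Finₚ.≟ M i j′)
         | Finₚ.any? (λ i → Finₚ.any? λ i′ → Finₚ.any? λ j′ → Finₚ.any? λ j →
             (suc (toℕ j′) ℕₚ.≟ toℕ j) ×-dec ¬? (i Finₚ.≟ i′) ×-dec (M i j Finₚ.≟ M i′ j′) ×-dec
             ¬? (M i j Finₚ.≟ zero) ×-dec (t u X M i j′ ≟ t u X M i′ j′))
    progress (schedule {suc n} X M) onTime | yes (j , Xj≈0) | _ | _ =
      inj₂ ((λ std → StandardForm.noZeroColumn std j Xj≈0) ,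
            _ , deleteZero X M j Xj≈0 , inj₁ ℕₚ.≤-refl)
    progress (schedule {suc n} X M) onTime | no _ | yes (j′ , j , red) | _ =
      inj₂ ((λ std → StandardForm.noRedundantColumn std j′ j red) ,
            _ , deleteRedundant X M j′ j red , inj₁ ℕₚ.≤-refl)
    progress (schedule X M) onTime | no _ | no _ | yes
      (i , i′ , j′ , j , sw@(j′→j , i≢i′ , same , nonzero , _)) =
      inj₂ ((λ std → StandardForm.noSwapSwitch std i i′ j′ j sw) ,
            _ , removeSwitch X M i i′ j′ j sw ,
            inj₂ (≡.refl , totalBreaks-exchange M (OnTime.unshared onTime) j′→j i≢i′ same nonzero))
    progress (schedule X M) onTime | no ¬zero | no ¬red | no ¬sw = inj₁ record
      { noZeroColumn      = λ j Xj≈0 → ¬zero (j , Xj≈0)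
      ; noRedundantColumn = λ j′ j red → ¬red (j′ , j , red)
      ; noSwapSwitch      = λ i i′ j′ j sw → ¬sw (i , i′ , j′ , j , sw)
      }

    OnTimeMatrix : SizedMatrix m b → Set _
    OnTimeMatrix (sized M) = ∃ λ X → OnTime u X M

    module _ {m} (1≤m : 1 ℕ.≤ m) (u≤1 : ∀ k → u k ≤ 1#) where

      -- `S₀` is where the current run of `Standardize` began, and the path holds its steps so far.
      -- Solving the linear program changes only the lengths, which the measure ignores; if the
      -- result is not in standard form, the first removal of the next run is made at once, so that
      -- the recursive call has a smaller measure.
      repeat-exists : ∀ (S₀ S : Schedule m b) → Star (_⟶_ u) S₀ S → OnTimeSchedule S →
                      Acc _≺_ (measureOf S) → ∃ (RepeatUntil u S₀)
      repeat-exists S₀ (schedule {n} X M) path onTime (acc rs) = settle (progress (schedule X M) onTime)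
        where
        iterate : StandardForm u (schedule X M) → ∀ X′ → InducedPartition u M X′ → OnTime u X′ M →
                  Progress (schedule X′ M) → ∃ (RepeatUntil u S₀)
        iterate std X′ induced onTime′ (inj₁ std′) = sized M , exit (path , std) induced std′
        iterate std X′ induced onTime′ (inj₂ (¬std′ , S′ , step , S′≺)) =
          let (P , r) = repeat-exists (schedule X′ M) S′ (step ◅ ε) (step-onTime step onTime′) (rs S′≺)
          in P , again (path , std) induced ¬std′ r
        settle : Progress (schedule X M) → ∃ (RepeatUntil u S₀)
        settle (inj₂ (_ , S′ , step , S′≺S)) =
          repeat-exists S₀ S′ (path ◅◅ (step ◅ ε)) (step-onTime step onTime) (rs S′≺S)
        settle (inj₁ std) =
          let (X′ , induced) = inducedPartition-exists u 1≤m u≤1 onTime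
              onTime′ = inducedPartition-onTime u 1≤m u≤1 onTime induced
          in iterate std X′ induced onTime′ (progress (schedule X′ M) onTime′)

      repeat-onTime : ∀ {S : Schedule m b} {P} → RepeatUntil u S P → OnTimeSchedule S → OnTimeMatrix P
      repeat-onTime (exit (path , _) induced _)    onTime = _ , steps-onTime path onTime
      repeat-onTime (again (path , _) induced _ r) onTime = repeat-onTime r
        (inducedPartition-onTime u 1≤m u≤1 (steps-onTime path onTime) induced)

      reduce-exists : ∀ {P : SizedMatrix m b} → OnTimeMatrix P → ∃ (Reduce u P)
      reduce-exists {sized M} (X , onTime) =
        let (X′ , induced) = inducedPartition-exists u 1≤m u≤1 onTime
            (P , r) = repeat-exists (schedule X′ M) (schedule X′ M) ε
                        (inducedPartition-onTime u 1≤m u≤1 onTime induced) (≺-wellFounded _)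
        in P , X′ , induced , r

      reduce-onTime : ∀ {P Q : SizedMatrix m b} → Reduce u P Q → OnTimeMatrix P → OnTimeMatrix Q
      reduce-onTime {sized M} (X′ , induced , r) (X , onTime) =
        repeat-onTime r (inducedPartition-onTime u 1≤m u≤1 onTime induced)

-- Labels of the concatenated matrices

data SplitView {m n} : Fin (m ℕ.+ n) → Set where
  left  : (i : Fin m) → SplitView (i ↑ˡ n)
  right : (i : Fin n) → SplitView (m ↑ʳ i)

splitView : ∀ m {n} (i : Fin (m ℕ.+ n)) → SplitView {m} i
splitView zero    i    = right i
splitView (suc m) zero = left zero
splitView (suc m) (suc i) with splitView m i
... | left  i′ = left (suc i′)
... | right i′ = right i′

nonzero-label : ∀ {k} (x : Label k) → x ≢ zero → ∃ λ p → x ≡ suc p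
nonzero-label zero    x≢0 = contradiction ≡.refl x≢0
nonzero-label (suc p) _   = p , ≡.refl

module Layouts (w k : ℕ) where

  -- What the blocks of DP[0], …, DP[l - 1] preserve: in the last column, the
  -- bikes are either in the first w + l rows or not below their own row.
  record Layout {n} (l : ℕ) (M : Matrix (w ℕ.+ k) n k) : Set where
    field
      full     : ∀ j p → ∃ λ i → M i j ≡ suc p
      unshared : BikesUnshared M
      handover : ∀ i {j p} → suc (toℕ j) ≡ n → M i j ≡ suc p →
                 toℕ i ℕ.≤ w ℕ.+ toℕ p ⊎ toℕ i ℕ.< w ℕ.+ l

  -- Shift columns

  bikeAt : ℕ → Label k
  bikeAt d with d ℕₚ.<? k
  ... | yes d<k = suc (fromℕ< d<k)
  ... | no  _   = zero

  bikeAt-toℕ : ∀ p → bikeAt (toℕ p) ≡ suc p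
  bikeAt-toℕ p with toℕ p ℕₚ.<? k
  ... | yes p<k = ≡.cong suc (Finₚ.fromℕ<-toℕ p p<k)
  ... | no  p≮k = contradiction (Finₚ.toℕ<n p) p≮k

  bikeAt-≡ : ∀ {d p} → bikeAt d ≡ suc p → d ≡ toℕ p
  bikeAt-≡ {d} eq with d ℕₚ.<? k
  bikeAt-≡ ≡.refl | yes d<k = ≡.sym (Finₚ.toℕ-fromℕ< d<k)

  -- The entries of `shiftColumns`, continued to all natural row and column numbers, so that clocks
  -- and lengths can be defined by plain recursion.
  shiftLabel : (i j : ℕ) → Label k
  shiftLabel i j with j ℕₚ.≤? i
  ... | yes _ = bikeAt (i ∸ j)
  ... | no  _ = zero

  shiftLabel-≥ : ∀ {i j} → j ℕ.≤ i → shiftLabel i j ≡ bikeAt (i ∸ j)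
  shiftLabel-≥ {i} {j} j≤i with j ℕₚ.≤? i
  ... | yes _   = ≡.refl
  ... | no  j≰i = contradiction j≤i j≰i

  shiftLabel-< : ∀ {i j} → i ℕ.< j → shiftLabel i j ≡ zero
  shiftLabel-< {i} {j} i<j with j ℕₚ.≤? i
  ... | yes j≤i = contradiction i<j (ℕₚ.≤⇒≯ j≤i)
  ... | no  _   = ≡.refl

  shiftLabel-≡ : ∀ {i j p} → shiftLabel i j ≡ suc p → i ≡ j ℕ.+ toℕ p
  shiftLabel-≡ {i} {j} eq with j ℕₚ.≤? i
  ... | yes j≤i = ≡.trans (≡.sym (ℕₚ.m+[n∸m]≡n j≤i)) (≡.cong (j ℕ.+_) (bikeAt-≡ eq))

  shiftColumns-label : ∀ i j → shiftColumns w k i j ≡ shiftLabel (toℕ i) (toℕ j)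
  shiftColumns-label i j with toℕ j ℕₚ.≤? toℕ i
  ... | no  _ = ≡.refl
  ... | yes _ with (toℕ i ∸ toℕ j) ℕₚ.<? k
  ...   | yes _ = ≡.refl
  ...   | no  _ = ≡.refl

  shiftColumns-≡ : ∀ i j {p} → shiftColumns w k i j ≡ suc p → toℕ i ≡ toℕ j ℕ.+ toℕ p
  shiftColumns-≡ i j eq = shiftLabel-≡ (≡.trans (≡.sym (shiftColumns-label i j)) eq)

  shiftColumns-layout : Layout 0 (shiftColumns w k)
  shiftColumns-layout = record
    { full     = full
    ; unshared = λ i j nonzero i′ i′≢i same → let (p , eq) = nonzero-label _ nonzero in
        i′≢i (Finₚ.toℕ-injective (≡.trans (shiftColumns-≡ i′ j (≡.trans same eq))
          (≡.sym (shiftColumns-≡ i j eq))))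
    ; handover = λ i {j} _ eq → inj₁ (ℕₚ.≤-trans (ℕₚ.≤-reflexive (shiftColumns-≡ i j eq))
        (ℕₚ.+-monoˡ-≤ _ (ℕₚ.<⇒≤ (Finₚ.toℕ<n j))))
    }
    where
    full : ∀ j p → ∃ λ i → shiftColumns w k i j ≡ suc p
    full j p = fromℕ< row< , ≡.trans (shiftColumns-label (fromℕ< row<) j)
      (≡.trans (≡.cong (λ i → shiftLabel i (toℕ j)) (Finₚ.toℕ-fromℕ< row<))
      (≡.trans (shiftLabel-≥ (ℕₚ.m≤m+n (toℕ j) (toℕ p)))
      (≡.trans (≡.cong bikeAt (ℕₚ.m+n∸m≡n (toℕ j) (toℕ p))) (bikeAt-toℕ p))))
      where
      row< : toℕ j ℕ.+ toℕ p ℕ.< w ℕ.+ k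
      row< = ℕₚ.+-mono-< (Finₚ.toℕ<n j) (Finₚ.toℕ<n p)

  -- Blocks

  data RowView (l : ℕ) (i : Fin (w ℕ.+ k)) : Set where
    inner : toℕ i ℕ.< w ℕ.+ l → RowView l i
    own   : ∀ p → i ≡ w ↑ʳ p → l ℕ.≤ toℕ p → RowView l i

  rowView : ∀ l i → RowView l i
  rowView l i with toℕ i ℕₚ.<? w ℕ.+ l
  ... | yes i<w+l = inner i<w+l
  ... | no  i≮w+l with splitView w i
  ...   | left  r = contradiction
      (ℕₚ.≤-trans (ℕₚ.≤-trans (s≤s (ℕₚ.≤-reflexive (Finₚ.toℕ-↑ˡ r k))) (Finₚ.toℕ<n r))
                                    (ℕₚ.m≤m+n w l)) i≮w+l
  ...   | right p = own p ≡.refl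
      (ℕₚ.+-cancelˡ-≤ w _ _ (ℕₚ.≤-trans (ℕₚ.≮⇒≥ i≮w+l) (ℕₚ.≤-reflexive (Finₚ.toℕ-↑ʳ w p))))

  module _ {l n} (l≤k : l ℕ.≤ k) (P : Matrix (w ℕ.+ l) n l) where

    extend-inner : ∀ {i} (i<w+l : toℕ i ℕ.< w ℕ.+ l) j →
                   extend w l≤k P i j ≡ inject≤ (P (fromℕ< i<w+l) j) (s≤s l≤k)
    extend-inner {i} i<w+l j with toℕ i ℕₚ.<? w ℕ.+ l
    ... | yes _ = ≡.refl
    ... | no  i≮ = contradiction i<w+l i≮

    extend-own : ∀ p → l ℕ.≤ toℕ p → ∀ j → extend w l≤k P (w ↑ʳ p) j ≡ suc p
    extend-own p l≤p j with toℕ (w ↑ʳ p) ℕₚ.<? w ℕ.+ l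
    ... | yes i< = contradiction
        (ℕₚ.≤-trans i< (ℕₚ.≤-trans (ℕₚ.+-monoʳ-≤ w l≤p) (ℕₚ.≤-reflexive (≡.sym (Finₚ.toℕ-↑ʳ w p)))))
                                 (ℕₚ.<-irrefl ≡.refl)
    ... | no  _  = ≡.cong Sum.[ (λ _ → zero) , suc ]′ (Finₚ.splitAt-↑ʳ w k p)

    inner-label-< : ∀ {x : Label l} {p} → inject≤ x (s≤s l≤k) ≡ suc p → toℕ p ℕ.< l
    inner-label-< {x} eq = ℕₚ.≤-pred (ℕₚ.≤-trans (s≤s (ℕₚ.≤-reflexive
      (≡.trans (≡.cong toℕ (≡.sym eq)) (Finₚ.toℕ-inject≤ x (s≤s l≤k))))) (Finₚ.toℕ<n x))

    extend-< : ∀ {i j p} → toℕ i ℕ.< w ℕ.+ l → extend w l≤k P i j ≡ suc p → toℕ p ℕ.< l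
    extend-< {j = j} i< eq = inner-label-< (≡.trans (≡.sym (extend-inner i< j)) eq)

    extend-full : (∀ j p → ∃ λ i → P i j ≡ suc p) → ∀ j p → ∃ λ i → extend w l≤k P i j ≡ suc p
    extend-full full j p with ℕₚ.<-≤-connex (toℕ p) l
    ... | inj₂ l≤p = w ↑ʳ p , extend-own p l≤p j
    ... | inj₁ p<l with full j (fromℕ< p<l)
    ...   | r , Prj≡p = inject≤ r (ℕₚ.+-monoʳ-≤ w l≤k) , ≡.trans (extend-inner r< j)
      (≡.trans (≡.cong (λ x → inject≤ x (s≤s l≤k)) (≡.trans (≡.cong (λ i → P i j) r≡) Prj≡p))
        (≡.cong suc (Finₚ.toℕ-injective
          (≡.trans (Finₚ.toℕ-inject≤ (fromℕ< p<l) l≤k) (Finₚ.toℕ-fromℕ< p<l)))))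
      where
      toℕ-r = Finₚ.toℕ-inject≤ r (ℕₚ.+-monoʳ-≤ w l≤k)
      r< : toℕ (inject≤ r (ℕₚ.+-monoʳ-≤ w l≤k)) ℕ.< w ℕ.+ l
      r< = ℕₚ.≤-trans (s≤s (ℕₚ.≤-reflexive toℕ-r)) (Finₚ.toℕ<n r)
      r≡ : fromℕ< r< ≡ r
      r≡ = Finₚ.toℕ-injective (≡.trans (Finₚ.toℕ-fromℕ< r<) toℕ-r)

    inner-label-≡ : ∀ {i i′ j j′} (i< : toℕ i ℕ.< w ℕ.+ l) (i′< : toℕ i′ ℕ.< w ℕ.+ l) →
                    extend w l≤k P i j ≡ extend w l≤k P i′ j′ → P (fromℕ< i<) j ≡ P (fromℕ< i′<) j′
    inner-label-≡ {j = j} {j′} i< i′< same = Finₚ.inject≤-injective (s≤s l≤k) (s≤s l≤k) _ _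
      (≡.trans (≡.sym (extend-inner i< j)) (≡.trans same (extend-inner i′< j′)))

    inner-nonzero : ∀ {i j} (i< : toℕ i ℕ.< w ℕ.+ l) → extend w l≤k P i j ≢ zero → P (fromℕ< i<) j ≢ zero
    inner-nonzero {j = j} i< nonzero P≡0 =
      nonzero (≡.trans (extend-inner i< j) (≡.cong (λ x → inject≤ x (s≤s l≤k)) P≡0))

    data SameBike (i i′ : Fin (w ℕ.+ k)) : Set where
      inner : toℕ i ℕ.< w ℕ.+ l → toℕ i′ ℕ.< w ℕ.+ l → SameBike i i′
      own   : i ≡ i′ → SameBike i i′

    -- The rows of `P` use only bikes below `l`, and every other row keeps its own bike, which is at
    -- least `l`. So inside the block no bike passes between the two kinds of rows.
    sameBike : ∀ i i′ {j j′} → extend w l≤k P i j ≡ extend w l≤k P i′ j′ →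
               extend w l≤k P i j ≢ zero → SameBike i i′
    sameBike i i′ {j} {j′} same nonzero with rowView l i | rowView l i′
    ... | inner i<         | inner i′<           = inner i< i′<
    ... | inner i<         | own p ≡.refl l≤p    =
      contradiction (extend-< i< (≡.trans same (extend-own p l≤p j′))) (ℕₚ.≤⇒≯ l≤p)
    ... | own p ≡.refl l≤p | inner i′<           =
      contradiction (extend-< i′< (≡.trans (≡.sym same) (extend-own p l≤p j))) (ℕₚ.≤⇒≯ l≤p)
    ... | own p ≡.refl l≤p | own p′ ≡.refl l≤p′  = own (≡.cong (w ↑ʳ_) (Finₚ.suc-injective
      (≡.trans (≡.sym (extend-own p l≤p j)) (≡.trans same (extend-own p′ l≤p′ j′)))))

    extend-unshared : BikesUnshared P → BikesUnshared (extend w l≤k P)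
    extend-unshared unshared i j nonzero i′ i′≢i same with sameBike i i′ (≡.sym same) nonzero
    ... | own i≡i′     = i′≢i (≡.sym i≡i′)
    ... | inner i< i′< = unshared (fromℕ< i<) j (inner-nonzero i< nonzero) (fromℕ< i′<)
      (i′≢i ∘ Finₚ.toℕ-injective ∘ λ eq → ≡.trans (≡.sym (Finₚ.toℕ-fromℕ< i′<))
        (≡.trans (≡.cong toℕ eq) (Finₚ.toℕ-fromℕ< i<)))
      (inner-label-≡ i′< i< same)

    append-layout : ∀ {n₀} {M : Matrix (w ℕ.+ k) n₀ k} → Layout l M →
      (∀ j p → ∃ λ i → P i j ≡ suc p) → BikesUnshared P → Layout (suc l) (λ i → M i ++ extend w l≤k P i)
    append-layout {n₀} {M} layout full-P unshared-P = record
      { full = full⁺ ; unshared = unshared⁺ ; handover = handover⁺ }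
      where
      open Layout layout
      N = extend w l≤k P
      full⁺ : ∀ j p → ∃ λ i → (M i ++ N i) j ≡ suc p
      full⁺ j p with splitView n₀ j
      ... | left a  = proj₁ (full a p) , ≡.trans (lookup-++ˡ (M _) (N _) a) (proj₂ (full a p))
      ... | right a = proj₁ (extend-full full-P a p) ,
                      ≡.trans (lookup-++ʳ (M _) (N _) a) (proj₂ (extend-full full-P a p))
      unshared⁺ : BikesUnshared (λ i → M i ++ N i)
      unshared⁺ i j nonzero i′ i′≢i same with splitView n₀ j
      ... | left a  = unshared i a (λ z → nonzero (≡.trans (lookup-++ˡ (M i) (N i) a) z)) i′ i′≢i
        (≡.trans (≡.sym (lookup-++ˡ (M i′) (N i′) a)) (≡.trans same (lookup-++ˡ (M i) (N i) a)))
      ... | right a = extend-unshared unshared-P i a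
          (λ z → nonzero (≡.trans (lookup-++ʳ (M i) (N i) a) z)) i′ i′≢i
        (≡.trans (≡.sym (lookup-++ʳ (M i′) (N i′) a)) (≡.trans same (lookup-++ʳ (M i) (N i) a)))
      w+l<w+1+l = ℕₚ.+-monoʳ-< w (ℕₚ.n<1+n l)
      handover⁺ : ∀ i {j p} → suc (toℕ j) ≡ n₀ ℕ.+ n → (M i ++ N i) j ≡ suc p →
                  toℕ i ℕ.≤ w ℕ.+ toℕ p ⊎ toℕ i ℕ.< w ℕ.+ suc l
      handover⁺ i {j} {p} last eq with splitView n₀ j
      -- The last column can be an old one only if the appended block has no columns, and then it
      -- was the last one before.
      ... | left a  = Sum.map₂ (λ i< → ℕₚ.<-trans i< w+l<w+1+l) (handover i
        (ℕₚ.≤-antisym (Finₚ.toℕ<n a) (ℕₚ.≤-trans (ℕₚ.m≤m+n n₀ n)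
          (ℕₚ.≤-reflexive (≡.trans (≡.sym last) (≡.cong suc (Finₚ.toℕ-↑ˡ a n))))))
        (≡.trans (≡.sym (lookup-++ˡ (M i) (N i) a)) eq))
      ... | right a with rowView l i
      ...   | inner i<          = inj₂ (ℕₚ.<-trans i< w+l<w+1+l)
      ...   | own p′ ≡.refl l≤p′ =
          inj₁ (ℕₚ.≤-reflexive (≡.trans (Finₚ.toℕ-↑ʳ w p′) (≡.cong (λ p → w ℕ.+ toℕ p)
        (Finₚ.suc-injective (≡.trans (≡.sym (extend-own p′ l≤p′ a))
          (≡.trans (≡.sym (lookup-++ʳ (M _) (N _) a)) eq))))))

module _ {w : ℕ} where

  -- Tables can be compared only entry by entry. This carries the recurrence over to a table that
  -- was changed at a later entry.
  concatenation-cong : ∀ {k} {DP DP′ : Table w} l (l≤k : l ℕ.≤ k) → (∀ l′ → l′ ℕ.< l → DP l′ ≡ DP′ l′) →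
                       concatenation w k DP l l≤k ≡ concatenation w k DP′ l l≤k
  concatenation-cong         zero    _   _      = ≡.refl
  concatenation-cong {k} (suc l) l<k DP≡DP′ = ≡.cong₂ append
    (concatenation-cong l (ℕₚ.<⇒≤ l<k) λ l′ l′<l → DP≡DP′ l′ (ℕₚ.m<n⇒m<1+n l′<l)) (DP≡DP′ l ℕₚ.≤-refl)
    where
    append : SizedMatrix (w ℕ.+ k) k → SizedMatrix (w ℕ.+ l) l → SizedMatrix (w ℕ.+ k) k
    append (sized M) (sized P) = sized λ i → M i ++ extend w (ℕₚ.<⇒≤ l<k) P i

  setEntry : ∀ k → SizedMatrix (w ℕ.+ k) k → Table w → Table w
  setEntry k Q DP l with l ℕₚ.≟ k
  ... | yes ≡.refl = Q
  ... | no  _      = DP l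

  setEntry-same : ∀ k Q DP → setEntry k Q DP k ≡ Q
  setEntry-same k Q DP with k ℕₚ.≟ k
  ... | yes ≡.refl = ≡.refl
  ... | no  k≢k    = contradiction ≡.refl k≢k

  setEntry-other : ∀ {k} Q DP {l} → l ≢ k → DP l ≡ setEntry k Q DP l
  setEntry-other {k} Q DP {l} l≢k with l ℕₚ.≟ k
  ... | yes l≡k = contradiction l≡k l≢k
  ... | no  _   = ≡.refl

-- Timing of concatenated schedules

module Concatenations {c ℓ₁ ℓ₂} (F : OrderedField c ℓ₁ ℓ₂) where
  open OrderedField F
  open BikeSharing F
  open FieldProperties F
  open PrefixSums F
  open OnTimeSchedules F

  -- The agents of rank below s arrive together, the others later, in order.
  Ordered : ∀ {a} {R : Set a} → (R → ℕ) → ℕ → (R → Carrier) → Set _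
  Ordered rank s A = ∀ i i′ → rank i ℕ.≤ rank i′ ⊎ rank i ℕ.< s → A i ≤ A i′

  module _ {a} {R : Set a} {rank : R → ℕ} {s : ℕ} {A : R → Carrier} where

    ordered-together : Ordered rank s A → ∀ {i i′} → rank i ℕ.< s → rank i′ ℕ.< s → A i ≈ A i′
    ordered-together ordered i< i′< = antisym (ordered _ _ (inj₂ i<)) (ordered _ _ (inj₂ i′<))

    -- The induction step of every catch-up, in a shift column as in a block: agent `q` draws level
    -- with the group, which grows by one, while the ranks from `s` on merely stay in order.
    ordered-advance : ∀ q → rank q ≡ s → (∀ i → rank i ℕ.< s → A i ≈ A q) →
      (∀ i i′ → s ℕ.≤ rank i → rank i ℕ.≤ rank i′ → A i ≤ A i′) → Ordered rank (suc s) A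
    ordered-advance q q≡s sync mono i i′ rel with ℕₚ.<-cmp (rank i) s | ℕₚ.<-≤-connex (rank i′) s
    ... | tri< i<s _ _ | inj₁ i′<s = ≤-reflexive (trans (sync i i<s) (sym (sync i′ i′<s)))
    ... | tri< i<s _ _ | inj₂ s≤i′ = ≤-trans (≤-reflexive (sync i i<s))
      (mono q i′ (ℕₚ.≤-reflexive (≡.sym q≡s)) (ℕₚ.≤-trans (ℕₚ.≤-reflexive q≡s) s≤i′))
    ... | tri≈ _ i≡s _ | inj₁ i′<s = ≤-trans
      (mono i q (ℕₚ.≤-reflexive (≡.sym i≡s)) (ℕₚ.≤-reflexive (≡.trans i≡s (≡.sym q≡s))))
        (≤-reflexive (sym (sync i′ i′<s)))
    ... | tri≈ _ i≡s _ | inj₂ s≤i′ =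
        mono i i′ (ℕₚ.≤-reflexive (≡.sym i≡s)) (ℕₚ.≤-trans (ℕₚ.≤-reflexive i≡s) s≤i′)
    ... | tri> _ _ s<i | i′-cmp =
        mono i i′ (ℕₚ.<⇒≤ s<i) (Sum.[ id , (λ i≤s → contradiction s<i (ℕₚ.≤⇒≯ (ℕₚ.≤-pred i≤s))) ]′ rel)

  module _ {b} (u : Vector Carrier b) where

    arrival≈time : ∀ {m n} (X : Vector Carrier n) (M : Matrix m n b) i → arrival u X M i ≈ time u X M i n
    arrival≈time X M i = sym (prefix-all (leg u X M i))

    module _ {m n n′} (X : Vector Carrier n) (Y : Vector Carrier n′) (M : Matrix m n b)
      (N : Matrix m n′ b) where

      leg-++ : ∀ i k → leg u (X ++ Y) (λ i → M i ++ N i) i k ≡ (leg u X M i ++ leg u Y N i) k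
      leg-++ i k with splitView n k
      ... | left a  = ≡.trans (≡.cong₂ _*_ (≡.cong (pace u) (lookup-++ˡ (M i) (N i) a))
          (lookup-++ˡ X Y a))
                        (≡.sym (lookup-++ˡ (leg u X M i) (leg u Y N i) a))
      ... | right a = ≡.trans (≡.cong₂ _*_ (≡.cong (pace u) (lookup-++ʳ (M i) (N i) a))
          (lookup-++ʳ X Y a))
                        (≡.sym (lookup-++ʳ (leg u X M i) (leg u Y N i) a))

      time-++ˡ : ∀ i {c} → c ℕ.≤ n → time u (X ++ Y) (λ i → M i ++ N i) i c ≈ time u X M i c
      time-++ˡ i {c} c≤n = trans (prefix-cong c (reflexive ∘ leg-++ i))
        (prefix-++ˡ (leg u X M i) (leg u Y N i) c≤n)

      time-++ʳ : ∀ i c → time u (X ++ Y) (λ i → M i ++ N i) i (n ℕ.+ c) ≈ arrival u X M i + time u Y N i c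
      time-++ʳ i c = trans (prefix-cong (n ℕ.+ c) (reflexive ∘ leg-++ i))
        (prefix-++ʳ (leg u X M i) (leg u Y N i) c)

      arrival-++ : ∀ i → arrival u (X ++ Y) (λ i → M i ++ N i) i ≈ arrival u X M i + arrival u Y N i
      arrival-++ i = trans (sum-cong-≋ (reflexive ∘ leg-++ i)) (sum-++ (leg u X M i) (leg u Y N i))

      inTime-++ : InTime u X M →
        (∀ i i′ {j′ : Fin n} {j : Fin n′} → suc (toℕ j′) ≡ n → N i j ≡ M i′ j′ → N i j ≢ zero →
          arrival u X M i′ ≤ arrival u X M i) →
        (∀ i i′ {j′ j} → j′ PrecedesCol j → N i j ≡ N i′ j′ → N i j ≢ zero →
          arrival u X M i′ + time u Y N i′ (toℕ j) ≤ arrival u X M i + time u Y N i (toℕ j)) →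
        InTime u (X ++ Y) (λ i → M i ++ N i)
      inTime-++ first boundary second i i′ {j′} {j} j′→j same nonzero with splitView n j′ | splitView n j
      ... | left a′ | left a = ≤-respˡ-≈ (sym (time-++ˡ i′ a≤n)) (≤-respʳ-≈ (sym (time-++ˡ i a≤n))
        (≡.subst (λ c → time u X M i′ c ≤ time u X M i c) (≡.sym toℕ-a)
          (first i i′ (≡.trans (≡.cong suc (≡.sym (Finₚ.toℕ-↑ˡ a′ n′))) (≡.trans j′→j toℕ-a))
            (≡.trans (≡.sym (lookup-++ˡ (M i) (N i) a)) (≡.trans same (lookup-++ˡ (M i′) (N i′) a′)))
            (λ z → nonzero (≡.trans (lookup-++ˡ (M i) (N i) a) z)))))
        where
        toℕ-a = Finₚ.toℕ-↑ˡ a n′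
        a≤n : toℕ (a ↑ˡ n′) ℕ.≤ n
        a≤n = ℕₚ.≤-trans (ℕₚ.≤-reflexive toℕ-a) (ℕₚ.<⇒≤ (Finₚ.toℕ<n a))
      ... | left a′ | right a = ≤-respˡ-≈ (sym (at-n i′)) (≤-respʳ-≈ (sym (at-n i))
        (boundary i i′ {a′} {a} (≡.trans suc-a′ toℕ-a≡n)
          (≡.trans (≡.sym (lookup-++ʳ (M i) (N i) a)) (≡.trans same (lookup-++ˡ (M i′) (N i′) a′)))
          (λ z → nonzero (≡.trans (lookup-++ʳ (M i) (N i) a) z))))
        where
        suc-a′ : suc (toℕ a′) ≡ toℕ (n ↑ʳ a)
        suc-a′ = ≡.trans (≡.cong suc (≡.sym (Finₚ.toℕ-↑ˡ a′ n′))) j′→j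
        toℕ-a≡n : toℕ (n ↑ʳ a) ≡ n
        toℕ-a≡n = ℕₚ.≤-antisym (ℕₚ.≤-trans (ℕₚ.≤-reflexive (≡.sym suc-a′)) (Finₚ.toℕ<n a′))
          (ℕₚ.≤-trans (ℕₚ.m≤m+n n (toℕ a)) (ℕₚ.≤-reflexive (≡.sym (Finₚ.toℕ-↑ʳ n a))))
        at-n : ∀ i → time u (X ++ Y) (λ i → M i ++ N i) i (toℕ (n ↑ʳ a)) ≈ arrival u X M i
        at-n i = trans (reflexive (≡.cong (time u (X ++ Y) (λ i → M i ++ N i) i) toℕ-a≡n))
          (trans (time-++ˡ i ℕₚ.≤-refl) (prefix-all (leg u X M i)))
      ... | right a′ | left a = contradiction
        (ℕₚ.≤-trans (Finₚ.toℕ<n a)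
          (ℕₚ.≤-trans (ℕₚ.m≤m+n n (toℕ a′)) (ℕₚ.≤-reflexive (≡.sym (Finₚ.toℕ-↑ʳ n a′)))))
        (ℕₚ.≤⇒≯ (ℕₚ.≤-trans (ℕₚ.<⇒≤ (ℕₚ.≤-reflexive j′→j)) (ℕₚ.≤-reflexive (Finₚ.toℕ-↑ˡ a n′))))
      ... | right a′ | right a = ≤-respˡ-≈ (sym (at-a i′)) (≤-respʳ-≈ (sym (at-a i))
        (second i i′ (ℕₚ.+-cancelˡ-≡ n _ _ (≡.trans (ℕₚ.+-suc n (toℕ a′))
            (≡.trans (≡.cong suc (≡.sym (Finₚ.toℕ-↑ʳ n a′))) (≡.trans j′→j (Finₚ.toℕ-↑ʳ n a)))))
          (≡.trans (≡.sym (lookup-++ʳ (M i) (N i) a)) (≡.trans same (lookup-++ʳ (M i′) (N i′) a′)))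
          (λ z → nonzero (≡.trans (lookup-++ʳ (M i) (N i) a) z))))
        where
        at-a : ∀ i → time u (X ++ Y) (λ i → M i ++ N i) i (toℕ (n ↑ʳ a)) ≈ arrival u X M i + time u Y N i
          (toℕ a)
        at-a i = trans (reflexive (≡.cong (time u (X ++ Y) (λ i → M i ++ N i) i) (Finₚ.toℕ-↑ʳ n a)))
          (time-++ʳ i (toℕ a))

    time-scale : ∀ {m n} y (X : Vector Carrier n) (M : Matrix m n b) i c →
                 time u (λ j → y * X j) M i c ≈ y * time u X M i c
    time-scale y X M i c = trans
      (prefix-cong c λ k → solve 3 (λ p y x → p :* (y :* x) := y :* (p :* x)) refl (pace u (M i k)) y
        (X k))
      (prefix-scale y (leg u X M i) c)

    arrival-scale : ∀ {m n} y (X : Vector Carrier n) (M : Matrix m n b) i →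
                    arrival u (λ j → y * X j) M i ≈ y * arrival u X M i
    arrival-scale {n = n} y X M i = trans (arrival≈time (λ j → y * X j) M i)
      (trans (time-scale y X M i n) (*-congˡ (sym (arrival≈time X M i))))

    inTime-scale : ∀ {m n} {y} {X : Vector Carrier n} {M : Matrix m n b} → 0# ≤ y →
                   InTime u X M → InTime u (λ j → y * X j) M
    inTime-scale {y = y} {X} {M} 0≤y inTime i i′ {j = j} j′→j same nonzero =
      ≤-respˡ-≈ (sym (time-scale y X M i′ (toℕ j))) (≤-respʳ-≈ (sym (time-scale y X M i (toℕ j)))
        (*-monoˡ-≤ 0≤y (inTime i i′ j′→j same nonzero)))

  module _ {b} (u : Vector Carrier b) (u-mono : ∀ i j → i Fin.≤ j → u i ≤ u j) (w : ℕ) where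

    fastest : ∀ k → k ℕ.≤ b → Vector Carrier k
    fastest k k≤b r = u (inject≤ r k≤b)

    fastest-mono : ∀ {k} (k≤b : k ℕ.≤ b) p p′ → toℕ p ℕ.≤ toℕ p′ → fastest k k≤b p ≤ fastest k k≤b p′
    fastest-mono k≤b p p′ p≤p′ = u-mono _ _ (ℕₚ.≤-trans (ℕₚ.≤-reflexive (Finₚ.toℕ-inject≤ p k≤b))
      (ℕₚ.≤-trans p≤p′ (ℕₚ.≤-reflexive (≡.sym (Finₚ.toℕ-inject≤ p′ k≤b)))))

    module _ {k} (k≤b : k ℕ.≤ b) where
      open Layouts w k

      private
        U : Vector Carrier k
        U = fastest k k≤b

      -- All conditions are homogeneous in the lengths, whose sum is left free. Appending a block
      -- then leaves the earlier lengths alone, and a single rescaling at the end suffices.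
      record Timing {n} (l : ℕ) (X : Vector Carrier n) (M : Matrix (w ℕ.+ k) n k) : Set (c ⊔ ℓ₂) where
        field
          nonNegative : ∀ j → 0# ≤ X j
          inTime      : InTime U X M
          ordered     : Ordered toℕ (w ℕ.+ l) (arrival U X M)

      module _ {l n} (l<k : l ℕ.< k) (P : Matrix (w ℕ.+ l) n l) (Y : Vector Carrier n) (y : Carrier) where
        private
          l≤k : l ℕ.≤ k
          l≤k = ℕₚ.<⇒≤ l<k
          l≤b : l ℕ.≤ b
          l≤b = ℕₚ.≤-trans l≤k k≤b
          Uₗ : Vector Carrier l
          Uₗ = fastest l l≤b
          N : Matrix (w ℕ.+ k) n k
          N = extend w l≤k P
          y∙Y : Vector Carrier n
          y∙Y j = y * Y j

        pace-inject≤ : ∀ x → pace U (inject≤ x (s≤s l≤k)) ≡ pace Uₗ x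
        pace-inject≤ zero    = ≡.refl
        pace-inject≤ (suc p) = ≡.cong u (Finₚ.inject≤-idempotent p l≤k k≤b l≤b)

        time-inner : ∀ {i} (i< : toℕ i ℕ.< w ℕ.+ l) c → time U y∙Y N i c ≈ y * time Uₗ Y P (fromℕ< i<) c
        time-inner {i} i< c = trans (time-scale U y Y N i c) (*-congˡ (prefix-cong c λ j →
          *-congʳ (reflexive (≡.trans (≡.cong (pace U) (extend-inner l≤k P i< j))
            (pace-inject≤ (P (fromℕ< i<) j))))))

        time-own : ∀ p → l ℕ.≤ toℕ p → ∀ c → time U y∙Y N (w ↑ʳ p) c ≈ y * (U p * prefix Y c)
        time-own p l≤p c = trans (time-scale U y Y N (w ↑ʳ p) c) (*-congˡ (trans
          (prefix-cong c λ j → *-congʳ (reflexive (≡.cong (pace U) (extend-own l≤k P p l≤p j))))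
          (prefix-scale (U p) Y c)))

        module _ (onTime : OnTime Uₗ Y P) where
          open OnTime onTime

          arrival-inner : ∀ {i} → toℕ i ℕ.< w ℕ.+ l → arrival U y∙Y N i ≈ y * T (w ℕ.+ l) Uₗ
          arrival-inner {i} i< = trans (arrival≈time U y∙Y N i) (trans (time-inner i< n)
            (*-congˡ (trans (prefix-all (leg Uₗ Y P (fromℕ< i<))) (punctual (fromℕ< i<)))))

          arrival-own : ∀ p → l ℕ.≤ toℕ p → arrival U y∙Y N (w ↑ʳ p) ≈ y * U p
          arrival-own p l≤p = trans (arrival≈time U y∙Y N (w ↑ʳ p)) (trans (time-own p l≤p n)
            (*-congˡ (trans (*-congˡ (trans (prefix-all Y) (proj₂ isPartition))) (*-identityʳ (U p)))))

          module _ {n₀} {X : Vector Carrier n₀} {M : Matrix (w ℕ.+ k) n₀ k}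
                   (layout : Layout l M) (timing : Timing l X M) (0≤y : 0# ≤ y) where
            open Layout layout using (handover)
            open Timing timing renaming
              (inTime to inTime₀; nonNegative to nonNegative₀; ordered to ordered₀)
            private
              A : Fin (w ℕ.+ k) → Carrier
              A = arrival U X M

            append-inTime : InTime U (X ++ y∙Y) (λ i → M i ++ N i)
            append-inTime = inTime-++ U X y∙Y M N inTime₀ boundary within
              where
              boundary : ∀ i i′ {j′ : Fin n₀} {j : Fin n} → suc (toℕ j′) ≡ n₀ → N i j ≡ M i′ j′ →
                N i j ≢ zero → A i′ ≤ A i
              boundary i i′ {j′} {j} last same nonzero with nonzero-label (N i j) nonzero
              -- The giver `i′` is in the level group or not below row `w + p`. The taker `i` is in
              -- the group with `p` below `l`, which puts `i′` there too, or is row `w + p` itself.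
              -- In each case `i′` has arrived by the time `i` needs the bike.
              ... | p , Nij≡p with handover i′ last (≡.trans (≡.sym same) Nij≡p) | rowView l i
              ...   | inj₂ i′< | _        = ordered₀ i′ i (inj₂ i′<)
              ...   | inj₁ i′≤ | inner i< = ordered₀ i′ i (inj₂ (ℕₚ.≤-trans (s≤s i′≤)
                                              (ℕₚ.+-monoʳ-< w (extend-< l≤k P i< Nij≡p))))
              ...   | inj₁ i′≤ | own p′ ≡.refl l≤p′ = ordered₀ i′ i (inj₁ (ℕₚ.≤-trans i′≤ (ℕₚ.≤-reflexive
                        (≡.trans (≡.cong (λ p → w ℕ.+ toℕ p)
                          (Finₚ.suc-injective (≡.trans (≡.sym Nij≡p) (extend-own l≤k P p′ l≤p′ j))))
                          (≡.sym (Finₚ.toℕ-↑ʳ w p′))))))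
              within : ∀ i i′ {j′ j} → j′ PrecedesCol j → N i j ≡ N i′ j′ → N i j ≢ zero →
                A i′ + time U y∙Y N i′ (toℕ j) ≤ A i + time U y∙Y N i (toℕ j)
              within i i′ {j′} {j} j′→j same nonzero with sameBike l≤k P i i′ same nonzero
              ... | own ≡.refl   = ≤-refl
              -- The group enters the block level, so handovers inside it are those of the schedule
              -- `P`, scaled by `y`.
              ... | inner i< i′< = +-mono-≤ (ordered₀ i′ i (inj₂ i′<))
                (≤-respˡ-≈ (sym (time-inner i′< (toℕ j))) (≤-respʳ-≈ (sym (time-inner i< (toℕ j)))
                  (*-monoˡ-≤ 0≤y (inTime (fromℕ< i<) (fromℕ< i′<) j′→j
                    (inner-label-≡ l≤k P i< i′< same) (inner-nonzero l≤k P i< nonzero)))))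

            append-ordered : (∀ i → toℕ i ℕ.< w ℕ.+ l →
                A i + y * T (w ℕ.+ l) Uₗ ≈ A (w ↑ʳ fromℕ< l<k) + y * U (fromℕ< l<k)) →
              Ordered toℕ (w ℕ.+ suc l) (arrival U (X ++ y∙Y) (λ i → M i ++ N i))
            append-ordered sync = ≡.subst (λ s → Ordered toℕ s (arrival U (X ++ y∙Y) (λ i → M i ++ N i)))
              (≡.sym (ℕₚ.+-suc w l)) (ordered-advance q
                (≡.trans (Finₚ.toℕ-↑ʳ w (fromℕ< l<k)) (≡.cong (w ℕ.+_) (Finₚ.toℕ-fromℕ< l<k)))
                sync⁺ mono⁺)
              where
              q = w ↑ʳ fromℕ< l<k
              A⁺ : Fin (w ℕ.+ k) → Carrier
              A⁺ = arrival U (X ++ y∙Y) (λ i → M i ++ N i)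
              A⁺-own : ∀ p → l ℕ.≤ toℕ p → A⁺ (w ↑ʳ p) ≈ A (w ↑ʳ p) + y * U p
              A⁺-own p l≤p = trans (arrival-++ U X y∙Y M N (w ↑ʳ p)) (+-congˡ (arrival-own p l≤p))
              sync⁺ : ∀ i → toℕ i ℕ.< w ℕ.+ l → A⁺ i ≈ A⁺ q
              sync⁺ i i< = trans (arrival-++ U X y∙Y M N i)
                (trans (+-congˡ (arrival-inner i<)) (trans (sync i i<)
                (sym (A⁺-own (fromℕ< l<k) (ℕₚ.≤-reflexive (≡.sym (Finₚ.toℕ-fromℕ< l<k)))))))
              mono⁺ : ∀ i i′ → w ℕ.+ l ℕ.≤ toℕ i → toℕ i ℕ.≤ toℕ i′ → A⁺ i ≤ A⁺ i′
              mono⁺ i i′ ≤i i≤i′ with rowView l i | rowView l i′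
              ... | inner i< | _         = contradiction i< (ℕₚ.≤⇒≯ ≤i)
              ... | own _ _ _ | inner i′< = contradiction i′< (ℕₚ.≤⇒≯ (ℕₚ.≤-trans ≤i i≤i′))
              ... | own p ≡.refl l≤p | own p′ ≡.refl l≤p′ =
                  ≤-respˡ-≈ (sym (A⁺-own p l≤p)) (≤-respʳ-≈ (sym (A⁺-own p′ l≤p′))
                (+-mono-≤ (ordered₀ (w ↑ʳ p) (w ↑ʳ p′) (inj₁ i≤i′)) (*-monoˡ-≤ 0≤y (fastest-mono k≤b p p′
                  (ℕₚ.+-cancelˡ-≤ w _ _ (ℕₚ.≤-trans (ℕₚ.≤-reflexive (≡.sym (Finₚ.toℕ-↑ʳ w p)))
                    (ℕₚ.≤-trans i≤i′ (ℕₚ.≤-reflexive (Finₚ.toℕ-↑ʳ w p′)))))))))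

            append-timing : (∀ i → toℕ i ℕ.< w ℕ.+ l →
                A i + y * T (w ℕ.+ l) Uₗ ≈ A (w ↑ʳ fromℕ< l<k) + y * U (fromℕ< l<k)) →
              Timing (suc l) (X ++ y∙Y) (λ i → M i ++ N i)
            append-timing sync = record
              { nonNegative = nonNegative⁺ ; inTime = append-inTime ; ordered = append-ordered sync }
              where
              nonNegative⁺ : ∀ j → 0# ≤ (X ++ y∙Y) j
              nonNegative⁺ j with splitView n₀ j
              ... | left a  = ≤-respʳ-≈ (reflexive (≡.sym (lookup-++ˡ X y∙Y a))) (nonNegative₀ a)
              ... | right a = ≤-respʳ-≈ (reflexive (≡.sym (lookup-++ʳ X y∙Y a)))
                  (*-nonNegative 0≤y (proj₁ isPartition a))

      zero-timing : ∀ {n} l (M : Matrix (w ℕ.+ k) n k) → Timing l (λ _ → 0#) M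
      zero-timing l M = record
        { nonNegative = λ _ → ≤-refl
        ; inTime      = λ i i′ {_} {j} _ _ _ → ≤-reflexive
            (trans (time≈0 i′ (toℕ j)) (sym (time≈0 i (toℕ j))))
        ; ordered     = λ i i′ _ → ≤-reflexive (trans (arrival≈0 i) (sym (arrival≈0 i′)))
        }
        where
        time≈0 : ∀ i c → time U (λ _ → 0#) M i c ≈ 0#
        time≈0 i c = prefix-zero (λ j → zeroʳ (pace U (M i j))) c
        arrival≈0 : ∀ i → arrival U (λ _ → 0#) M i ≈ 0#
        arrival≈0 i = sum-zero {f = leg U (λ _ → 0#) M i} λ j → zeroʳ (pace U (M i j))

      -- Once all agents are level, the column totals determine their common time: multiplied by the
      -- number of agents it is `totalPace`, whatever the lengths are. The recursion for the lengths
      -- never has to be evaluated.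
      normalise : ∀ {n} {X : Vector Carrier n} {M : Matrix (w ℕ.+ k) n k} → 1 ℕ.≤ k →
        Layout k M → Timing k X M → 0# < sum X → OnTime U (λ j → sum X ⁻¹ * X j) M
      normalise {n} {X} {M} 1≤k layout timing 0<σ = record
        { full        = full
        ; unshared    = unshared
        ; isPartition = isPartition
        ; inTime      = inTime-scale U 0≤σ⁻¹ inTime
        ; punctual    = λ i → *-cancelˡ-≈ (·1-positive 1≤m) (begin
            m · 1# * arrival U X′ M i       ≈⟨ sum-const m (arrival U X′ M i) ⟨
            sum {m} (λ _ → arrival U X′ M i) ≈⟨ sum-cong-≋ {m} (λ i′ → trans (arrival-scale U σ⁻¹ X M i)
                 (trans (*-congˡ (ordered-together ordered (Finₚ.toℕ<n i) (Finₚ.toℕ<n i′)))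
                   (sym (arrival-scale U σ⁻¹ X M i′)))) ⟩
            sum (arrival U X′ M)            ≈⟨ Σarrival-≈ U X′ M full unshared ⟩
            totalPace m U * sum X′          ≈⟨ trans (*-congˡ (proj₂ isPartition))
              (*-identityʳ (totalPace m U)) ⟩
            totalPace m U                   ≈⟨ m*T≈totalPace 1≤m U ⟨
            m · 1# * T m U                  ∎)
        }
        where
        open SetoidReasoning setoid
        open Layout layout
        open Timing timing
        m = w ℕ.+ k
        1≤m : 1 ℕ.≤ m
        1≤m = ℕₚ.≤-trans 1≤k (ℕₚ.m≤n+m k w)
        σ⁻¹ = sum X ⁻¹
        0≤σ⁻¹ : 0# ≤ σ⁻¹
        0≤σ⁻¹ = ⁻¹-nonNegative 0<σ
        X′ : Vector Carrier n
        X′ j = σ⁻¹ * X j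
        isPartition : IsPartition U X′ M
        isPartition = (λ j → *-nonNegative 0≤σ⁻¹ (nonNegative j)) ,
          trans (sym (*-distribˡ-sum σ⁻¹ X))
            (trans (*-comm σ⁻¹ (sum X)) (⁻¹-inverseʳ (sum X) (proj₂ 0<σ ∘ sym)))

-- Lengths of the columns and blocks, and the table of the dynamic program

module DynamicProgram {c ℓ₁ ℓ₂} (F : OrderedField c ℓ₁ ℓ₂) where
  open OrderedField F
  open BikeSharing F
  open FieldProperties F
  open PrefixSums F
  open OnTimeSchedules F
  open Standardization F
  open Concatenations F

  module _ {b} (u : Vector Carrier b) (u-mono : ∀ i j → i Fin.≤ j → u i ≤ u j)
           (u<1 : ∀ k → u k < 1#) (w : ℕ) where

    private
      U : ∀ {k} → k ℕ.≤ b → Vector Carrier k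
      U {k} k≤b = fastest u u-mono w k k≤b

    -- Shift columns

    module _ {k} (1≤k : 1 ℕ.≤ k) (k≤b : k ℕ.≤ b) where
      open Layouts w k

      private
        u₁ : Carrier
        u₁ = pace (U k≤b) (bikeAt 0)

      pace-≤1 : ∀ l → pace (U k≤b) l ≤ 1#
      pace-≤1 zero    = ≤-refl
      pace-≤1 (suc p) = proj₁ (u<1 (inject≤ p k≤b))

      -- Bikes are sorted, and past the last one the label is walking, which is the slowest of all.
      bikeAt-mono : ∀ {d d′} → d ℕ.≤ d′ → pace (U k≤b) (bikeAt d) ≤ pace (U k≤b) (bikeAt d′)
      bikeAt-mono {d} {d′} d≤d′ with d′ ℕₚ.<? k | d ℕₚ.<? k
      ... | no  _    | yes d<k = pace-≤1 (suc (fromℕ< d<k))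
      ... | no  _    | no  _   = ≤-refl
      ... | yes d′<k | no  d≮k = contradiction (ℕₚ.≤-<-trans d≤d′ d′<k) d≮k
      ... | yes d′<k | yes d<k =
          fastest-mono u u-mono w k≤b _ _ (ℕₚ.≤-trans (ℕₚ.≤-reflexive (Finₚ.toℕ-fromℕ< d<k))
        (ℕₚ.≤-trans d≤d′ (ℕₚ.≤-reflexive (≡.sym (Finₚ.toℕ-fromℕ< d′<k)))))

      0<1-u₁ : 0# < 1# - u₁
      0<1-u₁ = 0<y-x (≡.subst (λ l → pace (U k≤b) l < 1#)
        (≡.sym (≡.trans (≡.cong bikeAt (≡.sym (Finₚ.toℕ-fromℕ< 1≤k))) (bikeAt-toℕ (fromℕ< 1≤k))))
        (u<1 (inject≤ (fromℕ< 1≤k) k≤b)))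

      -- clock c i is the time of agent i after c shift columns. The length of
      -- column c lets agent c, on the first bike, reach the agents below it.
      clock  : ℕ → ℕ → Carrier
      weight : ℕ → Carrier
      clock zero    i = 0#
      clock (suc c) i = clock c i + pace (U k≤b) (shiftLabel i c) * weight c
      weight zero     = 1#
      weight (suc c)  = (1# - u₁) ⁻¹ * (clock (suc c) (suc c) - clock (suc c) 0)

      private
        -- Nonnegative lengths and ordered clocks depend on each other. Taking the order at `c` as
        -- an argument makes the lemma available inside the induction of `clock-ordered`.
        weight-nonNegative′ : ∀ c → Ordered id c (clock c) → 0# ≤ weight c
        weight-nonNegative′ zero    _       = 0≤1
        weight-nonNegative′ (suc c) ordered = *-nonNegative (⁻¹-nonNegative 0<1-u₁)
          (0≤y-x (ordered 0 (suc c) (inj₁ z≤n)))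

        -- While the group walks, agent `c` rides the first bike and gains `(1# - u₁) * weight c`.
        -- The length was chosen to make this the whole gap, with row 0 standing for the group.
        catchUp : ∀ c → Ordered id c (clock c) → ∀ {i} → i ℕ.< c →
          clock c i + weight c ≈ clock c c + u₁ * weight c
        catchUp (suc c) ordered {i} i<c = begin
          x + z                      ≈⟨ solve 3
            (λ x z u → x :+ z := x :+ (:1 :- u) :* z :+ u :* z) refl x z u₁ ⟩
          x + (1# - u₁) * z + u₁ * z ≈⟨ +-congʳ (+-congˡ (*-⁻¹-cancel (proj₂ 0<1-u₁) (y - x₀))) ⟩
          x + (y - x₀) + u₁ * z      ≈⟨ +-congʳ
            (+-congˡ (+-congˡ (-‿cong (ordered-together ordered {0} {i} (s≤s z≤n) i<c)))) ⟩
          x + (y - x) + u₁ * z       ≈⟨ +-congʳ (solve 2 (λ x y → x :+ (y :- x) := y) refl x y) ⟩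
          y + u₁ * z                 ∎
          where
          open SetoidReasoning setoid
          x  = clock (suc c) i
          x₀ = clock (suc c) 0
          y  = clock (suc c) (suc c)
          z  = weight (suc c)

      clock-ordered : ∀ c → Ordered id c (clock c)
      clock-ordered zero    i i′ _ = ≤-refl
      clock-ordered (suc c) = ordered-advance c ≡.refl sync mono
        where
        ordered = clock-ordered c
        label-c : shiftLabel c c ≡ bikeAt 0
        label-c = ≡.trans (shiftLabel-≥ (ℕₚ.≤-refl {c})) (≡.cong bikeAt (ℕₚ.n∸n≡0 c))
        sync : ∀ i → i ℕ.< c → clock (suc c) i ≈ clock (suc c) c
        sync i i<c = trans
          (+-congˡ (trans (*-congʳ (reflexive (≡.cong (pace (U k≤b)) (shiftLabel-< i<c))))
            (*-identityˡ (weight c))))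
          (trans (catchUp c ordered i<c)
            (+-congˡ (*-congʳ (reflexive (≡.cong (pace (U k≤b)) (≡.sym label-c))))))
        mono : ∀ i i′ → c ℕ.≤ i → i ℕ.≤ i′ → clock (suc c) i ≤ clock (suc c) i′
        mono i i′ c≤i i≤i′ = +-mono-≤ (ordered i i′ (inj₁ i≤i′))
          (*-monoʳ-≤ (weight-nonNegative′ c ordered)
          (≡.subst₂ (λ l l′ → pace (U k≤b) l ≤ pace (U k≤b) l′)
            (≡.sym (shiftLabel-≥ c≤i)) (≡.sym (shiftLabel-≥ (ℕₚ.≤-trans c≤i i≤i′)))
            (bikeAt-mono (ℕₚ.∸-monoˡ-≤ c i≤i′))))

      weight-nonNegative : ∀ c → 0# ≤ weight c
      weight-nonNegative c = weight-nonNegative′ c (clock-ordered c)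

      shiftLengths : ∀ n → Vector Carrier n
      shiftLengths n j = weight (toℕ j)

      shiftLengths-positive : ∀ {n} → 1 ℕ.≤ n → 0# < sum (shiftLengths n)
      shiftLengths-positive {suc n} _ = <-≤-trans 0<1
        (x≤x+d (sum-nonNegative {f = shiftLengths (suc n) ∘ suc}
          (λ j → weight-nonNegative (suc (toℕ j)))) refl)

      shift-time : ∀ i {c} → c ℕ.≤ w →
        time (U k≤b) (shiftLengths w) (shiftColumns w k) i c ≈ clock c (toℕ i)
      shift-time i {zero}  _   = refl
      shift-time i {suc c} c<w =
        trans (≡.subst (λ d → prefix f (suc d) ≈ prefix f d + f j) toℕ-j (prefix-suc f j))
        (+-cong (shift-time i (ℕₚ.<⇒≤ c<w)) (*-cong
          (reflexive (≡.cong (pace (U k≤b))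
            (≡.trans (shiftColumns-label i j) (≡.cong (shiftLabel (toℕ i)) toℕ-j))))
          (reflexive (≡.cong weight toℕ-j))))
        where
        j = fromℕ< c<w
        toℕ-j = Finₚ.toℕ-fromℕ< c<w
        f = leg (U k≤b) (shiftLengths w) (shiftColumns w k) i

      shift-timing : Timing u u-mono w k≤b 0 (shiftLengths w) (shiftColumns w k)
      shift-timing = record
        { nonNegative = λ j → weight-nonNegative (toℕ j)
        ; inTime      = inTime
        ; ordered     = λ i i′ rel → ≤-respˡ-≈ (sym (arrival≈clock i)) (≤-respʳ-≈ (sym (arrival≈clock i′))
            (clock-ordered w (toℕ i) (toℕ i′)
              (Sum.map₂ (λ i< → ℕₚ.≤-trans i< (ℕₚ.≤-reflexive (ℕₚ.+-identityʳ w))) rel)))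
        }
        where
        arrival≈clock : ∀ i → arrival (U k≤b) (shiftLengths w) (shiftColumns w k) i ≈ clock w (toℕ i)
        arrival≈clock i = trans (arrival≈time (U k≤b) (shiftLengths w) (shiftColumns w k) i)
          (shift-time i ℕₚ.≤-refl)
        inTime : InTime (U k≤b) (shiftLengths w) (shiftColumns w k)
        -- Bike `p` is on the diagonal of rows `j + p`, so it passes to a later row, whose clock is
        -- not behind.
        inTime i i′ {j′} {j} j′→j same nonzero =
          let (p , eq) = nonzero-label _ nonzero
              i≡  = shiftColumns-≡ i j eq
              i′≡ = shiftColumns-≡ i′ j′ (≡.trans (≡.sym same) eq)
              j≤w = ℕₚ.<⇒≤ (Finₚ.toℕ<n j)
              i′≤i = ℕₚ.≤-trans (ℕₚ.≤-reflexive i′≡) (ℕₚ.≤-trans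
                (ℕₚ.+-monoˡ-≤ (toℕ p) (ℕₚ.≤-trans (ℕₚ.n≤1+n (toℕ j′)) (ℕₚ.≤-reflexive j′→j)))
                  (ℕₚ.≤-reflexive (≡.sym i≡)))
          in ≤-respˡ-≈ (sym (shift-time i′ j≤w)) (≤-respʳ-≈ (sym (shift-time i j≤w))
               (clock-ordered (toℕ j) (toℕ i′) (toℕ i) (inj₁ i′≤i)))

    private
      saving : Vector Carrier b
      saving j = 1# - u j

    -- Up to the factor w + j, this is T - u j, where T is the arrival time of
    -- w + j agents with the bikes before j (see T-slack).
    slack : Fin b → Carrier
    slack j = (w ℕ.+ toℕ j) · 1# * saving j - prefix saving (toℕ j)

    -- The difference of the two values is `w + j + 1` times `u j′ - u j`.
    slack-step : ∀ j j′ → suc (toℕ j) ≡ toℕ j′ → slack j′ ≤ slack j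
    slack-step j j′ j→j′ = x≤x+d (*-nonNegative (·1-nonNegative (suc (w ℕ.+ toℕ j)))
      (0≤y-x (+-mono-≤ ≤-refl (neg-mono-≤
        (u-mono j j′ (ℕₚ.≤-trans (ℕₚ.n≤1+n (toℕ j)) (ℕₚ.≤-reflexive j→j′)))))))
      (sym (trans (+-congʳ (+-cong
          (*-congʳ (reflexive (≡.cong (_· 1#)
            (≡.trans (≡.cong (w ℕ.+_) (≡.sym j→j′)) (ℕₚ.+-suc w (toℕ j))))))
          (-‿cong (trans (reflexive (≡.cong (prefix saving) (≡.sym j→j′))) (prefix-suc saving j)))))
        (solve 4 (λ N d d′ S → (:1 :+ N) :* d′ :- (S :+ d) :+ (:1 :+ N) :* (d :- d′) := N :* d :- S)
          refl ((w ℕ.+ toℕ j) · 1#) (saving j) (saving j′) (prefix saving (toℕ j)))))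

    slack-antitone : ∀ j j′ → toℕ j ℕ.≤ toℕ j′ → slack j′ ≤ slack j
    slack-antitone j j′ j≤j′ = ≡.subst (λ i → slack i ≤ slack j) (Finₚ.fromℕ<-toℕ j′ (Finₚ.toℕ<n j′))
      (go (toℕ j′) (Finₚ.toℕ<n j′) j≤j′)
      where
      equal : ∀ {c} (c<b : c ℕ.< b) → toℕ j ≡ c → slack (fromℕ< c<b) ≤ slack j
      equal c<b j≡c = ≤-reflexive (reflexive (≡.cong slack
        (Finₚ.toℕ-injective (≡.trans (Finₚ.toℕ-fromℕ< c<b) (≡.sym j≡c)))))
      go : ∀ c (c<b : c ℕ.< b) → toℕ j ℕ.≤ c → slack (fromℕ< c<b) ≤ slack j
      go zero    c<b j≤c = equal c<b (ℕₚ.n≤0⇒n≡0 j≤c)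
      go (suc c) c<b j≤c = Sum.[ (λ j<c → ≤-trans
          (slack-step (fromℕ< (ℕₚ.<⇒≤ c<b)) (fromℕ< c<b)
            (≡.trans (≡.cong suc (Finₚ.toℕ-fromℕ< (ℕₚ.<⇒≤ c<b))) (≡.sym (Finₚ.toℕ-fromℕ< c<b))))
          (go c (ℕₚ.<⇒≤ c<b) (ℕₚ.≤-pred j<c)))
        , equal c<b ]′ (ℕₚ.m≤n⇒m<n∨m≡n j≤c)

    T-slack : ∀ {l} (l<b : l ℕ.< b) → 1 ℕ.≤ w ℕ.+ l →
      (w ℕ.+ l) · 1# * (T (w ℕ.+ l) (U (ℕₚ.<⇒≤ l<b)) - u (fromℕ< l<b)) ≈ slack (fromℕ< l<b)
    T-slack {l} l<b 1≤w+l = begin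
      N * (T (w ℕ.+ l) Uₗ - u j)
        ≈⟨ solve 3 (λ N t u → N :* (t :- u) := N :* t :- N :* u) refl N (T (w ℕ.+ l) Uₗ) (u j) ⟩
      N * T (w ℕ.+ l) Uₗ - N * u j
        ≈⟨ +-congʳ (trans (m*T≈totalPace 1≤w+l Uₗ) (+-congˡ (-‿cong (sum-inject≤ saving (ℕₚ.<⇒≤ l<b))))) ⟩
      N - prefix saving l - N * u j
        ≈⟨ solve 3 (λ N s u → N :- s :- N :* u := N :* (:1 :- u) :- s) refl N (prefix saving l) (u j) ⟩
      N * saving j - prefix saving l
        ≈⟨ reflexive (≡.cong (λ l → (w ℕ.+ l) · 1# * saving j - prefix saving l)
        (≡.sym (Finₚ.toℕ-fromℕ< l<b))) ⟩
      slack j                                      ∎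
      where
      open SetoidReasoning setoid
      j = fromℕ< l<b
      N = (w ℕ.+ l) · 1#
      Uₗ = U (ℕₚ.<⇒≤ l<b)

    -- The hypothesis compares `u j` with the T that already counts bike `j`, and `slack` with the T
    -- before it. Since `N′ = N + 1` and `N′ T′ = N T + u j`, the products `N′ (T′ - u j)` and
    -- `N (T - u j)` agree.
    last-slack : ∀ j → suc (toℕ j) ≡ b → u j ≤ T (w ℕ.+ b) u → 0# ≤ slack j
    last-slack j j-last u≤T = ≤-respʳ-≈ (begin
      N′ * T (w ℕ.+ b) u - N′ * u j
        ≈⟨ +-cong (m*T≈totalPace 1≤w+b u) (-‿cong (*-congʳ N′≈)) ⟩
      N′ - sum saving - (1# + N) * u j
        ≈⟨ +-congʳ (+-cong N′≈ (-‿cong (trans (sym (prefix-all saving))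
             (trans (reflexive (≡.cong (prefix saving) (≡.sym j-last))) (prefix-suc saving j))))) ⟩
      1# + N - (prefix saving (toℕ j) + (1# - u j)) - (1# + N) * u j
        ≈⟨ solve 3 (λ N s u → :1 :+ N :- (s :+ (:1 :- u)) :- (:1 :+ N) :* u := N :* (:1 :- u) :- s) refl N
          (prefix saving (toℕ j)) (u j) ⟩
      slack j ∎)
      (0≤y-x (*-monoˡ-≤ (·1-nonNegative (w ℕ.+ b)) u≤T))
      where
      open SetoidReasoning setoid
      N = (w ℕ.+ toℕ j) · 1#
      N′ = (w ℕ.+ b) · 1#
      w+b≡ : w ℕ.+ b ≡ suc (w ℕ.+ toℕ j)
      w+b≡ = ≡.trans (≡.cong (w ℕ.+_) (≡.sym j-last)) (ℕₚ.+-suc w (toℕ j))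
      N′≈ : N′ ≈ 1# + N
      N′≈ = reflexive (≡.cong (_· 1#) w+b≡)
      1≤w+b : 1 ℕ.≤ w ℕ.+ b
      1≤w+b = ≡.subst (1 ℕ.≤_) (≡.sym w+b≡) (s≤s z≤n)

    -- The concatenated matrices

    module _ {k} (1≤k : 1 ℕ.≤ k) (k≤b : k ℕ.≤ b) (DP : Table w)
             (good : ∀ l → l ℕ.< k → (l≤b : l ℕ.≤ b) → OnTimeMatrix (U l≤b) (DP l)) where
      open Layouts w k

      concatenation-layout : ∀ l (l≤k : l ℕ.≤ k) →
        Layout l (SizedMatrix.matrix (concatenation w k DP l l≤k))
      concatenation-layout zero    _   = shiftColumns-layout
      concatenation-layout (suc l) l<k = append-layout (ℕₚ.<⇒≤ l<k) (SizedMatrix.matrix (DP l))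
        (concatenation-layout l (ℕₚ.<⇒≤ l<k)) full unshared
        where
        onTime = proj₂ (good l l<k (ℕₚ.≤-trans (ℕₚ.<⇒≤ l<k) k≤b))
        open OnTime onTime using (full; unshared)

      module _ {l} (l<k : l ℕ.< k) where
        private
          l≤k : l ℕ.≤ k
          l≤k = ℕₚ.<⇒≤ l<k
          l<b : l ℕ.< b
          l<b = ℕₚ.≤-trans l<k k≤b
          l≤b : l ℕ.≤ b
          l≤b = ℕₚ.<⇒≤ l<b
          Y = proj₁ (good l l<k l≤b)
          onTime = proj₂ (good l l<k l≤b)
          T₀ : Carrier
          T₀ = T (w ℕ.+ l) (U l≤b)
          u₀ : Carrier
          u₀ = U k≤b (fromℕ< l<k)
          q : Fin (w ℕ.+ k)
          q = w ↑ʳ fromℕ< l<k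
          M = SizedMatrix.matrix (concatenation w k DP l l≤k)

        gap≈slack : 1 ℕ.≤ w ℕ.+ l → (w ℕ.+ l) · 1# * (T₀ - u₀) ≈ slack (fromℕ< l<b)
        gap≈slack 1≤w+l = trans (*-congˡ (+-congˡ (-‿cong (reflexive (≡.cong u (Finₚ.toℕ-injective
          (≡.trans (Finₚ.toℕ-inject≤ (fromℕ< l<k) k≤b)
            (≡.trans (Finₚ.toℕ-fromℕ< l<k) (≡.sym (Finₚ.toℕ-fromℕ< l<b))))))))))
          (T-slack l<b 1≤w+l)

        gap-zero : slack (fromℕ< l<b) ≈ 0# → 1 ℕ.≤ w ℕ.+ l → T₀ ≈ u₀
        gap-zero slack≈0 1≤w+l = +-cancelʳ-≈ (- u₀) (trans
          (*-cancelˡ-≈ (·1-positive 1≤w+l) (trans (gap≈slack 1≤w+l) (trans slack≈0 (sym (zeroʳ _)))))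
          (sym (-‿inverseʳ u₀)))

        gap-positive : 0# < slack (fromℕ< l<b) → 1 ℕ.≤ w ℕ.+ l → 0# < T₀ - u₀
        gap-positive 0<slack 1≤w+l = ≰⇒> λ gap≤0 → <⇒≰ 0<slack
          (≤-respˡ-≈ (gap≈slack 1≤w+l) (≤-respʳ-≈ (zeroʳ _) (*-monoˡ-≤ (·1-nonNegative (w ℕ.+ l)) gap≤0)))

        appendBlock : ∀ (X : Vector Carrier (SizedMatrix.size (concatenation w k DP l l≤k))) y →
          Timing u u-mono w k≤b l X M → 0# ≤ y →
          (∀ i → toℕ i ℕ.< w ℕ.+ l → arrival (U k≤b) X M i + y * T₀ ≈ arrival (U k≤b) X M q + y * u₀) →
          ∃ λ X⁺ → Timing u u-mono w k≤b (suc l) X⁺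
            (SizedMatrix.matrix (concatenation w k DP (suc l) l<k)) ×
                   sum X⁺ ≈ sum X + y
        appendBlock X y timing 0≤y sync = (X ++ λ j → y * Y j) ,
          append-timing u u-mono w k≤b l<k (SizedMatrix.matrix (DP l)) Y y onTime
            (concatenation-layout l l≤k) timing 0≤y sync ,
          trans (sum-++ X (λ j → y * Y j)) (+-congˡ (trans (sym (*-distribˡ-sum y Y))
            (trans (*-congˡ (proj₂ (OnTime.isPartition onTime))) (*-identityʳ y))))

        -- If the new bike is as slow as the schedule DP[l], this schedule is
        -- used all the way.
        degenerateBlock : slack (fromℕ< l<b) ≈ 0# →
          ∃ λ X → Timing u u-mono w k≤b (suc l) X
            (SizedMatrix.matrix (concatenation w k DP (suc l) l<k)) × 0# < sum X
        degenerateBlock slack≈0 =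
          let (X , timing , ΣX≈) = appendBlock (λ _ → 0#) 1# (zero-timing u u-mono w k≤b l M) 0≤1
                λ i i< → +-cong (trans (arrival≈0 i) (sym (arrival≈0 q)))
                  -- The row `i` itself witnesses `1 ≤ w + l`. For `w + l = 0` there is nobody to be
                  -- level with and the condition is vacuous.
                  (*-congˡ (gap-zero slack≈0 (ℕₚ.≤-trans (s≤s z≤n) i<)))
          in X , timing , <-≤-trans 0<1
               (≤-reflexive (sym (trans ΣX≈ (trans (+-congʳ Σ0≈0) (+-identityˡ 1#)))))
          where
          Σ0≈0 : sum {SizedMatrix.size (concatenation w k DP l l≤k)} (λ _ → 0#) ≈ 0#
          Σ0≈0 = sum-replicate-zero (SizedMatrix.size (concatenation w k DP l l≤k))
          arrival≈0 : ∀ i → arrival (U k≤b) (λ _ → 0#) M i ≈ 0#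
          arrival≈0 i = sum-zero {f = leg (U k≤b) (λ _ → 0#) M i} λ j → zeroʳ (pace (U k≤b) (M i j))

        strictBlock : 1 ℕ.≤ w → 0# < slack (fromℕ< l<b) →
          (∃ λ X → Timing u u-mono w k≤b l X M × 0# < sum X) →
          ∃ λ X → Timing u u-mono w k≤b (suc l) X
            (SizedMatrix.matrix (concatenation w k DP (suc l) l<k)) × 0# < sum X
        strictBlock 1≤w 0<slack (X₀ , timing₀ , 0<ΣX₀) =
          let (X , timing , ΣX≈) = appendBlock X₀ y timing₀ 0≤y sync
          in X , timing , <-≤-trans 0<ΣX₀ (x≤x+d 0≤y ΣX≈)
          where
          open Timing timing₀
          A : Fin (w ℕ.+ k) → Carrier
          A = arrival (U k≤b) X₀ M
          r : Fin (w ℕ.+ k)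
          r = fromℕ< (ℕₚ.≤-trans 1≤w (ℕₚ.m≤m+n w k))
          r< : toℕ r ℕ.< w ℕ.+ l
          r< = ℕₚ.≤-trans (s≤s (ℕₚ.≤-reflexive (Finₚ.toℕ-fromℕ< (ℕₚ.≤-trans 1≤w (ℕₚ.m≤m+n w k)))))
            (ℕₚ.≤-trans 1≤w (ℕₚ.m≤m+n w l))
          0<gap : 0# < T₀ - u₀
          0<gap = gap-positive 0<slack (ℕₚ.≤-trans 1≤w (ℕₚ.m≤m+n w l))
          -- The solution of `A r + y * T₀ ≈ A q + y * u₀`. Agent `r` is row 0, which represents the
          -- level group.
          y : Carrier
          y = (T₀ - u₀) ⁻¹ * (A q - A r)
          0≤y : 0# ≤ y
          0≤y = *-nonNegative (⁻¹-nonNegative 0<gap) (0≤y-x (ordered r q (inj₂ r<)))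
          sync : ∀ i → toℕ i ℕ.< w ℕ.+ l → A i + y * T₀ ≈ A q + y * u₀
          sync i i< = begin
            A i + y * T₀                   ≈⟨ solve 4
              (λ a y t u → a :+ y :* t := a :+ (t :- u) :* y :+ y :* u) refl (A i) y T₀ u₀ ⟩
            A i + (T₀ - u₀) * y + y * u₀   ≈⟨ +-congʳ (+-congˡ (*-⁻¹-cancel (proj₂ 0<gap) (A q - A r))) ⟩
            A i + (A q - A r) + y * u₀
              ≈⟨ +-congʳ (+-congˡ (+-congˡ (-‿cong (ordered-together ordered r< i<)))) ⟩
            A i + (A q - A i) + y * u₀
              ≈⟨ solve 3 (λ a a′ v → a :+ (a′ :- a) :+ v := a′ :+ v) refl (A i) (A q) (y * u₀) ⟩
            A q + y * u₀                   ∎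
            where open SetoidReasoning setoid

      strictBlocks : 1 ℕ.≤ w → ∀ l (l≤k : l ℕ.≤ k) → (∀ j → toℕ j ℕ.< l → 0# < slack j) →
        ∃ λ X → Timing u u-mono w k≤b l X (SizedMatrix.matrix (concatenation w k DP l l≤k)) × 0# < sum X
      strictBlocks 1≤w zero    _   _       =
        shiftLengths 1≤k k≤b w , shift-timing 1≤k k≤b , shiftLengths-positive 1≤k k≤b 1≤w
      strictBlocks 1≤w (suc l) l<k 0<slack = strictBlock l<k 1≤w
        (0<slack _ (s≤s (ℕₚ.≤-reflexive (Finₚ.toℕ-fromℕ< (ℕₚ.≤-trans l<k k≤b)))))
        (strictBlocks 1≤w l (ℕₚ.<⇒≤ l<k) λ j j<l → 0<slack j (ℕₚ.m<n⇒m<1+n j<l))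

    -- For `w = 0` the slack of the first bike is zero times its saving minus an empty sum, and the
    -- later ones are no larger. So the strict case always has a shift column, which makes the sum
    -- of the lengths positive.
    positive-slack⇒1≤w : ∀ j → 0# < slack j → 1 ℕ.≤ w
    positive-slack⇒1≤w j 0<slack =
      ℕₚ.≰⇒> λ w≤0 → <⇒≰ 0<slack (≤-trans (slack-antitone j₀ j (ℕₚ.≤-trans (ℕₚ.≤-reflexive toℕ-j₀) z≤n))
      (≤-reflexive (≡.subst₂ (λ w l → (w ℕ.+ l) · 1# * (1# - u j₀) - prefix (λ j → 1# - u j) l ≈ 0#)
        (≡.sym (ℕₚ.n≤0⇒n≡0 w≤0)) (≡.sym toℕ-j₀) (solve 1 (λ d → :0 :* d :- :0 := :0) refl (1# - u j₀)))))
      where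
      0<b : 0 ℕ.< b
      0<b = ℕₚ.≤-trans (s≤s z≤n) (Finₚ.toℕ<n j)
      j₀ : Fin b
      j₀ = fromℕ< 0<b
      toℕ-j₀ : toℕ j₀ ≡ 0
      toℕ-j₀ = Finₚ.toℕ-fromℕ< 0<b

    module _ (0≤slack : ∀ j → 0# ≤ slack j) where

      concatenation-onTime : ∀ {k} → 1 ℕ.≤ k → (k≤b : k ℕ.≤ b) (DP : Table w) →
        (∀ l → l ℕ.< k → (l≤b : l ℕ.≤ b) → OnTimeMatrix (U l≤b) (DP l)) →
        OnTimeMatrix (U k≤b) (concatenation w k DP k ℕₚ.≤-refl)
      concatenation-onTime {suc l} 1≤k k≤b DP good = finish (by-slack (slack j ≟ 0#))
        where
        j = fromℕ< k≤b
        Result : Set _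
        Result = ∃ λ X → Timing u u-mono w k≤b (suc l) X
          (SizedMatrix.matrix (concatenation w (suc l) DP (suc l) ℕₚ.≤-refl)) × 0# < sum X
        finish : Result → OnTimeMatrix (U k≤b) (concatenation w (suc l) DP (suc l) ℕₚ.≤-refl)
        finish (X , timing , 0<ΣX) = _ ,
          normalise u u-mono w k≤b 1≤k
            (concatenation-layout 1≤k k≤b DP good (suc l) ℕₚ.≤-refl) timing 0<ΣX
        by-slack : Dec (slack j ≈ 0#) → Result
        by-slack (yes slack≈0) = degenerateBlock 1≤k k≤b DP good ℕₚ.≤-refl slack≈0
        -- Positivity at the last bike passes to all earlier ones because `slack` is antitone, so
        -- every block can be scaled.
        by-slack (no  slack≉0) = strictBlocks 1≤k k≤b DP good (positive-slack⇒1≤w j 0<slack)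
          (suc l) ℕₚ.≤-refl
          λ i i<1+l → <-≤-trans 0<slack (slack-antitone i j
            (ℕₚ.≤-trans (ℕₚ.≤-pred i<1+l) (ℕₚ.≤-reflexive (≡.sym (Finₚ.toℕ-fromℕ< k≤b)))))
          where
          0<slack : 0# < slack j
          0<slack = 0≤slack j , slack≉0 ∘ sym

      -- The table of AllMakeIt*

      -- The bound `n` allows the table to be filled one entry at a time; for `n = b` the record
      -- amounts to `IsDPTable`.
      record DPTableUpTo (n : ℕ) (DP : Table w) : Set (c ⊔ ℓ₁ ⊔ ℓ₂) where
        field
          base : DP 0 ≡ sized {size = 1} (λ _ _ → zero)
          step : ∀ k → 1 ℕ.≤ k → k ℕ.≤ n → (k≤b : k ℕ.≤ b) →
                 Reduce (U k≤b) (concatenation w k DP k ℕₚ.≤-refl) (DP k)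

      walk-onTime : OnTimeMatrix (U z≤n) {m = w ℕ.+ 0} (sized {size = 1} (λ _ _ → zero))
      walk-onTime = (λ _ → 1#) , record
        { full        = λ _ ()
        ; unshared    = λ _ _ nonzero → contradiction ≡.refl nonzero
        ; isPartition = (λ _ → 0≤1) , +-identityʳ 1#
        ; inTime      = λ { _ _ {_} {zero} () }
        ; punctual    = λ _ → solve 1 (λ N → :1 :* :1 :+ :0 := :1 :- N :* :0) refl (((w ℕ.+ 0) · 1#) ⁻¹)
        }

      U≤1 : ∀ {k} (k≤b : k ℕ.≤ b) p → U k≤b p ≤ 1#
      U≤1 k≤b p = proj₁ (u<1 (inject≤ p k≤b))

      -- This concerns any table that satisfies the recurrence, not only the one constructed below,
      -- and so reaches every execution of the algorithm.
      table-onTime : ∀ {n DP} → DPTableUpTo n DP → ∀ k → k ℕ.≤ n → (k≤b : k ℕ.≤ b) →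
        OnTimeMatrix (U k≤b) (DP k)
      table-onTime {n} {DP} table k = go (suc k) k ℕₚ.≤-refl
        where
        open DPTableUpTo table
        -- `s` is fuel for a strong induction, as entry `k` is built from all earlier entries.
        go : ∀ s k → k ℕ.< s → k ℕ.≤ n → (k≤b : k ℕ.≤ b) → OnTimeMatrix (U k≤b) (DP k)
        go (suc s) zero    _   _   _   =
          ≡.subst (OnTimeMatrix (U z≤n) {m = w ℕ.+ 0}) (≡.sym base) walk-onTime
        go (suc s) (suc k) (s≤s k<s) k<n k≤b = reduce-onTime (U k≤b) 1≤m (U≤1 k≤b)
          (step (suc k) (s≤s z≤n) k<n k≤b)
          (concatenation-onTime (s≤s z≤n) k≤b DP λ l l<1+k → go s l (ℕₚ.≤-trans l<1+k k<s)
            (ℕₚ.≤-trans (ℕₚ.≤-pred l<1+k) (ℕₚ.<⇒≤ k<n)))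
          where
          1≤m : 1 ℕ.≤ w ℕ.+ suc k
          1≤m = ℕₚ.≤-trans (s≤s z≤n) (ℕₚ.m≤n+m (suc k) w)

      table-exists : ∀ n → n ℕ.≤ b → ∃ (DPTableUpTo n)
      table-exists zero    _   = (λ _ → sized {size = 1} λ _ _ → zero) , record
        { base = ≡.refl
        ; step = λ { (suc k) _ () }
        }
      table-exists (suc n) n<b =
        let (DP , table) = table-exists n (ℕₚ.<⇒≤ n<b)
            (Q , reduce) = reduce-exists (U n<b) (ℕₚ.≤-trans (s≤s z≤n) (ℕₚ.m≤n+m (suc n) w)) (U≤1 n<b)
              (concatenation-onTime (s≤s z≤n) n<b DP λ l l<1+n → table-onTime table l (ℕₚ.≤-pred l<1+n))
        in setEntry (suc n) Q DP , extended DP Q table reduce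
        where
        extended : ∀ DP Q → DPTableUpTo n DP →
          Reduce (U n<b) (concatenation w (suc n) DP (suc n) ℕₚ.≤-refl) Q →
                   DPTableUpTo (suc n) (setEntry (suc n) Q DP)
        extended DP Q table reduce = record
          { base = ≡.trans (≡.sym (other 0 (s≤s z≤n))) (DPTableUpTo.base table)
          ; step = λ k 1≤k k≤1+n k≤b → step k 1≤k k≤b (ℕₚ.m≤n⇒m<n∨m≡n k≤1+n)
          }
          where
          other : ∀ l → l ℕ.< suc n → DP l ≡ setEntry (suc n) Q DP l
          other l l<1+n = setEntry-other Q DP (ℕₚ.<⇒≢ l<1+n)
          step : ∀ k → 1 ℕ.≤ k → (k≤b : k ℕ.≤ b) → k ℕ.< suc n ⊎ k ≡ suc n →
                 Reduce (U k≤b) (concatenation w k (setEntry (suc n) Q DP) k ℕₚ.≤-refl)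
                   (setEntry (suc n) Q DP k)
          step k 1≤k k≤b (inj₁ k<1+n) = ≡.subst₂ (Reduce (U k≤b))
            (concatenation-cong k ℕₚ.≤-refl λ l l<k → other l (ℕₚ.<-trans l<k k<1+n)) (other k k<1+n)
            (DPTableUpTo.step table k 1≤k (ℕₚ.≤-pred k<1+n) k≤b)
          step k 1≤k k≤b (inj₂ ≡.refl) = ≡.subst₂ (Reduce (U k≤b))
            (concatenation-cong k ℕₚ.≤-refl other) (≡.sym (setEntry-same k Q DP)) reduce

-- Change of speeds and of row indices

module Transport {c ℓ₁ ℓ₂} (F : OrderedField c ℓ₁ ℓ₂) where
  open OrderedField F
  open BikeSharing F
  open FieldProperties F
  open PrefixSums F
  open OnTimeSchedules F

  -- The last table entry is built for the speeds `u` composed with `inject≤`, which agree with `u`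
  -- only pointwise.
  onTime-cong : ∀ {m n b} {u u′ : Vector Carrier b} {X : Vector Carrier n} {M : Matrix m n b} →
                (∀ k → u k ≡ u′ k) → OnTime u X M → OnTime u′ X M
  onTime-cong {m} {b = b} {u} {u′} {X} {M} u≡u′ onTime = record
    { full        = full
    ; unshared    = unshared
    ; isPartition = isPartition
    ; inTime      = λ i i′ {_} {j} j′→j same nonzero → ≤-respˡ-≈ (prefix-cong (toℕ j) (legs i′))
        (≤-respʳ-≈ (prefix-cong (toℕ j) (legs i)) (inTime i i′ j′→j same nonzero))
    ; punctual    = λ i → trans (sum-cong-≋ (sym ∘ legs i)) (trans (punctual i)
        (+-congˡ (-‿cong (*-congˡ (sum-cong-≋ λ k → +-congˡ (-‿cong (reflexive (u≡u′ k))))))))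
    }
    where
    open OnTime onTime
    pace-≡ : ∀ l → pace u l ≡ pace u′ l
    pace-≡ Fin.zero    = ≡.refl
    pace-≡ (Fin.suc k) = u≡u′ k
    legs : ∀ i k → leg u X M i k ≈ leg u′ X M i k
    legs i k = *-congʳ (reflexive (pace-≡ (M i k)))

  onTime-cast : ∀ {m m′ n b} {u : Vector Carrier b} {X : Vector Carrier n} {M : Matrix m′ n b}
    (m≡m′ : m ≡ m′) →
                OnTime u X M → OnTime u X (λ i → M (cast m≡m′ i))
  onTime-cast {M = M} ≡.refl onTime = record
    { full        = λ j k → proj₁ (full j k) ,
        ≡.trans (≡.cong (λ i → M i j) (Finₚ.cast-is-id ≡.refl _)) (proj₂ (full j k))
    ; unshared    = λ i j nonzero i′ i′≢i → unshared (cast ≡.refl i) j nonzero (cast ≡.refl i′)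
        λ eq → i′≢i (≡.trans (≡.sym (Finₚ.cast-is-id ≡.refl i′)) (≡.trans eq (Finₚ.cast-is-id ≡.refl i)))
    ; isPartition = isPartition
    ; inTime      = λ i i′ → inTime (cast ≡.refl i) (cast ≡.refl i′)
    ; punctual    = λ i → punctual (cast ≡.refl i)
    }
    where open OnTime onTime

-- Existence of an execution and optimality of every execution

module Main {c ℓ₁ ℓ₂} (F : OrderedField c ℓ₁ ℓ₂) where
  open OrderedField F
  open BikeSharing F
  open FieldProperties F
  open OnTimeSchedules F
  open Standardization F
  open DynamicProgram F
  open Transport F

  module _ (m b : ℕ) (1≤b : 1 ℕ.≤ b) (b≤m : b ℕ.≤ m) (u : Vector Carrier b)
           (u-mono : ∀ i j → i Fin.≤ j → u i ≤ u j) (0<u<1 : ∀ k → 0# < u k × u k < 1#)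
           (u≤T : ∀ k → suc (toℕ k) ≡ b → u k ≤ T m u) where
    private
      w : ℕ
      w = m ∸ b
      w+b≡m : w ℕ.+ b ≡ m
      w+b≡m = ℕₚ.m∸n+n≡m b≤m
      1≤m : 1 ℕ.≤ m
      1≤m = ℕₚ.≤-trans 1≤b b≤m
      u<1 : ∀ k → u k < 1#
      u<1 k = proj₂ (0<u<1 k)
      u≤1 : ∀ k → u k ≤ 1#
      u≤1 k = proj₁ (u<1 k)

      lastBike : ∃ λ (k : Fin b) → suc (toℕ k) ≡ b
      lastBike = Fin.fromℕ< p<b , ≡.trans (≡.cong suc (Finₚ.toℕ-fromℕ< p<b)) 1+p≡b
        where
        1+p≡b : suc (ℕ.pred b) ≡ b
        1+p≡b = ℕₚ.suc-pred b ⦃ ℕ.>-nonZero 1≤b ⦄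
        p<b : ℕ.pred b ℕ.< b
        p<b = ℕₚ.≤-reflexive 1+p≡b

      0≤slack : ∀ j → 0# ≤ slack u u-mono u<1 w j
      0≤slack j = ≤-trans
        (last-slack u u-mono u<1 w k last (≡.subst (λ m → u k ≤ T m u) (≡.sym w+b≡m) (u≤T k last)))
        (slack-antitone u u-mono u<1 w j k
          (ℕₚ.≤-pred (ℕₚ.≤-trans (Finₚ.toℕ<n j) (ℕₚ.≤-reflexive (≡.sym last)))))
        where
        k = proj₁ lastBike
        last = proj₂ lastBike

      DPTable : ℕ → Table w → Set _
      DPTable = DPTableUpTo u u-mono u<1 w 0≤slack

    finalMatrix-onTime : ∀ {DP} → DPTable b DP → OnTimeMatrix u (finalMatrix b≤m DP)
    finalMatrix-onTime table =
      let (X , onTime) = table-onTime u u-mono u<1 w 0≤slack table b ℕₚ.≤-refl ℕₚ.≤-refl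
      in X , onTime-cast (≡.sym w+b≡m)
           (onTime-cong (λ k → ≡.cong u (Finₚ.inject≤-refl k ℕₚ.≤-refl)) onTime)

    allMakeIt-exists : ∃ (AllMakeIt* m u b≤m)
    allMakeIt-exists =
      let (DP , table) = table-exists u u-mono u<1 w 0≤slack b ℕₚ.≤-refl
          open DPTableUpTo table
          (X , induced) = inducedPartition-exists u 1≤m u≤1 (proj₂ (finalMatrix-onTime table))
      in _ , produces DP (record { base = base ; step = λ k 1≤k k≤b → step k 1≤k k≤b k≤b }) X induced

    allMakeIt-optimal : ∀ S → AllMakeIt* m u b≤m S → OptimalSchedule u S
    allMakeIt-optimal _ (produces DP isTable X induced) =
      onTime⇒feasible u onTime , λ S′ feasible → ≤-trans
        (maximum-least 1≤m (arrival u X M) (≤-reflexive ∘ OnTime.punctual onTime))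
        (T≤τ u 1≤m u≤1 {S′} feasible)
      where
      open SizedMatrix (finalMatrix b≤m DP) renaming (matrix to M)
      table : DPTable b DP
      table = record
        { base = IsDPTable.base isTable ; step = λ k 1≤k _ → IsDPTable.step isTable k 1≤k }
      onTime : OnTime u X M
      onTime = inducedPartition-onTime u 1≤m u≤1 (proj₂ (finalMatrix-onTime table)) induced

theorem11 : ∀ {c ℓ₁ ℓ₂} (F : OrderedField c ℓ₁ ℓ₂) →
    let open OrderedField F
        open BikeSharing F
    in
    ∀ (m b : ℕ) → 1 ℕ.≤ b → (b≤m : b ℕ.≤ m) →
    (u : Vector Carrier b) →
    (∀ i j → i Fin.≤ j → u i ≤ u j) →
    (∀ k → 0# < u k × u k < 1#) →
    (∀ k → suc (toℕ k) ≡ b → u k ≤ T m u) →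
    ∃ (AllMakeIt* m u b≤m) ×
    (∀ S → AllMakeIt* m u b≤m S → OptimalSchedule u S)
theorem11 F m b 1≤b b≤m u u-mono 0<u<1 u≤T =
  allMakeIt-exists m b 1≤b b≤m u u-mono 0<u<1 u≤T ,
  allMakeIt-optimal m b 1≤b b≤m u u-mono 0<u<1 u≤T
  where open Main F
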